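{- Let $r\ge 4$ be an integer, let $G$ be a graph with $t=\chi_{\mathrm f}(G)\ge 2$, and let $p\in(0,1)$. Suppose that for some $D\ge 0$, $$\mathbb P\bigl(\lambda_{<r}(G_p)\le D\bigr)>\frac1{2t}.$$ Then $$h_r^{\mathrm f}(G)\ge \frac{t}{(D+1)\bigl(8\log_{1/(1-p)}(2et)+4\bigr)}.$$ If, with probability greater than $1/(2t)$, the cycles of length less than $r$ in $G_p$ are pairwise vertex-disjoint, then $$h_r^{\mathrm f}(G)\ge \frac{t}{2\bigl(8\log_{1/(1-p)}(2et)+4\bigr)}.$$
   Context: All graphs are finite and simple; subgraphs need not be induced. $\chi_{\mathrm f}$ is the fractional chromatic number; $e$ in $2et$ is Euler's number. The girth of a forest is $\infty$. $G_p$ is the random spanning subgraph of $G$ obtained by retaining each edge independently with probability $p$. $h_r^{\mathrm f}(G)=\max\{\chi_{\mathrm f}(H):H\subseteq G,\ \operatorname{girth}(H)\ge r\}$. For a graph $X$, $\lambda_{<r}(X)$ is the maximum over $v\in V(X)$ of the number of cycles $C$ of $X$ with $3\le |C|<r$ and $v\in V(C)$. -}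

module Defs where

open import Algebra.Bundles using (CommutativeRing; Semiring)
import Algebra.Definitions.RawSemiring as RawSemiringDefs
open import Data.Bool.Base using (Bool; T; _∧_)
open import Data.Bool.Properties using (T?; T-∧)
open import Data.Empty using (⊥)
open import Data.Fin.Base as Fin using (Fin)
import Data.Fin.Properties as Fin
open import Data.Fin.Subset using (Subset; inside; outside; ∣_∣; ∁) renaming (_∈_ to _∈ₛ_; _⊆_ to _⊆ₛ_)
open import Data.Fin.Subset.Properties using () renaming (_∈?_ to _∈ₛ?_; _⊆?_ to _⊆ₛ?_)
open import Data.List.Base as List using (List; []; _∷_; _∷ʳ_; allFin; cartesianProduct; cartesianProductWith; concatMap; filter; foldr; head; last; length; map; upTo)
import Data.List.Extrema as Extrema
import Data.List.Extrema.Nat as ℕExtrema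
open import Data.List.Membership.Propositional using (_∈_)
import Data.List.Membership.DecPropositional as DecMembership
open import Data.List.Relation.Binary.Disjoint.Propositional using (Disjoint)
import Data.List.Relation.Binary.Disjoint.DecPropositional as DecDisjoint
open import Data.List.Relation.Unary.All using (All; all?)
open import Data.List.Relation.Unary.AllPairs using (AllPairs; allPairs?)
open import Data.List.Relation.Unary.Linked using (Linked; linked?)
open import Data.List.Relation.Unary.Unique.Propositional using (Unique)
import Data.List.Relation.Unary.Unique.DecPropositional as DecUnique
open import Data.Maybe.Relation.Binary.Connected using (Connected; connected?)
open import Data.Nat.Base as ℕ using (ℕ; zero; suc)
import Data.Nat.Properties as ℕ
open import Data.Product.Base using (_×_; _,_; ∃; ∃-syntax; Σ-syntax; proj₁; proj₂)
open import Data.Product.Properties using (≡-dec)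
open import Data.Sum.Base using (_⊎_; swap)
open import Data.Vec.Base as Vec using (Vec; []; _∷_)
open import Function.Base using (_∘_)
open import Function.Bundles using (module Equivalence)
open import Level using (0ℓ)
open import Relation.Binary.Bundles using (TotalOrder)
open import Relation.Binary.Core using (Rel)
import Relation.Binary.Construct.Add.Supremum.NonStrict as AddSupremum
import Relation.Binary.Construct.NonStrictToStrict as NonStrictToStrict
open import Relation.Binary.Definitions using () renaming (Decidable to Decidable₂)
open import Relation.Binary.Structures using (IsDecTotalOrder)
open import Relation.Nullary using (¬_; no)
open import Relation.Nullary.Construct.Add.Supremum using (_⁺; ⊤⁺; [_])
open import Relation.Nullary.Decidable using (¬?; ⌊_⌋; toWitness; fromWitness; _×-dec_; _⊎-dec_; _→-dec_)
open import Relation.Unary using (Pred; Decidable)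

-- The classical axioms for ℝ, which determine it up to isomorphism.
-- The operations _⁻¹ and sup are total; nothing is assumed about the
-- inverse of 0# or about sup of an empty or unbounded set.

record CompleteOrderedField : Set₁ where
  field
    commutativeRing : CommutativeRing 0ℓ 0ℓ

  open CommutativeRing commutativeRing public
  open RawSemiringDefs (Semiring.rawSemiring semiring) public using (_^_) renaming (_×_ to _·_)

  infix  4 _≤_
  infix  9 _⁻¹
  infixl 7 _/_

  field
    _≤_             : Rel Carrier 0ℓ
    isDecTotalOrder : IsDecTotalOrder _≈_ _≤_
    0≉1             : ¬ 0# ≈ 1#
    _⁻¹             : Carrier → Carrier
    *-inverseʳ      : ∀ x → ¬ x ≈ 0# → x * x ⁻¹ ≈ 1#
    +-monoˡ-≤       : ∀ z {x y} → x ≤ y → x + z ≤ y + z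
    *-nonneg        : ∀ {x y} → 0# ≤ x → 0# ≤ y → 0# ≤ x * y

  open IsDecTotalOrder isDecTotalOrder public using (_≤?_)
  open NonStrictToStrict _≈_ _≤_ public using (_<_)

  UpperBound : Pred Carrier 0ℓ → Pred Carrier 0ℓ
  UpperBound S b = ∀ x → S x → x ≤ b

  field
    sup       : Pred Carrier 0ℓ → Carrier
    sup-upper : ∀ S → ∃ S → ∃ (UpperBound S) → UpperBound S (sup S)
    sup-least : ∀ S → ∃ S → ∃ (UpperBound S) → ∀ b → UpperBound S b → sup S ≤ b

  inf : Pred Carrier 0ℓ → Carrier
  inf S = - sup (S ∘ -_)

  _/_ : Carrier → Carrier → Carrier
  x / y = x * y ⁻¹

  fromℕ : ℕ → Carrier
  fromℕ n = n · 1#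

  sumOver : ∀ {A : Set} → List A → (A → Carrier) → Carrier
  sumOver xs f = foldr (λ x s → f x + s) 0# xs

  factorial : ℕ → Carrier
  factorial zero    = 1#
  factorial (suc n) = fromℕ (suc n) * factorial n

  -- Euler's number Σ_k 1/k!, as the supremum of the partial sums.
  e : Carrier
  e = sup λ x → ∃[ n ] x ≈ sumOver (upTo n) (λ k → factorial k ⁻¹)

  -- The logarithm of x > 0 to base b > 1: the supremum of the rationals
  -- q = (i − j)/(n + 1) with b^q ≤ x, that is b^(i−j) ≤ x^(n+1).
  log : Carrier → Carrier → Carrier
  log b x = sup λ y → ∃[ i ] ∃[ j ] ∃[ n ]
    (y ≈ (fromℕ i - fromℕ j) / fromℕ (suc n)) × (b ^ i ≤ b ^ j * x ^ suc n)

-- Finite simple graphs whose vertices are drawn from Fin n.  The vertex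
-- set need not be all of Fin n, so that the subgraphs of a graph are again
-- of type Graph n.

record Graph (n : ℕ) : Set where
  field
    vertices : Subset n
    adj      : Fin n → Fin n → Bool

  Adj : Rel (Fin n) 0ℓ
  Adj u v = T (adj u v)

  field
    Adj-sym      : ∀ u v → Adj u v → Adj v u
    Adj-irrefl   : ∀ u → ¬ Adj u u
    Adj-vertices : ∀ u v → Adj u v → u ∈ₛ vertices

  adj? : Decidable₂ Adj
  adj? u v = T? (adj u v)

open Graph public

infix 4 _⊑_

_⊑_ : ∀ {n} → Rel (Graph n) 0ℓ
H ⊑ G = vertices H ⊆ₛ vertices G × (∀ u v → Adj H u v → Adj G u v)

-- All vectors of length k with entries in xs.
vectors : ∀ {A : Set} → List A → ∀ k → List (Vec A k)
vectors xs zero    = [] ∷ []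
vectors xs (suc k) = cartesianProductWith _∷_ xs (vectors xs k)

subsets : ∀ n → List (Subset n)
subsets = vectors (inside ∷ outside ∷ [])

-- A cycle subgraph is encoded by its vertices listed in cyclic order.  To
-- have exactly one list per cycle, the list starts at the least vertex of
-- the cycle and proceeds towards the smaller of its two neighbours.

IsCycle : ∀ {n} → Graph n → List (Fin n) → Set
IsCycle G []       = ⊥
IsCycle G (u ∷ vs) =
  3 ℕ.≤ length (u ∷ vs) ×
  Unique (u ∷ vs) ×
  Linked (Adj G) ((u ∷ vs) ∷ʳ u) ×
  All (u Fin.<_) vs ×
  Connected Fin._<_ (head vs) (last vs)

isCycle? : ∀ {n} (G : Graph n) → Decidable (IsCycle G)
isCycle? G []       = no λ ()
isCycle? G (u ∷ vs) =
  3 ℕ.≤? length (u ∷ vs) ×-dec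
  DecUnique.unique? Fin._≟_ (u ∷ vs) ×-dec
  linked? (adj? G) ((u ∷ vs) ∷ʳ u) ×-dec
  all? (u Fin.<?_) vs ×-dec
  connected? Fin._<?_ (head vs) (last vs)

cycles : ∀ {n} → Graph n → List (List (Fin n))
cycles {n} G =
  filter (isCycle? G)
    (concatMap (λ k → map Vec.toList (vectors (allFin n) k)) (upTo (suc n)))

open AddSupremum ℕ._≤_ public using (_≤⁺_; ≤⁺-isTotalOrder-≡)

ℕ∞-totalOrder : TotalOrder 0ℓ 0ℓ 0ℓ
ℕ∞-totalOrder = record { isTotalOrder = ≤⁺-isTotalOrder-≡ ℕ.≤-isTotalOrder }

girth : ∀ {n} → Graph n → ℕ ⁺
girth G = Extrema.min ℕ∞-totalOrder ⊤⁺ (map ([_] ∘ length) (cycles G))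

shortCycles : ∀ {n} → ℕ → Graph n → List (List (Fin n))
shortCycles r X = filter (λ c → length c ℕ.<? r) (cycles X)

-- λ_{<r}(X)
maxShortCycles : ∀ {n} → ℕ → Graph n → ℕ
maxShortCycles {n} r X =
  ℕExtrema.max 0
    (map (λ v → length (filter (v ∈?_) (shortCycles r X)))
         (filter (_∈ₛ? vertices X) (allFin n)))
  where open DecMembership (Fin._≟_ {n}) using (_∈?_)

DisjointShortCycles : ∀ {n} → ℕ → Pred (Graph n) 0ℓ
DisjointShortCycles r X = AllPairs Disjoint (shortCycles r X)

disjointShortCycles? : ∀ {n} r → Decidable (DisjointShortCycles {n} r)
disjointShortCycles? r X =
  allPairs? (DecDisjoint.disjoint? Fin._≟_) (shortCycles r X)

edges : ∀ {n} → Graph n → List (Fin n × Fin n)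
edges {n} G =
  filter (λ (u , v) → u Fin.<? v ×-dec adj? G u v)
    (cartesianProduct (allFin n) (allFin n))

select : ∀ {A : Set} (xs : List A) → Subset (length xs) → List A
select []       []            = []
select (x ∷ xs) (inside  ∷ ω) = x ∷ select xs ω
select (x ∷ xs) (outside ∷ ω) = select xs ω

-- The spanning subgraph of G retaining the edges indexed by ω.
spanning : ∀ {n} (G : Graph n) → Subset (length (edges G)) → Graph n
spanning {n} G ω = record
  { vertices     = vertices G
  ; adj          = λ u v → adj G u v ∧ ⌊ retained? u v ⌋
  ; Adj-sym      = λ u v uv → from T-∧
      ( Adj-sym G u v (proj₁ (to T-∧ uv))
      , fromWitness {a? = retained? v u}
          (swap (toWitness {a? = retained? u v} (proj₂ (to T-∧ uv)))) )
  ; Adj-irrefl   = λ u uu → Adj-irrefl G u (proj₁ (to T-∧ uu))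
  ; Adj-vertices = λ u v uv → Adj-vertices G u v (proj₁ (to T-∧ uv))
  }
  where
  open Equivalence using (to; from)
  open DecMembership (≡-dec (Fin._≟_ {n}) (Fin._≟_ {n})) using (_∈?_)

  Retained : Rel (Fin n) 0ℓ
  Retained u v = (u , v) ∈ select (edges G) ω ⊎ (v , u) ∈ select (edges G) ω

  retained? : Decidable₂ Retained
  retained? u v = (u , v) ∈? select (edges G) ω ⊎-dec (v , u) ∈? select (edges G) ω

Independent : ∀ {n} → Graph n → Pred (Subset n) 0ℓ
Independent G S =
  S ⊆ₛ vertices G × (∀ u → u ∈ₛ S → ∀ v → v ∈ₛ S → ¬ Adj G u v)

independent? : ∀ {n} (G : Graph n) → Decidable (Independent G)
independent? G S =
  S ⊆ₛ? vertices G ×-dec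
  Fin.all? λ u → u ∈ₛ? S →-dec Fin.all? λ v → v ∈ₛ? S →-dec ¬? (adj? G u v)

independentSets : ∀ {n} → Graph n → List (Subset n)
independentSets {n} G = filter (independent? G) (subsets n)

module GraphParameters (ℝ : CompleteOrderedField) where
  open CompleteOrderedField ℝ

  module _ {n} (G : Graph n) where

    -- Only the values of w on independent sets of G matter.
    record IsFractionalColouring (w : Subset n → Carrier) : Set where
      field
        nonneg : ∀ S → Independent G S → 0# ≤ w S
        covers : ∀ v → v ∈ₛ vertices G →
                 1# ≤ sumOver (filter (v ∈ₛ?_) (independentSets G)) w

    χf : Carrier
    χf = inf λ x → Σ[ w ∈ (Subset n → Carrier) ]
      IsFractionalColouring w × x ≈ sumOver (independentSets G) w

    -- ℙ p P? is the probability that G_p satisfies P.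
    ℙ : Carrier → {P : Pred (Graph n) 0ℓ} → Decidable P → Carrier
    ℙ p P? = sumOver (filter (P? ∘ spanning G) (subsets (length (edges G))))
      λ ω → p ^ ∣ ω ∣ * (1# - p) ^ ∣ ∁ ω ∣

  -- h_r^f(G); the supremum is over finitely many values.
  hf : ∀ {n} → ℕ → Graph n → Carrier
  hf {n} r G = sup λ x → Σ[ H ∈ Graph n ]
    H ⊑ G × [ r ] ≤⁺ girth H × x ≈ χf H

{-# OPTIONS --safe #-}

-- By linear programming duality there are weights μ ≥ 0 on V(G) with total
-- t in which every independent set of G has weight at most 1.  A subgraph
-- in which every independent set has weight at most m then has fractional
-- chromatic number at least its own weight over m.
--
-- Let x = 2et and q = 1 - p, and let d be least with q^d ≤ x⁻⁴.  With
-- probability at least 1 - 1/(2t), no independent set I of G_p has weight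
-- more than 2d + 2.  Indeed, colour such an I greedily with d colours as
-- a subset of G, from heavy to light.  The coloured vertices have weight at
-- most d, so summation by parts yields an initial segment of all vertices
-- (from heavy to light) of length at most tm/2 in which m ≥ 1 vertices lie
-- in I and at least m/2 of these are uncoloured.  Each uncoloured vertex has
-- at least d earlier neighbours in I, so that these m vertices span dm/2
-- edges of G, all of which are missing from G_p.  For given m there are at
-- most (4t)^m such m-sets, each spanning no edge of G_p with probability
-- at most x^(-2m), and the sum over m is at most 1/(2t).
--
-- Finally, if each vertex lies on at most D short cycles, a greedy
-- colouring with D + 1 colours leaves no short cycle monochromatic, and the
-- heaviest colour class induces the required subgraph.

module Submission where

open import Defs
open import Algebra.Bundles using (CommutativeRing; RawRing)
import Algebra.Properties.CommutativeSemiring.Exp as CommutativeSemiringExp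
import Algebra.Properties.Ring as RingProperties
import Algebra.Properties.Semiring.Exp as SemiringExp
import Algebra.Properties.Semiring.Mult as SemiringMult
import Algebra.Properties.Semiring.Mult.TCOptimised as TCOptimised
import Algebra.Solver.Ring
open import Algebra.Solver.Ring.AlmostCommutativeRing using (_-Raw-AlmostCommutative⟶_; fromCommutativeRing)
open import Data.Bool.Base using (_∧_; false; true)
open import Data.Bool.Properties as Bool using (T-∧; T-≡)
open import Data.Empty using (⊥-elim)
open import Data.Fin.Base as Fin using (Fin)
open import Data.Fin.Patterns using (0F)
import Data.Fin.Properties as Fin
open import Data.Fin.Subset using (Subset; _∩_; inside; outside; ⁅_⁆; ∁; ∣_∣) renaming (_∈_ to _∈ₛ_; _⊆_ to _⊆ₛ_)
open import Data.Fin.Subset.Properties using (x∈p∩q⁺; x∈p∩q⁻; x∈⁅x⁆; x∈⁅y⁆⇒x≡y) renaming (_∈?_ to _∈ₛ?_)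
open import Data.Integer.Base as ℤ using (+_; -[1+_]; _⊖_; ℤ)
import Data.Integer.Properties as ℤ
open import Data.List.Base as List using (List; []; _++_; _∷_; allFin; cartesianProduct; cartesianProductWith; concatMap; drop; filter; length; map; tabulate; upTo)
import Data.List.Extrema as Extrema
import Data.List.Extrema.Nat as ℕExtrema
import Data.List.Membership.DecPropositional as DecMembership
open import Data.List.Membership.Propositional as Membership using (_∈_; _∉_)
open import Data.List.Membership.Propositional.Properties using (∈-++⁺ʳ; ∈-++⁺ˡ; ∈-++⁻; ∈-allFin; ∈-cartesianProductWith⁺; ∈-cartesianProductWith⁻; ∈-concatMap⁺; ∈-filter⁺; ∈-filter⁻; ∈-map⁺; ∈-map⁻; ∈-upTo⁺)
import Data.List.Properties as List
open import Data.List.Relation.Binary.Disjoint.Propositional using (Disjoint)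
open import Data.List.Relation.Binary.Permutation.Propositional using (_↭_; prep; swap; ↭-sym; ↭⇒↭ₛ) renaming (refl to ↭-refl; trans to ↭-trans)
open import Data.List.Relation.Binary.Permutation.Propositional.Properties using (↭-length; ∈-resp-↭)
import Data.List.Relation.Binary.Permutation.Setoid.Properties as PermutationSetoid
open import Data.List.Relation.Binary.Sublist.Propositional using ([]; _∷_; _∷ʳ_; _⊆_; ⊆-refl; ⊆-trans)
open import Data.List.Relation.Binary.Sublist.Propositional.Properties using (filter-⊆)
open import Data.List.Relation.Unary.All as All using (All; []; _∷_)
import Data.List.Relation.Unary.All.Properties as All
open import Data.List.Relation.Unary.AllPairs as AllPairs using (AllPairs; []; _∷_)
import Data.List.Relation.Unary.AllPairs.Properties as AllPairs
open import Data.List.Relation.Unary.Any as Any using (Any; here; index; there)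
open import Data.List.Relation.Unary.Any.Properties using (lookup-index)
open import Data.List.Relation.Unary.Linked as Linked using (Linked; []; _∷_)
open import Data.List.Relation.Unary.Linked.Properties using (Linked⇒AllPairs)
open import Data.List.Relation.Unary.Unique.Propositional using (Unique)
import Data.List.Relation.Unary.Unique.Propositional.Properties as Unique
import Data.List.Sort as Sort
open import Data.Maybe.Base using (Maybe; just; nothing)
import Data.Maybe.Properties as Maybe
open import Data.Nat.Base as ℕ using (suc; zero; ℕ)
import Data.Nat.Properties as ℕ
open import Data.Nat.Tactic.RingSolver using (solve-∀)
open import Data.Product.Base using (_,_; _×_; proj₁; proj₂; Σ-syntax; ∃; ∃-syntax)
open import Data.Product.Properties using (≡-dec)
open import Data.Sum.Base using (_⊎_; inj₁; inj₂)
open import Data.Vec.Base as Vec using (Vec; []; _∷_)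
import Data.Vec.Properties as Vec
open import Function.Base using (_∘_; case_of_; id)
open import Function.Bundles using (module Equivalence)
open import Level using (0ℓ)
open import Relation.Binary.Bundles using (DecTotalOrder)
import Relation.Binary.Construct.On as On
open import Relation.Binary.Core using (Rel)
open import Relation.Binary.Definitions using (DecidableEquality)
open import Relation.Binary.PropositionalEquality as ≡ using (_≡_; _≢_)
import Relation.Binary.Reasoning.PartialOrder as PartialOrderReasoning
open import Relation.Binary.Structures using (IsDecTotalOrder)
open import Relation.Nullary using (Dec; no; yes; ¬_)
import Relation.Nullary.Construct.Add.Supremum as Sup
open import Relation.Nullary.Decidable using (_×-dec_; _⊎-dec_; decidable-stable; fromWitness; toWitness; ¬?; ⌊_⌋)
open import Relation.Unary using (Decidable; Pred)

-- A union bound over all vertex sets would bring in the number of vertices, while the bound may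
-- depend on t alone. The order by weight removes it: a heavy independent set betrays itself inside
-- a segment of the heaviest vertices whose length is proportional to m, where the number of m-sets
-- is exponential in m with base of order t. In the weight 2d + 2, one d pays for the coloured
-- vertices and a second d makes the uncoloured ones outweigh them. The 2, charged at rate 2/t
-- against a total weight of t, pays for the length of the segment. Since e ≥ 2, also x ≥ 4t. Of the
-- factor x⁻² per vertex, one x⁻¹ cancels the base of the count and the other leaves a series of
-- ratio at most 1/(4t), with sum at most 1/(2t). A logical obstacle remains: a supremum comes
-- without a witness, so the Archimedean property, the exponent d and the typical outcome of G_p are
-- obtained only under double negation. The conclusions are inequalities and `_≤_` is decidable, so
-- double negations can be removed at the end.

module OrderedField (ℝ : CompleteOrderedField) where
  open CompleteOrderedField ℝ public hiding (setoid; zero)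
  open CompleteOrderedField ℝ using (setoid)
  open IsDecTotalOrder isDecTotalOrder public
    using (total; antisym)
    renaming (refl to ≤-refl; trans to ≤-trans; reflexive to ≤-reflexive; isPartialOrder to ≤-isPartialOrder; _≟_ to _≈?_)
  open RingProperties ring using (-0#≈0#; -‿distribˡ-*; -‿distribʳ-*; -‿+-comm; -‿involutive)

  ≤-decTotalOrder : DecTotalOrder 0ℓ 0ℓ 0ℓ
  ≤-decTotalOrder = record { isDecTotalOrder = isDecTotalOrder }

  open DecTotalOrder ≤-decTotalOrder using (poset) public

  module ≤-Reasoning = PartialOrderReasoning poset

  open SemiringMult semiring public using (×-homo-+; ×1-homo-*)
  open SemiringExp semiring public using (^-homo-*; ^-assocʳ; ^-congˡ)
  open CommutativeSemiringExp commutativeSemiring public using (^-distrib-*)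

  -- The ring solver needs coefficients whose equality can be tested, so polynomials over the
  -- abstract field get integer coefficients. The optimised multiples make `ι (+ 1)` reduce to `1#`
  -- itself, so `con (+ 1)` matches goals that mention `1#`.
  module ℤ-coefficients where
    open TCOptimised semiring using () renaming (_×_ to _×′_; ×-homo-+ to ×′-homo-+; ×1-homo-* to ×′1-homo-*; 1+× to 1+×′)

    ι : ℤ → Carrier
    ι (+ n)    = n ×′ 1#
    ι -[1+ n ] = - (suc n ×′ 1#)

    ι-neg : ∀ i → ι (ℤ.- i) ≈ - ι i
    ι-neg (+ zero)  = sym -0#≈0#
    ι-neg (+ suc n) = refl
    ι-neg -[1+ n ]  = sym (-‿involutive _)

    open import Relation.Binary.Reasoning.Setoid setoid

    ι-⊖ : ∀ m n → ι (m ⊖ n) ≈ m ×′ 1# - n ×′ 1#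
    ι-⊖ m       zero    = sym (trans (+-congˡ -0#≈0#) (+-identityʳ _))
    ι-⊖ zero    (suc n) = sym (+-identityˡ _)
    ι-⊖ (suc m) (suc n) = begin
      ι (suc m ⊖ suc n)               ≡⟨ ≡.cong ι (ℤ.[1+m]⊖[1+n]≡m⊖n m n) ⟩
      ι (m ⊖ n)                       ≈⟨ ι-⊖ m n ⟩
      x - y                           ≈⟨ +-congʳ (+-identityʳ x) ⟨
      x + 0# - y                      ≈⟨ +-congʳ (+-congˡ (-‿inverseʳ 1#)) ⟨
      x + (1# - 1#) - y               ≈⟨ +-congʳ (+-assoc x 1# (- 1#)) ⟨
      x + 1# - 1# - y                 ≈⟨ +-assoc (x + 1#) (- 1#) (- y) ⟩
      x + 1# + (- 1# - y)             ≈⟨ +-cong (+-comm x 1#) (-‿+-comm 1# y) ⟩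
      1# + x - (1# + y)               ≈⟨ +-cong (1+×′ m 1#) (-‿cong (1+×′ n 1#)) ⟨
      suc m ×′ 1# - suc n ×′ 1#       ∎
      where
      x = m ×′ 1#
      y = n ×′ 1#

    ι-+ : ∀ i j → ι (i ℤ.+ j) ≈ ι i + ι j
    ι-+ (+ m)    (+ n)    = ×′-homo-+ 1# m n
    ι-+ (+ m)    -[1+ n ] = ι-⊖ m (suc n)
    ι-+ -[1+ m ] (+ n)    = trans (ι-⊖ n (suc m)) (+-comm _ _)
    ι-+ -[1+ m ] -[1+ n ] = begin
      - (suc (suc (m ℕ.+ n)) ×′ 1#)       ≡⟨ ≡.cong (λ k → - (suc k ×′ 1#)) (ℕ.+-suc m n) ⟨
      - ((suc m ℕ.+ suc n) ×′ 1#)         ≈⟨ -‿cong (×′-homo-+ 1# (suc m) (suc n)) ⟩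
      - (suc m ×′ 1# + suc n ×′ 1#)       ≈⟨ -‿+-comm _ _ ⟨
      - (suc m ×′ 1#) - suc n ×′ 1#       ∎

    ι-*₊ : ∀ m j → ι (+ m ℤ.* j) ≈ ι (+ m) * ι j
    ι-*₊ m (+ n) = begin
      ι (+ m ℤ.* + n)    ≡⟨ ≡.cong ι (ℤ.pos-* m n) ⟨
      (m ℕ.* n) ×′ 1#    ≈⟨ ×′1-homo-* m n ⟩
      m ×′ 1# * n ×′ 1#  ∎
    ι-*₊ m -[1+ n ] = begin
      ι (+ m ℤ.* (ℤ.- (+ suc n)))    ≡⟨ ≡.cong ι (ℤ.neg-distribʳ-* (+ m) (+ suc n)) ⟨
      ι (ℤ.- (+ m ℤ.* + suc n))      ≈⟨ ι-neg (+ m ℤ.* + suc n) ⟩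
      - ι (+ m ℤ.* + suc n)          ≈⟨ -‿cong (ι-*₊ m (+ suc n)) ⟩
      - (m ×′ 1# * suc n ×′ 1#)      ≈⟨ -‿distribʳ-* _ _ ⟩
      m ×′ 1# * - (suc n ×′ 1#)      ∎

    ι-* : ∀ i j → ι (i ℤ.* j) ≈ ι i * ι j
    ι-* (+ m)    j = ι-*₊ m j
    ι-* -[1+ m ] j = begin
      ι ((ℤ.- (+ suc m)) ℤ.* j)   ≡⟨ ≡.cong ι (ℤ.neg-distribˡ-* (+ suc m) j) ⟨
      ι (ℤ.- (+ suc m ℤ.* j))     ≈⟨ ι-neg (+ suc m ℤ.* j) ⟩
      - ι (+ suc m ℤ.* j)         ≈⟨ -‿cong (ι-*₊ (suc m) j) ⟩
      - (suc m ×′ 1# * ι j)       ≈⟨ -‿distribˡ-* _ _ ⟩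
      - (suc m ×′ 1#) * ι j       ∎

    rawRing′ : RawRing 0ℓ 0ℓ
    rawRing′ = CommutativeRing.rawRing ℤ.+-*-commutativeRing

    morphism : rawRing′ -Raw-AlmostCommutative⟶ fromCommutativeRing commutativeRing
    morphism = record
      { ⟦_⟧ = ι ; +-homo = ι-+ ; *-homo = ι-* ; -‿homo = ι-neg ; 0-homo = refl ; 1-homo = refl }

    ι-≟ : ∀ i j → Maybe (ι i ≈ ι j)
    ι-≟ i j with i ℤ.≟ j
    ... | yes i≡j = just (reflexive (≡.cong ι i≡j))
    ... | no  _   = nothing

  module Solver = Algebra.Solver.Ring _ _ ℤ-coefficients.morphism ℤ-coefficients.ι-≟
  open Solver public using (solve; _:+_; _:*_; _:-_; :-_; _:=_; con)

  1+1 : Carrier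
  1+1 = fromℕ 2

  -- The polynomial evaluating to fromℕ m on the nose, unlike con (+ m).
  numeral : ∀ {k} → ℕ → Solver.Polynomial k
  numeral zero    = con (+ 0)
  numeral (suc m) = con (+ 1) :+ numeral m

  +-monoʳ-≤ : ∀ z {x y} → x ≤ y → z + x ≤ z + y
  +-monoʳ-≤ z {x} {y} x≤y = begin
    z + x ≈⟨ +-comm z x ⟩
    x + z ≤⟨ +-monoˡ-≤ z x≤y ⟩
    y + z ≈⟨ +-comm y z ⟩
    z + y ∎
    where open ≤-Reasoning

  +-mono-≤ : ∀ {x y u v} → x ≤ y → u ≤ v → x + u ≤ y + v
  +-mono-≤ {y = y} {u} x≤y u≤v = ≤-trans (+-monoˡ-≤ u x≤y) (+-monoʳ-≤ y u≤v)

  diff≥0⇒≤ : ∀ {x y z} → y - x ≈ z → 0# ≤ z → x ≤ y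
  diff≥0⇒≤ {x} {y} {z} y-x≈z 0≤z = begin
    x           ≈⟨ +-identityˡ x ⟨
    0# + x      ≤⟨ +-monoˡ-≤ x 0≤z ⟩
    z + x       ≈⟨ +-congʳ y-x≈z ⟨
    y - x + x   ≈⟨ solve 2 (λ x y → y :- x :+ x := y) refl x y ⟩
    y           ∎
    where open ≤-Reasoning

  ≤⇒diff≥0 : ∀ {x y} → x ≤ y → 0# ≤ y - x
  ≤⇒diff≥0 {x} {y} x≤y = begin
    0#     ≈⟨ -‿inverseʳ x ⟨
    x - x  ≤⟨ +-monoˡ-≤ (- x) x≤y ⟩
    y - x  ∎
    where open ≤-Reasoning

  +-nonneg : ∀ {x y} → 0# ≤ x → 0# ≤ y → 0# ≤ x + y
  +-nonneg 0≤x 0≤y = ≤-trans (≤-reflexive (sym (+-identityʳ 0#))) (+-mono-≤ 0≤x 0≤y)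

  neg-mono-≤ : ∀ {x y} → x ≤ y → - y ≤ - x
  neg-mono-≤ {x} {y} x≤y =
    diff≥0⇒≤ (solve 2 (λ x y → :- x :- :- y := y :- x) refl x y) (≤⇒diff≥0 x≤y)

  *-monoʳ-≤ : ∀ {z x y} → 0# ≤ z → x ≤ y → z * x ≤ z * y
  *-monoʳ-≤ {z} {x} {y} 0≤z x≤y =
    diff≥0⇒≤ (solve 3 (λ x y z → z :* y :- z :* x := z :* (y :- x)) refl x y z)
             (*-nonneg 0≤z (≤⇒diff≥0 x≤y))

  *-monoˡ-≤ : ∀ {z x y} → 0# ≤ z → x ≤ y → x * z ≤ y * z
  *-monoˡ-≤ {z} {x} {y} 0≤z x≤y = begin
    x * z  ≈⟨ *-comm x z ⟩
    z * x  ≤⟨ *-monoʳ-≤ 0≤z x≤y ⟩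
    z * y  ≈⟨ *-comm z y ⟩
    y * z  ∎
    where open ≤-Reasoning

  *-mono-≤ : ∀ {x y u v} → 0# ≤ u → 0# ≤ y → x ≤ y → u ≤ v → x * u ≤ y * v
  *-mono-≤ 0≤u 0≤y x≤y u≤v = ≤-trans (*-monoˡ-≤ 0≤u x≤y) (*-monoʳ-≤ 0≤y u≤v)

  ≰⇒≥ : ∀ {x y} → ¬ x ≤ y → y ≤ x
  ≰⇒≥ {x} {y} x≰y with total x y
  ... | inj₁ x≤y = ⊥-elim (x≰y x≤y)
  ... | inj₂ y≤x = y≤x

  ≰⇒> : ∀ {x y} → ¬ x ≤ y → y < x
  ≰⇒> x≰y = ≰⇒≥ x≰y , λ y≈x → x≰y (≤-reflexive (sym y≈x))

  <⇒≱ : ∀ {x y} → x < y → ¬ y ≤ x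
  <⇒≱ (x≤y , x≉y) y≤x = x≉y (antisym x≤y y≤x)

  <-≤-trans : ∀ {x y z} → x < y → y ≤ z → x < z
  <-≤-trans x<y y≤z = ≰⇒> λ z≤x → <⇒≱ x<y (≤-trans y≤z z≤x)

  _<?_ : ∀ x y → Dec (x < y)
  x <? y with y ≤? x
  ... | yes y≤x = no λ x<y → <⇒≱ x<y y≤x
  ... | no  y≰x = yes (≰⇒> y≰x)

  <⇒diff>0 : ∀ {x y} → x < y → 0# < y - x
  <⇒diff>0 {x} {y} x<y = ≰⇒> λ y-x≤0 → <⇒≱ x<y
    (diff≥0⇒≤ (solve 2 (λ x y → x :- y := con (+ 0) :- (y :- x)) refl x y) (≤⇒diff≥0 y-x≤0))

  -- The exit from double negation: every classical existence argument below ends in an inequality.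
  ≤-stable : ∀ {x y} → ¬ ¬ x ≤ y → x ≤ y
  ≤-stable {x} {y} = decidable-stable (x ≤? y)

  0≤1 : 0# ≤ 1#
  0≤1 with total 0# 1#
  ... | inj₁ 0≤1 = 0≤1
  ... | inj₂ 1≤0 = ≤-trans (*-nonneg 0≤-1 0≤-1)
      (≤-reflexive (solve 0 ((con (+ 0) :- con (+ 1)) :* (con (+ 0) :- con (+ 1)) := con (+ 1)) refl))
    where
    0≤-1 : 0# ≤ 0# - 1#
    0≤-1 = ≤⇒diff≥0 1≤0

  0<1 : 0# < 1#
  0<1 = 0≤1 , 0≉1

  +-pos-nonneg : ∀ {x y} → 0# < x → 0# ≤ y → 0# < x + y
  +-pos-nonneg {x} {y} 0<x 0≤y = <-≤-trans 0<x
    (≤-trans (≤-reflexive (sym (+-identityʳ x))) (+-monoʳ-≤ x 0≤y))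

  pos⇒≉0 : ∀ {x} → 0# < x → ¬ x ≈ 0#
  pos⇒≉0 (_ , 0≉x) x≈0 = 0≉x (sym x≈0)

  inverseʳ : ∀ {x} → 0# < x → x * x ⁻¹ ≈ 1#
  inverseʳ 0<x = *-inverseʳ _ (pos⇒≉0 0<x)

  ⁻¹-nonneg : ∀ {x} → 0# < x → 0# ≤ x ⁻¹
  ⁻¹-nonneg {x} 0<x = ≤-stable λ x⁻¹≰0 → <⇒≱ 0<1 (begin
    1#          ≈⟨ inverseʳ 0<x ⟨
    x * x ⁻¹    ≤⟨ *-monoʳ-≤ (proj₁ 0<x) (≰⇒≥ x⁻¹≰0) ⟩
    x * 0#      ≈⟨ zeroʳ x ⟩
    0#          ∎)
    where open ≤-Reasoning

  *-cancelˡ-≤ : ∀ {z x y} → 0# < z → z * x ≤ z * y → x ≤ y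
  *-cancelˡ-≤ {z} {x} {y} 0<z zx≤zy = begin
    x                ≈⟨ undo x ⟨
    z ⁻¹ * (z * x)   ≤⟨ *-monoʳ-≤ (⁻¹-nonneg 0<z) zx≤zy ⟩
    z ⁻¹ * (z * y)   ≈⟨ undo y ⟩
    y                ∎
    where
    open ≤-Reasoning
    undo : ∀ x → z ⁻¹ * (z * x) ≈ x
    undo x = trans (solve 3 (λ w z x → w :* (z :* x) := (z :* w) :* x) refl (z ⁻¹) z x)
      (trans (*-congʳ (inverseʳ 0<z)) (*-identityˡ x))

  *-pos : ∀ {x y} → 0# < x → 0# < y → 0# < x * y
  *-pos {x} {y} 0<x 0<y = ≰⇒> λ xy≤0 → <⇒≱ 0<y
    (*-cancelˡ-≤ 0<x (≤-trans xy≤0 (≤-reflexive (sym (zeroʳ x)))))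

  ⁻¹-unique : ∀ {x y} → 0# < x → x * y ≈ 1# → y ≈ x ⁻¹
  ⁻¹-unique {x} {y} 0<x xy≈1 = antisym
    (*-cancelˡ-≤ 0<x (≤-reflexive eq)) (*-cancelˡ-≤ 0<x (≤-reflexive (sym eq)))
    where
    eq : x * y ≈ x * x ⁻¹
    eq = trans xy≈1 (sym (inverseʳ 0<x))

  ≤*⇒/≤ : ∀ {x y z} → 0# < y → x ≤ y * z → x / y ≤ z
  ≤*⇒/≤ {x} {y} {z} 0<y x≤yz = *-cancelˡ-≤ 0<y (begin
    y * (x * y ⁻¹)   ≈⟨ solve 3 (λ x y w → y :* (x :* w) := x :* (y :* w)) refl x y (y ⁻¹) ⟩
    x * (y * y ⁻¹)   ≈⟨ *-congˡ (inverseʳ 0<y) ⟩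
    x * 1#           ≈⟨ *-identityʳ x ⟩
    x                ≤⟨ x≤yz ⟩
    y * z            ∎)
    where open ≤-Reasoning

  *≤⇒≤/ : ∀ {x y z} → 0# < y → y * z ≤ x → z ≤ x / y
  *≤⇒≤/ {x} {y} {z} 0<y yz≤x = *-cancelˡ-≤ 0<y (begin
    y * z            ≤⟨ yz≤x ⟩
    x                ≈⟨ *-identityʳ x ⟨
    x * 1#           ≈⟨ *-congˡ (inverseʳ 0<y) ⟨
    x * (y * y ⁻¹)   ≈⟨ solve 3 (λ x y w → x :* (y :* w) := y :* (x :* w)) refl x y (y ⁻¹) ⟩
    y * (x * y ⁻¹)   ∎)
    where open ≤-Reasoning

  /-*-cancel : ∀ {x y} → 0# < y → y * (x / y) ≈ x
  /-*-cancel {x} {y} 0<y = trans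
    (solve 3 (λ x y w → y :* (x :* w) := x :* (y :* w)) refl x y (y ⁻¹))
    (trans (*-congˡ (inverseʳ 0<y)) (*-identityʳ x))

  ^-nonneg : ∀ {x} → 0# ≤ x → ∀ n → 0# ≤ x ^ n
  ^-nonneg 0≤x zero    = 0≤1
  ^-nonneg 0≤x (suc n) = *-nonneg 0≤x (^-nonneg 0≤x n)

  ^-pos : ∀ {x} → 0# < x → ∀ n → 0# < x ^ n
  ^-pos 0<x zero    = 0<1
  ^-pos 0<x (suc n) = *-pos 0<x (^-pos 0<x n)

  ^-monoˡ-≤ : ∀ {x y} → 0# ≤ x → x ≤ y → ∀ n → x ^ n ≤ y ^ n
  ^-monoˡ-≤ 0≤x x≤y zero    = ≤-refl
  ^-monoˡ-≤ 0≤x x≤y (suc n) =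
    *-mono-≤ (^-nonneg 0≤x n) (≤-trans 0≤x x≤y) x≤y (^-monoˡ-≤ 0≤x x≤y n)

  ^-≤-1 : ∀ {x} → 0# ≤ x → x ≤ 1# → ∀ n → x ^ n ≤ 1#
  ^-≤-1 0≤x x≤1 n = ≤-trans (^-monoˡ-≤ 0≤x x≤1 n) (≤-reflexive (1^n≈1 n))
    where
    1^n≈1 : ∀ n → 1# ^ n ≈ 1#
    1^n≈1 zero    = refl
    1^n≈1 (suc n) = trans (*-identityˡ _) (1^n≈1 n)

  ^-antitone-≤ : ∀ {x} → 0# ≤ x → x ≤ 1# → ∀ {m n} → m ℕ.≤ n → x ^ n ≤ x ^ m
  ^-antitone-≤ {x} 0≤x x≤1 {m} {n} m≤n = begin
    x ^ n                    ≡⟨ ≡.cong (x ^_) (ℕ.m+[n∸m]≡n m≤n) ⟨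
    x ^ (m ℕ.+ (n ℕ.∸ m))    ≈⟨ ^-homo-* x m (n ℕ.∸ m) ⟩
    x ^ m * x ^ (n ℕ.∸ m)    ≤⟨ *-monoʳ-≤ (^-nonneg 0≤x m) (^-≤-1 0≤x x≤1 (n ℕ.∸ m)) ⟩
    x ^ m * 1#               ≈⟨ *-identityʳ _ ⟩
    x ^ m                    ∎
    where open ≤-Reasoning

  fromℕ-nonneg : ∀ n → 0# ≤ fromℕ n
  fromℕ-nonneg zero    = ≤-refl
  fromℕ-nonneg (suc n) = +-nonneg 0≤1 (fromℕ-nonneg n)

  fromℕ-pos : ∀ n → 0# < fromℕ (suc n)
  fromℕ-pos n = +-pos-nonneg 0<1 (fromℕ-nonneg n)

  1≤fromℕ-suc : ∀ n → 1# ≤ fromℕ (suc n)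
  1≤fromℕ-suc n = ≤-trans (≤-reflexive (sym (+-identityʳ 1#))) (+-monoʳ-≤ 1# (fromℕ-nonneg n))

  fromℕ-mono-≤ : ∀ {m n} → m ℕ.≤ n → fromℕ m ≤ fromℕ n
  fromℕ-mono-≤ {n = n} ℕ.z≤n       = fromℕ-nonneg n
  fromℕ-mono-≤         (ℕ.s≤s m≤n) = +-monoʳ-≤ 1# (fromℕ-mono-≤ m≤n)

  fromℕ-<-suc : ∀ n → fromℕ n < fromℕ (suc n)
  fromℕ-<-suc n = ≰⇒> λ 1+n≤n → <⇒≱ 0<1 (diff≥0⇒≤
    (solve 1 (λ n → con (+ 0) :- con (+ 1) := n :- (con (+ 1) :+ n)) refl (fromℕ n)) (≤⇒diff≥0 1+n≤n))

  fromℕ-cancel-≤ : ∀ {m n} → fromℕ m ≤ fromℕ n → m ℕ.≤ n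
  fromℕ-cancel-≤ {m} {n} m≤n with m ℕ.≤? n
  ... | yes m≤n′ = m≤n′
  ... | no  m≰n = ⊥-elim (<⇒≱ (fromℕ-<-suc n) (≤-trans (fromℕ-mono-≤ (ℕ.≰⇒> m≰n)) m≤n))

  fromℕ-^ : ∀ m k → fromℕ (m ℕ.^ k) ≈ fromℕ m ^ k
  fromℕ-^ m zero    = +-identityʳ 1#
  fromℕ-^ m (suc k) = trans (×1-homo-* m (m ℕ.^ k)) (*-congˡ (fromℕ-^ m k))

  -- sup {fromℕ n} would satisfy sup + 1 ≤ sup if ℕ were bounded.
  archimedean : ∀ x → ¬ ¬ ∃ λ n → x ≤ fromℕ n
  archimedean x unbounded = <⇒≱ 0<1 (diff≥0⇒≤
    (solve 1 (λ s → con (+ 0) :- con (+ 1) := s :- con (+ 1) :- s) refl s) (≤⇒diff≥0 s≤s-1))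
    where
    Naturals : Carrier → Set
    Naturals y = ∃ λ n → y ≈ fromℕ n

    s = sup Naturals

    nonempty : ∃ Naturals
    nonempty = 0# , 0 , refl

    bounded : ∃ (UpperBound Naturals)
    bounded = x , λ { y (n , y≈n) → ≤-trans (≤-reflexive y≈n) (≰⇒≥ λ x≤n → unbounded (n , x≤n)) }

    s≤s-1 : s ≤ s - 1#
    s≤s-1 = sup-least Naturals nonempty bounded (s - 1#) λ { y (n , y≈n) → begin
      y                   ≈⟨ y≈n ⟩
      fromℕ n             ≈⟨ solve 1 (λ n → n := con (+ 1) :+ n :- con (+ 1)) refl (fromℕ n) ⟩
      fromℕ (suc n) - 1#  ≤⟨ +-monoˡ-≤ (- 1#) (sup-upper Naturals nonempty bounded _ (suc n , refl)) ⟩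
      s - 1#              ∎ }
      where open ≤-Reasoning

  bernoulli : ∀ {h} → 0# ≤ h → ∀ n → 1# + fromℕ n * h ≤ (1# + h) ^ n
  bernoulli {h} 0≤h zero    = ≤-reflexive (trans (+-congˡ (zeroˡ h)) (+-identityʳ 1#))
  bernoulli {h} 0≤h (suc n) = begin
    1# + (1# + k) * h               ≤⟨ diff≥0⇒≤
      (solve 2 (λ h k → (con (+ 1) :+ h) :* (con (+ 1) :+ k :* h) :- (con (+ 1) :+ (con (+ 1) :+ k) :* h)
                        := k :* (h :* h)) refl h k)
      (*-nonneg (fromℕ-nonneg n) (*-nonneg 0≤h 0≤h)) ⟩
    (1# + h) * (1# + k * h)         ≤⟨ *-monoʳ-≤ (+-nonneg 0≤1 0≤h) (bernoulli 0≤h n) ⟩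
    (1# + h) * (1# + h) ^ n         ∎
    where
    open ≤-Reasoning
    k = fromℕ n

-- Indicators and finite sums in the field.

module FiniteSums (ℝ : CompleteOrderedField) where
  open OrderedField ℝ

  private variable
    A B : Set
    P Q : Set

  ind : Dec P → Carrier
  ind (yes _) = 1#
  ind (no  _) = 0#

  ind-nonneg : (P? : Dec P) → 0# ≤ ind P?
  ind-nonneg (yes _) = 0≤1
  ind-nonneg (no  _) = ≤-refl

  ind-≤-1 : (P? : Dec P) → ind P? ≤ 1#
  ind-≤-1 (yes _) = ≤-refl
  ind-≤-1 (no  _) = 0≤1

  ind-mono : (P? : Dec P) (Q? : Dec Q) → (P → Q) → ind P? ≤ ind Q?
  ind-mono (yes p) (yes q) _ = ≤-refl
  ind-mono (yes p) (no ¬q) f = ⊥-elim (¬q (f p))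
  ind-mono (no _)  Q?      _ = ind-nonneg Q?

  ind-yes : (P? : Dec P) → P → ind P? ≈ 1#
  ind-yes (yes _) _ = refl
  ind-yes (no ¬p) p = ⊥-elim (¬p p)

  ind-no : (P? : Dec P) → ¬ P → ind P? ≈ 0#
  ind-no (yes p) ¬p = ⊥-elim (¬p p)
  ind-no (no _)  _  = refl

  sumOver-mono : ∀ (xs : List A) {f g : A → Carrier} →
                 (∀ x → x ∈ xs → f x ≤ g x) → sumOver xs f ≤ sumOver xs g
  sumOver-mono []       f≤g = ≤-refl
  sumOver-mono (x ∷ xs) f≤g =
    +-mono-≤ (f≤g x (here ≡.refl)) (sumOver-mono xs λ y y∈xs → f≤g y (there y∈xs))

  sumOver-cong : ∀ (xs : List A) {f g : A → Carrier} →
                 (∀ x → f x ≈ g x) → sumOver xs f ≈ sumOver xs g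
  sumOver-cong []       f≈g = refl
  sumOver-cong (x ∷ xs) f≈g = +-cong (f≈g x) (sumOver-cong xs f≈g)

  sumOver-const : ∀ (xs : List A) c → sumOver xs (λ _ → c) ≈ fromℕ (length xs) * c
  sumOver-const []       c = sym (zeroˡ c)
  sumOver-const (x ∷ xs) c = trans (+-congˡ (sumOver-const xs c))
    (solve 2 (λ n c → c :+ n :* c := (con (+ 1) :+ n) :* c) refl (fromℕ (length xs)) c)

  sumOver-0 : ∀ (xs : List A) → sumOver xs (λ _ → 0#) ≈ 0#
  sumOver-0 xs = trans (sumOver-const xs 0#) (zeroʳ _)

  sumOver-nonneg : ∀ (xs : List A) {f : A → Carrier} →
                   (∀ x → x ∈ xs → 0# ≤ f x) → 0# ≤ sumOver xs f
  sumOver-nonneg xs 0≤f = ≤-trans (≤-reflexive (sym (sumOver-0 xs))) (sumOver-mono xs 0≤f)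

  sumOver-+ : ∀ (xs : List A) f g →
              sumOver xs (λ x → f x + g x) ≈ sumOver xs f + sumOver xs g
  sumOver-+ []       f g = sym (+-identityʳ 0#)
  sumOver-+ (x ∷ xs) f g = trans (+-congˡ (sumOver-+ xs f g))
    (solve 4 (λ a b c d → a :+ b :+ (c :+ d) := a :+ c :+ (b :+ d)) refl _ _ _ _)

  sumOver-*ˡ : ∀ (xs : List A) c f → sumOver xs (λ x → c * f x) ≈ c * sumOver xs f
  sumOver-*ˡ []       c f = sym (zeroʳ c)
  sumOver-*ˡ (x ∷ xs) c f = trans (+-congˡ (sumOver-*ˡ xs c f)) (sym (distribˡ c _ _))

  sumOver-- : ∀ (xs : List A) f g →
              sumOver xs (λ x → f x - g x) ≈ sumOver xs f - sumOver xs g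
  sumOver-- []       f g = sym (-‿inverseʳ 0#)
  sumOver-- (x ∷ xs) f g = trans (+-congˡ (sumOver-- xs f g))
    (solve 4 (λ a b c d → a :- b :+ (c :- d) := a :+ c :- (b :+ d)) refl _ _ _ _)

  sumOver-swap : ∀ (xs : List A) (ys : List B) (f : A → B → Carrier) →
                 sumOver xs (λ x → sumOver ys (f x)) ≈ sumOver ys (λ y → sumOver xs λ x → f x y)
  sumOver-swap []       ys f = sym (sumOver-0 ys)
  sumOver-swap (x ∷ xs) ys f = trans (+-congˡ (sumOver-swap xs ys f))
    (sym (sumOver-+ ys (f x) λ y → sumOver xs λ x → f x y))

  sumOver-++ : ∀ (xs ys : List A) f → sumOver (xs ++ ys) f ≈ sumOver xs f + sumOver ys f
  sumOver-++ []       ys f = sym (+-identityˡ _)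
  sumOver-++ (x ∷ xs) ys f = trans (+-congˡ (sumOver-++ xs ys f)) (sym (+-assoc _ _ _))

  sumOver-map : ∀ (g : A → B) xs f → sumOver (map g xs) f ≈ sumOver xs (f ∘ g)
  sumOver-map g []       f = refl
  sumOver-map g (x ∷ xs) f = +-congˡ (sumOver-map g xs f)

  sumOver-concatMap : ∀ (g : A → List B) xs f →
                      sumOver (concatMap g xs) f ≈ sumOver xs (λ x → sumOver (g x) f)
  sumOver-concatMap g []       f = refl
  sumOver-concatMap g (x ∷ xs) f =
    trans (sumOver-++ (g x) (concatMap g xs) f) (+-congˡ (sumOver-concatMap g xs f))

  sumOver-filter : ∀ {P : Pred A 0ℓ} (P? : Decidable P) xs f →
                   sumOver (filter P? xs) f ≈ sumOver xs (λ x → ind (P? x) * f x)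
  sumOver-filter P? []       f = refl
  sumOver-filter P? (x ∷ xs) f with P? x
  ... | yes _ = +-cong (sym (*-identityˡ _)) (sumOver-filter P? xs f)
  ... | no  _ = trans (sumOver-filter P? xs f) (sym (trans (+-congʳ (zeroˡ _)) (+-identityˡ _)))

  sumOver-ind : ∀ {P : Pred A 0ℓ} (P? : Decidable P) xs →
                sumOver xs (ind ∘ P?) ≈ fromℕ (length (filter P? xs))
  sumOver-ind P? []       = refl
  sumOver-ind P? (x ∷ xs) with P? x
  ... | yes _ = +-congˡ (sumOver-ind P? xs)
  ... | no  _ = trans (+-identityˡ _) (sumOver-ind P? xs)

  sumOver-filter-≤ : ∀ {P : Pred A 0ℓ} (P? : Decidable P) xs {f} →
                     (∀ x → x ∈ xs → 0# ≤ f x) → sumOver (filter P? xs) f ≤ sumOver xs f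
  sumOver-filter-≤ P? []       0≤f = ≤-refl
  sumOver-filter-≤ P? (x ∷ xs) {f} 0≤f with P? x
  ... | yes _ = +-monoʳ-≤ (f x) (sumOver-filter-≤ P? xs λ y y∈xs → 0≤f y (there y∈xs))
  ... | no  _ = ≤-trans (≤-reflexive (sym (+-identityˡ _)))
    (+-mono-≤ (0≤f x (here ≡.refl)) (sumOver-filter-≤ P? xs λ y y∈xs → 0≤f y (there y∈xs)))

  ∈⇒≤-sumOver : ∀ {xs : List A} {x f} → (∀ x → 0# ≤ f x) → x ∈ xs → f x ≤ sumOver xs f
  ∈⇒≤-sumOver {xs = x ∷ xs} 0≤f (here ≡.refl) = ≤-trans (≤-reflexive (sym (+-identityʳ _)))
    (+-monoʳ-≤ _ (sumOver-nonneg xs λ y _ → 0≤f y))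
  ∈⇒≤-sumOver {xs = y ∷ xs} 0≤f (there x∈xs) = ≤-trans (≤-reflexive (sym (+-identityˡ _)))
    (+-mono-≤ (0≤f y) (∈⇒≤-sumOver 0≤f x∈xs))

  sumOver-support : ∀ {xs : List A} {a f} → Unique xs → a ∈ xs →
                    (∀ x → ¬ x ≡ a → f x ≈ 0#) → sumOver xs f ≈ f a
  sumOver-support {xs = a ∷ xs} {f = f} (a∉xs ∷ _) (here ≡.refl) off =
    trans (+-congˡ (antisym Σ≤0 0≤Σ)) (+-identityʳ (f a))
    where
    off′ : ∀ y → y ∈ xs → f y ≈ 0#
    off′ y y∈xs = off y (All.lookup a∉xs y∈xs ∘ ≡.sym)
    Σ≤0 : sumOver xs f ≤ 0#
    Σ≤0 = ≤-trans (sumOver-mono xs λ y y∈xs → ≤-reflexive (off′ y y∈xs)) (≤-reflexive (sumOver-0 xs))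
    0≤Σ : 0# ≤ sumOver xs f
    0≤Σ = sumOver-nonneg xs λ y y∈xs → ≤-reflexive (sym (off′ y y∈xs))
  sumOver-support {xs = x ∷ xs} (x∉xs ∷ !xs) (there a∈xs) off =
    trans (+-cong (off x (All.lookup x∉xs a∈xs)) (sumOver-support !xs a∈xs off)) (+-identityˡ _)

  sumOver-↭ : ∀ {xs ys : List A} f → xs ↭ ys → sumOver xs f ≈ sumOver ys f
  sumOver-↭ f ↭-refl           = refl
  sumOver-↭ f (prep x xs↭ys)   = +-congˡ (sumOver-↭ f xs↭ys)
  sumOver-↭ f (swap x y xs↭ys) = trans (+-congˡ (+-congˡ (sumOver-↭ f xs↭ys)))
    (solve 3 (λ a b c → a :+ (b :+ c) := b :+ (a :+ c)) refl _ _ _)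
  sumOver-↭ f (↭-trans p q)    = trans (sumOver-↭ f p) (sumOver-↭ f q)

  sumOver-allFin-suc : ∀ n (f : Fin (suc n) → Carrier) →
                       sumOver (allFin (suc n)) f ≈ f 0F + sumOver (allFin n) (f ∘ Fin.suc)
  sumOver-allFin-suc n f = +-congˡ (trans
    (reflexive (≡.cong (λ xs → sumOver xs f) (≡.sym (List.map-tabulate (λ i → i) Fin.suc))))
    (sumOver-map Fin.suc (allFin n) f))

  sumOver-upTo-suc : ∀ n (f : ℕ → Carrier) →
                     sumOver (upTo (suc n)) f ≈ f 0 + sumOver (upTo n) (f ∘ suc)
  sumOver-upTo-suc n f = +-congˡ (trans
    (reflexive (≡.cong (λ xs → sumOver xs f) (≡.sym (List.map-upTo suc n))))
    (sumOver-map suc (upTo n) f))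

  exists-above-average : ∀ (x : A) xs f →
    ∃ λ y → sumOver (x ∷ xs) f ≤ fromℕ (length (x ∷ xs)) * f y
  exists-above-average x []       f = x , ≤-reflexive
    (solve 1 (λ a → a :+ con (+ 0) := (con (+ 1) :+ con (+ 0)) :* a) refl (f x))
  exists-above-average x (y ∷ xs) f with exists-above-average y xs f
  ... | z , sum≤ with f x ≤? f z
  ...   | yes fx≤fz = z , ≤-trans (+-mono-≤ fx≤fz sum≤)
          (≤-reflexive (solve 2 (λ a n → a :+ n :* a := (con (+ 1) :+ n) :* a) refl (f z) (fromℕ (length (y ∷ xs)))))
  ...   | no  fx≰fz = x , ≤-trans
          (+-monoʳ-≤ (f x) (≤-trans sum≤ (*-monoʳ-≤ (fromℕ-nonneg (length (y ∷ xs))) (≰⇒≥ fx≰fz))))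
          (≤-reflexive (solve 2 (λ a n → a :+ n :* a := (con (+ 1) :+ n) :* a) refl (f x) (fromℕ (length (y ∷ xs)))))

  -- Peeling off the first term leaves ρ times a shorter sum, and 1 + 2ρ ≤ 2 closes the induction
  -- without any division by 1 - ρ.
  geometric-sum-≤ : ∀ {ρ} → 0# ≤ ρ → 1+1 * ρ ≤ 1# → ∀ n → sumOver (upTo n) (ρ ^_) ≤ 1+1
  geometric-sum-≤ {ρ} 0≤ρ 2ρ≤1 zero    = +-nonneg 0≤1 (+-nonneg 0≤1 ≤-refl)
  geometric-sum-≤ {ρ} 0≤ρ 2ρ≤1 (suc n) = begin
    sumOver (upTo (suc n)) (ρ ^_)            ≈⟨ sumOver-upTo-suc n (ρ ^_) ⟩
    1# + sumOver (upTo n) (λ k → ρ * ρ ^ k)  ≈⟨ +-congˡ (sumOver-*ˡ (upTo n) ρ (ρ ^_)) ⟩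
    1# + ρ * sumOver (upTo n) (ρ ^_)         ≤⟨ +-monoʳ-≤ 1# (*-monoʳ-≤ 0≤ρ (geometric-sum-≤ 0≤ρ 2ρ≤1 n)) ⟩
    1# + ρ * 1+1                             ≈⟨ +-congˡ (*-comm ρ 1+1) ⟩
    1# + 1+1 * ρ                             ≤⟨ +-monoʳ-≤ 1# 2ρ≤1 ⟩
    1# + 1#                                  ≈⟨ +-congˡ (+-identityʳ 1#) ⟨
    1+1                                      ∎
    where open ≤-Reasoning

-- Systems of linear inequalities and the Farkas alternative.

module LinearInequalities (ℝ : CompleteOrderedField) where
  open OrderedField ℝ
  open FiniteSums ℝ

  -- The row (a , b) stands for the inequality Σᵢ aᵢ xᵢ ≤ b.
  Row : ℕ → Set
  Row k = (Fin k → Carrier) × Carrier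

  infix 8 _∙_

  _∙_ : ∀ {k} → (Fin k → Carrier) → (Fin k → Carrier) → Carrier
  _∙_ {k} a x = sumOver (allFin k) λ i → a i * x i

  Satisfies : ∀ {k} → (Fin k → Carrier) → Row k → Set
  Satisfies x (a , b) = a ∙ x ≤ b

  infixr 5 _◂_

  _◂_ : ∀ {k} {A : Set} → A → (Fin k → A) → Fin (suc k) → A
  (c ◂ a) 0F          = c
  (c ◂ a) (Fin.suc i) = a i

  _⊕_ : ∀ {k} → Row k → Row k → Row k
  (a , b) ⊕ (a′ , b′) = (λ i → a i + a′ i) , b + b′

  ∙-⊕ : ∀ {k} (a a′ x : Fin k → Carrier) → (λ i → a i + a′ i) ∙ x ≈ a ∙ x + a′ ∙ x
  ∙-⊕ {k} a a′ x = trans (sumOver-cong (allFin k) λ i → distribʳ (x i) (a i) (a′ i))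
    (sumOver-+ (allFin k) (λ i → a i * x i) λ i → a′ i * x i)

  -- An abstract set of consequences of a system, closed under nonnegative combinations. Elimination
  -- then carries no vectors of multipliers; the instance chosen by the caller decides in what form
  -- they are remembered.
  record IsCone {k} (K : Row k → Set) : Set where
    field
      resp  : ∀ {a a′ b b′} → (∀ i → a i ≈ a′ i) → b ≈ b′ → K (a , b) → K (a′ , b′)
      add   : ∀ {r s} → K r → K s → K (r ⊕ s)
      scale : ∀ {c a b} → 0# ≤ c → K (a , b) → K ((λ i → c * a i) , c * b)

  -- Supplies the value of an eliminated variable. Starting from `0#`, the value is lowered to each
  -- upper bound it exceeds and then raised to each lower bound it misses.
  between : ∀ (ls hs : List Carrier) → (∀ l h → l ∈ ls → h ∈ hs → l ≤ h) →
            ∃[ x ] (∀ l → l ∈ ls → l ≤ x) × (∀ h → h ∈ hs → x ≤ h)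
  between [] [] _ = 0# , (λ _ ()) , (λ _ ())
  between [] (h ∷ hs) _ with between [] hs (λ _ _ ())
  ... | x , _ , x≤hs with total x h
  ...   | inj₁ x≤h = x , (λ _ ()) , λ { _ (here ≡.refl) → x≤h ; h′ (there h′∈hs) → x≤hs h′ h′∈hs }
  ...   | inj₂ h≤x = h , (λ _ ()) , λ { _ (here ≡.refl) → ≤-refl ; h′ (there h′∈hs) → ≤-trans h≤x (x≤hs h′ h′∈hs) }
  between (l ∷ ls) hs ls≤hs with between ls hs (λ l h l∈ls → ls≤hs l h (there l∈ls))
  ... | x , ls≤x , x≤hs with total l x
  ...   | inj₁ l≤x = x , (λ { _ (here ≡.refl) → l≤x ; l′ (there l′∈ls) → ls≤x l′ l′∈ls }) , x≤hs
  ...   | inj₂ x≤l = l , (λ { _ (here ≡.refl) → ≤-refl ; l′ (there l′∈ls) → ≤-trans (ls≤x l′ l′∈ls) x≤l })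
                       , λ h → ls≤hs l h (here ≡.refl)

  -- The rows of a system, scaled so that the first coefficient is 1, -1 or 0.
  record Sorted {k} (K : Row (suc k) → Set) (rows : List (Row (suc k))) : Set where
    field
      upper lower free : List (Row k)
      upper-K : ∀ {a b} → (a , b) ∈ upper → K (1# ◂ a , b)
      lower-K : ∀ {a b} → (a , b) ∈ lower → K (- 1# ◂ a , b)
      free-K  : ∀ {a b} → (a , b) ∈ free  → K (0# ◂ a , b)
      sound   : ∀ {x₀ x} →
                (∀ {a b} → (a , b) ∈ upper → x₀ ≤ b - a ∙ x) →
                (∀ {a b} → (a , b) ∈ lower → a ∙ x - b ≤ x₀) →
                (∀ {r} → r ∈ free → Satisfies x r) →
                ∀ {r} → r ∈ rows → Satisfies (x₀ ◂ x) r

  module _ {k} {K : Row (suc k) → Set} (cone : IsCone K) where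
    open IsCone cone

    private
      ∙-head-tail : ∀ (a : Fin (suc k) → Carrier) x₀ x → a ∙ (x₀ ◂ x) ≈ a 0F * x₀ + (a ∘ Fin.suc) ∙ x
      ∙-head-tail a x₀ x = sumOver-allFin-suc k λ i → a i * (x₀ ◂ x) i

      scaled-∙ : ∀ c (a x : Fin k → Carrier) → (λ i → c * a i) ∙ x ≈ c * a ∙ x
      scaled-∙ c a x = trans (sumOver-cong (allFin k) λ i → *-assoc c (a i) (x i))
        (sumOver-*ˡ (allFin k) c λ i → a i * x i)

    sortRows : ∀ rows → (∀ {r} → r ∈ rows → K r) → Sorted K rows
    sortRows [] _ = record
      { upper = [] ; lower = [] ; free = []
      ; upper-K = λ () ; lower-K = λ () ; free-K = λ () ; sound = λ _ _ _ () }
    sortRows ((a , b) ∷ rows) rows⊆K with sortRows rows (rows⊆K ∘ there) | a 0F ≤? 0# | 0# ≤? a 0F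
    ... | s | no a₀≰0 | _ = record
      { upper = ((λ i → c * a (Fin.suc i)) , c * b) ∷ upper ; lower = lower ; free = free
      ; upper-K = λ { (here ≡.refl) → resp
                        (λ { 0F → trans (*-comm c (a 0F)) (inverseʳ 0<a₀) ; (Fin.suc i) → refl }) refl
                        (scale (⁻¹-nonneg 0<a₀) (rows⊆K (here ≡.refl)))
                    ; (there r∈) → upper-K r∈ }
      ; lower-K = lower-K ; free-K = free-K
      ; sound = λ { {x₀} {x} up lo fr (here ≡.refl) → begin
                      a ∙ (x₀ ◂ x)                          ≈⟨ ∙-head-tail a x₀ x ⟩
                      a 0F * x₀ + (a ∘ Fin.suc) ∙ x         ≤⟨ +-monoˡ-≤ _ (*-monoʳ-≤ (proj₁ 0<a₀) (up (here ≡.refl))) ⟩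
                      a 0F * (c * b - (λ i → c * a (Fin.suc i)) ∙ x) + (a ∘ Fin.suc) ∙ x
                                                            ≈⟨ +-congʳ (*-congˡ (+-congˡ (-‿cong (scaled-∙ c _ x)))) ⟩
                      a 0F * (c * b - c * (a ∘ Fin.suc) ∙ x) + (a ∘ Fin.suc) ∙ x
                        ≈⟨ solve 4 (λ a₀ c b y → a₀ :* (c :* b :- c :* y) :+ y := (a₀ :* c) :* (b :- y) :+ y) refl (a 0F) c b _ ⟩
                      (a 0F * c) * (b - (a ∘ Fin.suc) ∙ x) + (a ∘ Fin.suc) ∙ x
                                                            ≈⟨ +-congʳ (*-congʳ (inverseʳ 0<a₀)) ⟩
                      1# * (b - (a ∘ Fin.suc) ∙ x) + (a ∘ Fin.suc) ∙ x
                        ≈⟨ solve 2 (λ b y → con (+ 1) :* (b :- y) :+ y := b) refl b _ ⟩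
                      b                                     ∎
                  ; up lo fr (there r∈) → sound (up ∘ there) lo fr r∈ } }
      where
      open Sorted s
      open ≤-Reasoning
      0<a₀ = ≰⇒> a₀≰0
      c = a 0F ⁻¹
    ... | s | yes _ | no 0≰a₀ = record
      { upper = upper ; lower = ((λ i → c * a (Fin.suc i)) , c * b) ∷ lower ; free = free
      ; upper-K = upper-K
      ; lower-K = λ { (here ≡.refl) → resp
                        (λ { 0F → trans (solve 2 (λ c d → c :* d := :- (:- d :* c)) refl c (a 0F)) (-‿cong (inverseʳ 0<-a₀))
                           ; (Fin.suc i) → refl }) refl
                        (scale (⁻¹-nonneg 0<-a₀) (rows⊆K (here ≡.refl)))
                    ; (there r∈) → lower-K r∈ }
      ; free-K = free-K
      ; sound = λ { {x₀} {x} up lo fr (here ≡.refl) → begin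
                      a ∙ (x₀ ◂ x)                          ≈⟨ ∙-head-tail a x₀ x ⟩
                      a 0F * x₀ + (a ∘ Fin.suc) ∙ x
                        ≈⟨ solve 3 (λ d x₀ y → d :* x₀ :+ y := :- d :* :- x₀ :+ y) refl (a 0F) x₀ _ ⟩
                      - a 0F * - x₀ + (a ∘ Fin.suc) ∙ x     ≤⟨ +-monoˡ-≤ _ (*-monoʳ-≤ (proj₁ 0<-a₀) (neg-mono-≤ (lo (here ≡.refl)))) ⟩
                      - a 0F * - ((λ i → c * a (Fin.suc i)) ∙ x - c * b) + (a ∘ Fin.suc) ∙ x
                                                            ≈⟨ +-congʳ (*-congˡ (-‿cong (+-congʳ (scaled-∙ c _ x)))) ⟩
                      - a 0F * - (c * (a ∘ Fin.suc) ∙ x - c * b) + (a ∘ Fin.suc) ∙ x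
                        ≈⟨ solve 4 (λ d c b y → :- d :* :- (c :* y :- c :* b) :+ y := (:- d :* c) :* (b :- y) :+ y) refl (a 0F) c b _ ⟩
                      (- a 0F * c) * (b - (a ∘ Fin.suc) ∙ x) + (a ∘ Fin.suc) ∙ x
                                                            ≈⟨ +-congʳ (*-congʳ (inverseʳ 0<-a₀)) ⟩
                      1# * (b - (a ∘ Fin.suc) ∙ x) + (a ∘ Fin.suc) ∙ x
                        ≈⟨ solve 2 (λ b y → con (+ 1) :* (b :- y) :+ y := b) refl b _ ⟩
                      b                                     ∎
                  ; up lo fr (there r∈) → sound up (lo ∘ there) fr r∈ } }
      where
      open Sorted s
      open ≤-Reasoning
      0<-a₀ : 0# < - a 0F
      0<-a₀ = <-≤-trans (<⇒diff>0 (≰⇒> 0≰a₀)) (≤-reflexive (+-identityˡ _))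
      c = (- a 0F) ⁻¹
    ... | s | yes a₀≤0 | yes 0≤a₀ = record
      { upper = upper ; lower = lower ; free = ((a ∘ Fin.suc) , b) ∷ free
      ; upper-K = upper-K ; lower-K = lower-K
      ; free-K = λ { (here ≡.refl) → resp (λ { 0F → a₀≈0 ; (Fin.suc i) → refl }) refl (rows⊆K (here ≡.refl))
                   ; (there r∈) → free-K r∈ }
      ; sound = λ { {x₀} {x} up lo fr (here ≡.refl) → begin
                      a ∙ (x₀ ◂ x)                     ≈⟨ ∙-head-tail a x₀ x ⟩
                      a 0F * x₀ + (a ∘ Fin.suc) ∙ x    ≈⟨ +-congʳ (trans (*-congʳ a₀≈0) (zeroˡ x₀)) ⟩
                      0# + (a ∘ Fin.suc) ∙ x           ≈⟨ +-identityˡ _ ⟩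
                      (a ∘ Fin.suc) ∙ x                ≤⟨ fr (here ≡.refl) ⟩
                      b                                ∎
                  ; up lo fr (there r∈) → sound up lo (fr ∘ there) r∈ } }
      where
      open Sorted s
      open ≤-Reasoning
      a₀≈0 = antisym a₀≤0 0≤a₀

  -- Fourier–Motzkin elimination of the first variable.
  farkas : ∀ k {K : Row k → Set} → IsCone K → ∀ rows → (∀ {r} → r ∈ rows → K r) →
           (∃[ x ] ∀ {r} → r ∈ rows → Satisfies x r) ⊎ (∃[ b ] b < 0# × K ((λ _ → 0#) , b))
  farkas zero cone [] rows⊆K = inj₁ ((λ ()) , λ ())
  farkas zero cone ((a , b) ∷ rows) rows⊆K with 0# ≤? b | farkas zero cone rows (rows⊆K ∘ there)
  ... | no 0≰b  | _                = inj₂ (b , ≰⇒> 0≰b , IsCone.resp cone (λ ()) refl (rows⊆K (here ≡.refl)))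
  ... | yes 0≤b | inj₁ (x , sat)   = inj₁ (x , λ { (here ≡.refl) → 0≤b ; (there r∈) → sat r∈ })
  ... | yes _   | inj₂ infeasible  = inj₂ infeasible
  farkas (suc k) {K} cone rows rows⊆K = solution (farkas k cone′ rows′ rows′⊆K′)
    where
    open IsCone cone
    open Sorted (sortRows cone rows rows⊆K)

    -- Restricting the cone to rows with leading coefficient 0 keeps an infeasibility certificate
    -- found in k variables valid in k + 1.
    K′ : Row k → Set
    K′ (a , b) = K (0# ◂ a , b)

    cone′ : IsCone K′
    cone′ = record
      { resp  = λ a≈a′ → resp λ { 0F → refl ; (Fin.suc i) → a≈a′ i }
      ; add   = λ r∈K s∈K → resp (λ { 0F → +-identityʳ 0# ; (Fin.suc i) → refl }) refl (add r∈K s∈K)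
      ; scale = λ {c} 0≤c r∈K → resp (λ { 0F → zeroʳ c ; (Fin.suc i) → refl }) refl (scale 0≤c r∈K)
      }

    -- In the sum of an upper and a lower row the leading coefficients 1 and -1 cancel; the sum is
    -- satisfied exactly when that lower bound on the eliminated variable is at most that upper
    -- bound.
    rows′ : List (Row k)
    rows′ = free ++ cartesianProductWith _⊕_ upper lower

    combined-K : ∀ {r} → r ∈ cartesianProductWith _⊕_ upper lower → K′ r
    combined-K r∈ with ∈-cartesianProductWith⁻ _⊕_ upper lower r∈
    ... | u , l , u∈ , l∈ , ≡.refl =
      resp (λ { 0F → -‿inverseʳ 1# ; (Fin.suc i) → refl }) refl (add (upper-K u∈) (lower-K l∈))

    rows′⊆K′ : ∀ {r} → r ∈ rows′ → K′ r
    rows′⊆K′ r∈ with ∈-++⁻ free r∈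
    ... | inj₁ r∈free = free-K r∈free
    ... | inj₂ r∈comb = combined-K r∈comb

    solution : (∃[ x ] ∀ {r} → r ∈ rows′ → Satisfies x r) ⊎ (∃[ b ] b < 0# × K′ ((λ _ → 0#) , b)) →
               (∃[ x ] ∀ {r} → r ∈ rows → Satisfies x r) ⊎ (∃[ b ] b < 0# × K ((λ _ → 0#) , b))
    solution (inj₂ (b , b<0 , r∈K)) = inj₂ (b , b<0 , resp (λ { 0F → refl ; (Fin.suc i) → refl }) refl r∈K)
    solution (inj₁ (x , sat)) with between (map lowerBound lower) (map upperBound upper) lower≤upper
      where
      lowerBound upperBound : Row k → Carrier
      lowerBound (a , b) = a ∙ x - b
      upperBound (a , b) = b - a ∙ x
      lower≤upper : ∀ l h → l ∈ map lowerBound lower → h ∈ map upperBound upper → l ≤ h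
      lower≤upper l h l∈ h∈ with ∈-map⁻ lowerBound l∈ | ∈-map⁻ upperBound h∈
      ... | (a , b) , ab∈ , ≡.refl | (a′ , b′) , ab′∈ , ≡.refl = diff≥0⇒≤
        (trans (solve 4 (λ y b y′ b′ → b′ :- y′ :- (y :- b) := b′ :+ b :- (y′ :+ y)) refl (a ∙ x) b (a′ ∙ x) b′)
          (+-congˡ (-‿cong (sym (∙-⊕ a′ a x)))))
        (≤⇒diff≥0 (sat (∈-++⁺ʳ free (∈-cartesianProductWith⁺ _⊕_ ab′∈ ab∈))))
    ... | x₀ , lower≤x₀ , x₀≤upper = inj₁ (x₀ ◂ x , sound
      (λ r∈ → x₀≤upper _ (∈-map⁺ _ r∈)) (λ r∈ → lower≤x₀ _ (∈-map⁺ _ r∈)) (λ r∈ → sat (∈-++⁺ˡ r∈)))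

-- Enumeration of subsets and independent sets.

vectors-complete : ∀ {A : Set} {xs : List A} → (∀ x → x ∈ xs) → ∀ {k} (v : Vec A k) → v ∈ vectors xs k
vectors-complete complete []      = here ≡.refl
vectors-complete complete (x ∷ v) = ∈-cartesianProductWith⁺ _∷_ (complete x) (vectors-complete complete v)

vectors-unique : ∀ {A : Set} {xs : List A} → Unique xs → ∀ k → Unique (vectors xs k)
vectors-unique !xs zero    = [] ∷ []
vectors-unique !xs (suc k) = Unique.cartesianProductWith⁺ _∷_ Vec.∷-injective !xs (vectors-unique !xs k)

subsets-complete : ∀ {n} (S : Subset n) → S ∈ subsets n
subsets-complete = vectors-complete λ { true → here ≡.refl ; false → there (here ≡.refl) }

subsets-unique : ∀ n → Unique (subsets n)
subsets-unique = vectors-unique (((λ ()) ∷ []) ∷ [] ∷ [])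

_≟ₛ_ : ∀ {n} → DecidableEquality (Subset n)
_≟ₛ_ = Vec.≡-dec Bool._≟_

module _ {n} (G : Graph n) where

  ∈-independentSets⁺ : ∀ {S} → Independent G S → S ∈ independentSets G
  ∈-independentSets⁺ {S} ind-S = ∈-filter⁺ (independent? G) (subsets-complete S) ind-S

  ∈-independentSets⁻ : ∀ {S} → S ∈ independentSets G → Independent G S
  ∈-independentSets⁻ S∈ = proj₂ (∈-filter⁻ (independent? G) {xs = subsets n} S∈)

  independentSets-unique : Unique (independentSets G)
  independentSets-unique = Unique.filter⁺ (independent? G) (subsets-unique n)

  singleton-independent : ∀ {v} → v ∈ₛ vertices G → Independent G ⁅ v ⁆
  singleton-independent {v} v∈G =
      (λ u∈ → ≡.subst (_∈ₛ vertices G) (≡.sym (x∈⁅y⁆⇒x≡y v u∈)) v∈G)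
    , λ u u∈ w w∈ uw → Adj-irrefl G v
        (≡.subst₂ (Adj G) (x∈⁅y⁆⇒x≡y v u∈) (x∈⁅y⁆⇒x≡y v w∈) uw)

-- Fractional colourings and linear programming duality.

module FractionalColourings (ℝ : CompleteOrderedField) where
  open OrderedField ℝ
  open FiniteSums ℝ
  open LinearInequalities ℝ
  open GraphParameters ℝ

  module _ {n} (G : Graph n) where

    private
      Total : Carrier → Set
      Total x = Σ[ w ∈ (Subset n → Carrier) ] IsFractionalColouring G w × x ≈ sumOver (independentSets G) w

      total-nonneg : ∀ {w} → IsFractionalColouring G w → 0# ≤ sumOver (independentSets G) w
      total-nonneg fc = sumOver-nonneg (independentSets G) λ S S∈ →
        IsFractionalColouring.nonneg fc S (∈-independentSets⁻ G S∈)

    -- Singletons cover each vertex. Existence of some fractional colouring is needed before the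
    -- axioms on `sup` say anything about `χf`.
    constant-isFractionalColouring : IsFractionalColouring G (λ _ → 1#)
    constant-isFractionalColouring = record
      { nonneg = λ _ _ → 0≤1
      ; covers = λ v v∈G → ∈⇒≤-sumOver {f = λ _ → 1#} (λ _ → 0≤1)
          (∈-filter⁺ (v ∈ₛ?_) (∈-independentSets⁺ G (singleton-independent G v∈G)) (x∈⁅x⁆ v))
      }

    private
      nonempty : ∃ (Total ∘ -_)
      nonempty = - sumOver (independentSets G) (λ _ → 1#) , (λ _ → 1#) , constant-isFractionalColouring
               , solve 1 (λ x → :- :- x := x) refl _

      bounded : ∃ (UpperBound (Total ∘ -_))
      bounded = 0# , λ { x (w , fc , -x≈) → diff≥0⇒≤
        (trans (+-identityˡ (- x)) -x≈) (total-nonneg fc) }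

    χf-≤ : ∀ {w} → IsFractionalColouring G w → χf G ≤ sumOver (independentSets G) w
    χf-≤ {w} fc = ≤-trans
      (neg-mono-≤ (sup-upper (Total ∘ -_) nonempty bounded (- sumOver (independentSets G) w)
        (w , fc , solve 1 (λ x → :- :- x := x) refl _)))
      (≤-reflexive (solve 1 (λ x → :- :- x := x) refl _))

    ≤-χf : ∀ b → (∀ w → IsFractionalColouring G w → b ≤ sumOver (independentSets G) w) → b ≤ χf G
    ≤-χf b b≤ = ≤-trans
      (≤-reflexive (solve 1 (λ x → x := :- :- x) refl b))
      (neg-mono-≤ (sup-least (Total ∘ -_) nonempty bounded (- b) λ { x (w , fc , -x≈) → begin
        x       ≈⟨ solve 1 (λ x → x := :- :- x) refl x ⟩
        - - x   ≤⟨ neg-mono-≤ (≤-trans (b≤ w fc) (≤-reflexive (sym -x≈))) ⟩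
        - b     ∎ }))
      where open ≤-Reasoning

    χf-nonneg : 0# ≤ χf G
    χf-nonneg = ≤-χf 0# λ _ → total-nonneg

    -- The bound depends on n alone, hence holds for all subgraphs at once; this makes the set
    -- behind `hf` bounded.
    χf-bounded : χf G ≤ fromℕ (length (subsets n))
    χf-bounded = begin
      χf G                                        ≤⟨ χf-≤ constant-isFractionalColouring ⟩
      sumOver (independentSets G) (λ _ → 1#)      ≤⟨ sumOver-filter-≤ (independent? G) (subsets n) (λ _ _ → 0≤1) ⟩
      sumOver (subsets n) (λ _ → 1#)              ≈⟨ sumOver-const (subsets n) 1# ⟩
      fromℕ (length (subsets n)) * 1#             ≈⟨ *-identityʳ _ ⟩
      fromℕ (length (subsets n))                  ∎
      where open ≤-Reasoning

  weight : ∀ {n} → (Fin n → Carrier) → Subset n → Carrier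
  weight {n} μ S = sumOver (allFin n) λ v → ind (v ∈ₛ? S) * μ v

  -- Double counting of Σ μ v * w S over the pairs v ∈ S: covering bounds it below by the weight of
  -- the vertices, and packing bounds it above by M times the total of w. A general M lets a
  -- weighting that is optimal for G be used in a subgraph, where independent sets can be heavier.
  weak-duality : ∀ {n} (H : Graph n) {μ : Fin n → Carrier} {M} → (∀ v → 0# ≤ μ v) → 0# < M →
                 (∀ S → Independent H S → weight μ S ≤ M) →
                 weight μ (vertices H) ≤ M * χf H
  weak-duality {n} H {μ} {M} 0≤μ 0<M μ≤M = begin
      weight μ (vertices H)            ≈⟨ /-*-cancel 0<M ⟨
      M * (weight μ (vertices H) / M)  ≤⟨ *-monoʳ-≤ (proj₁ 0<M) (≤-χf H _ λ w fc → ≤*⇒/≤ 0<M (below w fc)) ⟩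
      M * χf H                         ∎
    where
    open ≤-Reasoning
    𝓘 = independentSets H
    below : ∀ w → IsFractionalColouring H w → weight μ (vertices H) ≤ M * sumOver 𝓘 w
    below w fc = begin
      sumOver (allFin n) (λ v → ind (v ∈ₛ? vertices H) * μ v)
        ≤⟨ sumOver-mono (allFin n) (λ v _ → covered v (v ∈ₛ? vertices H)) ⟩
      sumOver (allFin n) (λ v → μ v * sumOver 𝓘 (λ S → ind (v ∈ₛ? S) * w S))
        ≈⟨ sumOver-cong (allFin n) (λ v → sym (sumOver-*ˡ 𝓘 (μ v) λ S → ind (v ∈ₛ? S) * w S)) ⟩
      sumOver (allFin n) (λ v → sumOver 𝓘 (λ S → μ v * (ind (v ∈ₛ? S) * w S)))
        ≈⟨ sumOver-swap (allFin n) 𝓘 (λ v S → μ v * (ind (v ∈ₛ? S) * w S)) ⟩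
      sumOver 𝓘 (λ S → sumOver (allFin n) (λ v → μ v * (ind (v ∈ₛ? S) * w S)))
        ≈⟨ sumOver-cong 𝓘 (λ S → trans
             (sumOver-cong (allFin n) λ v → solve 3 (λ m i w → m :* (i :* w) := w :* (i :* m)) refl (μ v) (ind (v ∈ₛ? S)) (w S))
             (sumOver-*ˡ (allFin n) (w S) λ v → ind (v ∈ₛ? S) * μ v)) ⟩
      sumOver 𝓘 (λ S → w S * weight μ S)
        ≤⟨ sumOver-mono 𝓘 (λ S S∈ → *-monoʳ-≤ (IsFractionalColouring.nonneg fc S (∈-independentSets⁻ H S∈))
                                              (μ≤M S (∈-independentSets⁻ H S∈))) ⟩
      sumOver 𝓘 (λ S → w S * M)
        ≈⟨ sumOver-cong 𝓘 (λ S → *-comm (w S) M) ⟩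
      sumOver 𝓘 (λ S → M * w S)
        ≈⟨ sumOver-*ˡ 𝓘 M w ⟩
      M * sumOver 𝓘 w ∎
      where
      covered : ∀ v (v∈? : Dec (v ∈ₛ vertices H)) →
                ind v∈? * μ v ≤ μ v * sumOver 𝓘 (λ S → ind (v ∈ₛ? S) * w S)
      covered v (yes v∈H) = begin
        1# * μ v                                          ≈⟨ *-comm 1# (μ v) ⟩
        μ v * 1#                                          ≤⟨ *-monoʳ-≤ (0≤μ v) (IsFractionalColouring.covers fc v v∈H) ⟩
        μ v * sumOver (filter (v ∈ₛ?_) 𝓘) w               ≈⟨ *-congˡ (sumOver-filter (v ∈ₛ?_) 𝓘 w) ⟩
        μ v * sumOver 𝓘 (λ S → ind (v ∈ₛ? S) * w S)       ∎
      covered v (no _) = ≤-trans (≤-reflexive (zeroˡ (μ v))) (*-nonneg (0≤μ v)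
        (sumOver-nonneg 𝓘 λ S S∈ → *-nonneg (ind-nonneg (v ∈ₛ? S))
          (IsFractionalColouring.nonneg fc S (∈-independentSets⁻ H S∈))))

  -- An optimal solution of the dual program, set to 0 off the vertices of G so that sums may run
  -- over all of `Fin n`.
  record IsDualWeighting {n} (G : Graph n) (μ : Fin n → Carrier) : Set where
    field
      nonneg  : ∀ v → 0# ≤ μ v
      support : ∀ v → ¬ v ∈ₛ vertices G → μ v ≈ 0#
      packing : ∀ S → Independent G S → weight μ S ≤ 1#
      total   : sumOver (allFin n) μ ≈ χf G

  weight-support : ∀ {n} {S : Subset n} {μ} → (∀ v → ¬ v ∈ₛ S → μ v ≈ 0#) →
                   sumOver (allFin n) μ ≈ weight μ S
  weight-support {n} {S} {μ} support = sumOver-cong (allFin n) λ v → pointwise v (v ∈ₛ? S)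
    where
    pointwise : ∀ v (v∈? : Dec (v ∈ₛ S)) → μ v ≈ ind v∈? * μ v
    pointwise v (yes _)  = sym (*-identityˡ (μ v))
    pointwise v (no v∉S) = trans (support v v∉S) (sym (zeroˡ (μ v)))

  module _ {n} (G : Graph n) where

    private
      𝓘 = independentSets G
      t = χf G

      cover : (Subset n → Carrier) → Fin n → Carrier
      cover w v = sumOver 𝓘 λ S → ind (v ∈ₛ? S) * w S

      -- The consequences of the dual constraints below, with multipliers
      -- w for the packing constraints and c for the total.
      Consequence : Row n → Set
      Consequence (a , b) = Σ[ w ∈ (Subset n → Carrier) ] Σ[ c ∈ Carrier ]
        (∀ S → 0# ≤ w S) × 0# ≤ c ×
        (∀ v → v ∈ₛ vertices G → a v ≤ cover w v - c) ×
        sumOver 𝓘 w - c * t ≤ b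

      isCone : IsCone Consequence
      isCone = record
        { resp  = λ { a≈a′ b≈b′ (w , c , 0≤w , 0≤c , a≤ , ≤b) →
            w , c , 0≤w , 0≤c
            , (λ v v∈G → ≤-trans (≤-reflexive (sym (a≈a′ v))) (a≤ v v∈G))
            , ≤-trans ≤b (≤-reflexive b≈b′) }
        ; add   = λ { (w , c , 0≤w , 0≤c , a≤ , ≤b) (w′ , c′ , 0≤w′ , 0≤c′ , a′≤ , ≤b′) →
            (λ S → w S + w′ S) , c + c′
            , (λ S → +-nonneg (0≤w S) (0≤w′ S)) , +-nonneg 0≤c 0≤c′
            , (λ v v∈G → ≤-trans (+-mono-≤ (a≤ v v∈G) (a′≤ v v∈G)) (≤-reflexive (trans
                (solve 4 (λ x c x′ c′ → x :- c :+ (x′ :- c′) := x :+ x′ :- (c :+ c′)) refl _ c _ c′)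
                (+-congʳ (sym (trans (sumOver-cong 𝓘 λ S → distribˡ _ _ _) (sumOver-+ 𝓘 _ _)))))))
            , ≤-trans (≤-reflexive (trans (+-congʳ (sumOver-+ 𝓘 w w′))
                (solve 5 (λ x c x′ c′ t → x :+ x′ :- (c :+ c′) :* t := x :- c :* t :+ (x′ :- c′ :* t)) refl _ c _ c′ t)))
                (+-mono-≤ ≤b ≤b′) }
        ; scale = λ { {d} 0≤d (w , c , 0≤w , 0≤c , a≤ , ≤b) →
            (λ S → d * w S) , d * c
            , (λ S → *-nonneg 0≤d (0≤w S)) , *-nonneg 0≤d 0≤c
            , (λ v v∈G → ≤-trans (*-monoʳ-≤ 0≤d (a≤ v v∈G)) (≤-reflexive (trans
                (solve 3 (λ d x c → d :* (x :- c) := d :* x :- d :* c) refl d _ c)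
                (+-congʳ (sym (cover-scale d w v))))))
            , ≤-trans (≤-reflexive (trans (+-congʳ (sumOver-*ˡ 𝓘 d w))
                (solve 4 (λ d x c t → d :* x :- d :* c :* t := d :* (x :- c :* t)) refl d _ c t)))
                (*-monoʳ-≤ 0≤d ≤b) }
        }
        where
        cover-scale : ∀ d w v → cover (λ S → d * w S) v ≈ d * cover w v
        cover-scale d w v = trans
          (sumOver-cong 𝓘 λ S → solve 3 (λ i d w → i :* (d :* w) := d :* (i :* w)) refl _ d _)
          (sumOver-*ˡ 𝓘 d _)

      nonnegRow : Fin n → Row n
      nonnegRow v = (λ u → - ind (u Fin.≟ v)) , 0#

      packingRow : Subset n → Row n
      packingRow S = (λ u → ind (u ∈ₛ? S)) , 1#

      -- Only Σ μ ≥ t is imposed; the opposite inequality will be weak duality with bound 1 on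
      -- independent sets.
      totalRow : Row n
      totalRow = (λ u → - ind (u ∈ₛ? vertices G)) , - t

      rows : List (Row n)
      rows = totalRow ∷ map nonnegRow (allFin n) ++ map packingRow 𝓘

      -- The multipliers of the nonnegativity rows are not recorded: they are the slack in the
      -- inequality that `Consequence` demands of the coefficients.
      nonnegRow-consequence : ∀ v → Consequence (nonnegRow v)
      nonnegRow-consequence v = (λ _ → 0#) , 0# , (λ _ → ≤-refl) , ≤-refl
        , (λ u _ → begin
            - ind (u Fin.≟ v)         ≤⟨ neg-mono-≤ (ind-nonneg (u Fin.≟ v)) ⟩
            - 0#                      ≈⟨ +-identityˡ _ ⟨
            0# - 0#                   ≈⟨ +-congʳ (sumOver-0 𝓘) ⟨
            sumOver 𝓘 (λ _ → 0#) - 0# ≈⟨ +-congʳ (sumOver-cong 𝓘 λ S → zeroʳ (ind (u ∈ₛ? S))) ⟨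
            cover (λ _ → 0#) u - 0#   ∎)
        , ≤-reflexive (trans (+-congʳ (sumOver-0 𝓘)) (solve 1 (λ t → con (+ 0) :- con (+ 0) :* t := con (+ 0)) refl t))
        where open ≤-Reasoning

      packingRow-consequence : ∀ {S} → S ∈ 𝓘 → Consequence (packingRow S)
      packingRow-consequence {S} S∈ = w , 0# , 0≤w , ≤-refl
        , (λ v _ → begin
            ind (v ∈ₛ? S)              ≈⟨ trans (*-congˡ (ind-yes (S ≟ₛ S) ≡.refl)) (*-identityʳ _) ⟨
            ind (v ∈ₛ? S) * w S        ≤⟨ ∈⇒≤-sumOver {f = λ S′ → ind (v ∈ₛ? S′) * w S′}
                                            (λ S′ → *-nonneg (ind-nonneg (v ∈ₛ? S′)) (0≤w S′)) S∈ ⟩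
            cover w v                  ≈⟨ solve 1 (λ x → x := x :- con (+ 0)) refl _ ⟩
            cover w v - 0#             ∎)
        , (begin
            sumOver 𝓘 w - 0# * t       ≈⟨ solve 2 (λ x t → x :- con (+ 0) :* t := x) refl _ t ⟩
            sumOver 𝓘 w                ≈⟨ sumOver-support (independentSets-unique G) S∈
                                            (λ S′ S′≢S → ind-no (S′ ≟ₛ S) S′≢S) ⟩
            w S                        ≤⟨ ind-≤-1 (S ≟ₛ S) ⟩
            1#                         ∎)
        where
        open ≤-Reasoning
        w : Subset n → Carrier
        w S′ = ind (S′ ≟ₛ S)
        0≤w : ∀ S′ → 0# ≤ w S′
        0≤w S′ = ind-nonneg (S′ ≟ₛ S)

      totalRow-consequence : Consequence totalRow
      totalRow-consequence = (λ _ → 0#) , 1# , (λ _ → ≤-refl) , 0≤1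
        , (λ v v∈G → begin
            - ind (v ∈ₛ? vertices G)  ≈⟨ -‿cong (ind-yes (v ∈ₛ? vertices G) v∈G) ⟩
            - 1#                      ≈⟨ +-identityˡ _ ⟨
            0# - 1#                   ≈⟨ +-congʳ (sumOver-0 𝓘) ⟨
            sumOver 𝓘 (λ _ → 0#) - 1# ≈⟨ +-congʳ (sumOver-cong 𝓘 λ S → zeroʳ (ind (v ∈ₛ? S))) ⟨
            cover (λ _ → 0#) v - 1#   ∎)
        , ≤-reflexive (trans (+-congʳ (sumOver-0 𝓘)) (solve 1 (λ t → con (+ 0) :- con (+ 1) :* t := :- t) refl t))
        where open ≤-Reasoning

      rows-consequence : ∀ {r} → r ∈ rows → Consequence r
      rows-consequence (here ≡.refl) = totalRow-consequence
      rows-consequence (there r∈) with ∈-++⁻ (map nonnegRow (allFin n)) r∈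
      ... | inj₁ r∈nonneg with ∈-map⁻ nonnegRow r∈nonneg
      ...   | v , _ , ≡.refl = nonnegRow-consequence v
      rows-consequence (there r∈) | inj₂ r∈packing with ∈-map⁻ packingRow r∈packing
      ...   | S , S∈ , ≡.refl = packingRow-consequence S∈

      -- If c > 0, then w / c is a fractional colouring, so Σ w ≥ c * t by the definition of t as an
      -- infimum. If c = 0, then Σ w ≥ 0 suffices. In both cases b ≥ 0.
      no-contradiction : ∀ {b} → b < 0# → ¬ Consequence ((λ _ → 0#) , b)
      no-contradiction {b} b<0 (w , c , 0≤w , 0≤c , 0≤cover-c , ≤b) with c ≤? 0#
      ... | yes c≤0 = <⇒≱ b<0 (begin
          0#                    ≤⟨ sumOver-nonneg 𝓘 (λ S _ → 0≤w S) ⟩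
          sumOver 𝓘 w           ≈⟨ solve 2 (λ x t → x := x :- con (+ 0) :* t) refl _ t ⟩
          sumOver 𝓘 w - 0# * t  ≈⟨ +-congˡ (-‿cong (*-congʳ (antisym 0≤c c≤0))) ⟩
          sumOver 𝓘 w - c * t   ≤⟨ ≤b ⟩
          b                     ∎)
        where open ≤-Reasoning
      ... | no c≰0 = <⇒≱ b<0 (begin
          0#                           ≤⟨ ≤⇒diff≥0 ct≤Σw ⟩
          sumOver 𝓘 w - c * t          ≤⟨ ≤b ⟩
          b                            ∎)
        where
        open ≤-Reasoning
        0<c = ≰⇒> c≰0

        scaled : IsFractionalColouring G (λ S → c ⁻¹ * w S)
        scaled = record
          { nonneg = λ S _ → *-nonneg (⁻¹-nonneg 0<c) (0≤w S)
          ; covers = λ v v∈G → *-cancelˡ-≤ 0<c (begin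
              c * 1#                                                   ≈⟨ *-identityʳ c ⟩
              c                                                        ≤⟨ diff≥0⇒≤ refl (0≤cover-c v v∈G) ⟩
              cover w v                                                ≈⟨ *-identityˡ _ ⟨
              1# * cover w v                                           ≈⟨ *-congʳ (inverseʳ 0<c) ⟨
              c * c ⁻¹ * cover w v                                     ≈⟨ *-assoc c (c ⁻¹) _ ⟩
              c * (c ⁻¹ * cover w v)                                   ≈⟨ *-congˡ (*-congˡ (sumOver-filter (v ∈ₛ?_) 𝓘 w)) ⟨
              c * (c ⁻¹ * sumOver (filter (v ∈ₛ?_) 𝓘) w)               ≈⟨ *-congˡ (sumOver-*ˡ (filter (v ∈ₛ?_) 𝓘) (c ⁻¹) w) ⟨
              c * sumOver (filter (v ∈ₛ?_) 𝓘) (λ S → c ⁻¹ * w S)       ∎)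
          }

        ct≤Σw : c * t ≤ sumOver 𝓘 w
        ct≤Σw = begin
          c * t                              ≤⟨ *-monoʳ-≤ 0≤c (χf-≤ G scaled) ⟩
          c * sumOver 𝓘 (λ S → c ⁻¹ * w S)   ≈⟨ *-congˡ (sumOver-*ˡ 𝓘 (c ⁻¹) w) ⟩
          c * (c ⁻¹ * sumOver 𝓘 w)           ≈⟨ *-assoc c (c ⁻¹) _ ⟨
          c * c ⁻¹ * sumOver 𝓘 w             ≈⟨ *-congʳ (inverseʳ 0<c) ⟩
          1# * sumOver 𝓘 w                   ≈⟨ *-identityˡ _ ⟩
          sumOver 𝓘 w                        ∎

      optimal : (∃[ x ] ∀ {r} → r ∈ rows → Satisfies x r) → ∃ (IsDualWeighting G)
      optimal (x , sat) = μ , record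
        { nonneg  = 0≤μ
        ; support = support
        ; packing = packing
        ; total   = antisym total≤t t≤total
        }
        where
        open ≤-Reasoning

        -- No row bounds x from above off the vertex set; cutting these values to 0 affects neither
        -- the total row nor any packing row.
        μ : Fin n → Carrier
        μ v = ind (v ∈ₛ? vertices G) * x v

        0≤x : ∀ v → 0# ≤ x v
        0≤x v = diff≥0⇒≤ (trans (solve 1 (λ x → x :- con (+ 0) := con (+ 0) :- con (ℤ.- + 1) :* x) refl (x v)) (+-congˡ (-‿cong (sym eq)))) (≤⇒diff≥0
          (sat (there (∈-++⁺ˡ (∈-map⁺ nonnegRow (∈-allFin v))))))
          where
          eq : proj₁ (nonnegRow v) ∙ x ≈ - 1# * x v
          eq = trans
            (sumOver-support (Unique.allFin⁺ n) (∈-allFin v) λ u u≢v →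
              trans (*-congʳ (trans (-‿cong (ind-no (u Fin.≟ v) u≢v)) (solve 0 (:- con (+ 0) := con (+ 0)) refl))) (zeroˡ (x u)))
            (*-congʳ (-‿cong (ind-yes (v Fin.≟ v) ≡.refl)))

        0≤μ : ∀ v → 0# ≤ μ v
        0≤μ v = *-nonneg (ind-nonneg (v ∈ₛ? vertices G)) (0≤x v)

        μ≤x : ∀ v → μ v ≤ x v
        μ≤x v = ≤-trans (*-monoˡ-≤ (0≤x v) (ind-≤-1 (v ∈ₛ? vertices G))) (≤-reflexive (*-identityˡ (x v)))

        support : ∀ v → ¬ v ∈ₛ vertices G → μ v ≈ 0#
        support v v∉G = trans (*-congʳ (ind-no (v ∈ₛ? vertices G) v∉G)) (zeroˡ (x v))

        packing : ∀ S → Independent G S → weight μ S ≤ 1#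
        packing S ind-S = ≤-trans
          (sumOver-mono (allFin n) λ v _ → *-monoʳ-≤ (ind-nonneg (v ∈ₛ? S)) (μ≤x v))
          (sat (there (∈-++⁺ʳ (map nonnegRow (allFin n)) (∈-map⁺ packingRow (∈-independentSets⁺ G ind-S)))))

        t≤total : t ≤ sumOver (allFin n) μ
        t≤total = diff≥0⇒≤
          (trans (solve 2 (λ s t → s :- t := :- t :- con (ℤ.- + 1) :* s) refl _ t) (+-congˡ (-‿cong (sym eq))))
          (≤⇒diff≥0 (sat (here ≡.refl)))
          where
          eq : proj₁ totalRow ∙ x ≈ - 1# * sumOver (allFin n) μ
          eq = trans
            (sumOver-cong (allFin n) λ v → solve 2 (λ i x → :- i :* x := con (ℤ.- + 1) :* (i :* x)) refl (ind (v ∈ₛ? vertices G)) (x v))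
            (sumOver-*ˡ (allFin n) (- 1#) μ)

        total≤t : sumOver (allFin n) μ ≤ t
        total≤t = begin
          sumOver (allFin n) μ     ≈⟨ weight-support support ⟩
          weight μ (vertices G)    ≤⟨ weak-duality G 0≤μ 0<1 packing ⟩
          1# * t                   ≈⟨ *-identityˡ t ⟩
          t                        ∎

    strong-duality : ∃ (IsDualWeighting G)
    strong-duality with farkas n isCone rows rows-consequence
    ... | inj₁ feasible               = optimal feasible
    ... | inj₂ (b , b<0 , infeasible) = ⊥-elim (no-contradiction b<0 infeasible)

-- Greedy colouring, pair sums and a binomial estimate.

module Combinatorics where
  open import Data.Nat.Base using (_+_; _*_; _∸_; _^_; _≤_; _<_; z≤n; s≤s)
  open import Relation.Binary.PropositionalEquality using (refl; cong; sym; trans; subst)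

  private variable
    A B : Set

  -- Greedy colouring

  -- Pigeonhole: if every colour occurs, sending a colour to one of its positions is injective,
  -- because the entry at the position recovers the colour.
  missing-colour : ∀ {k} (cs : List (Maybe (Fin k))) → (∃[ c ] just c ∉ cs) ⊎ k ≤ length cs
  missing-colour {k} cs with Fin.any? (λ c → ¬? (just c ∈? cs))
    where open DecMembership (Maybe.≡-dec (Fin._≟_ {k})) using (_∈?_)
  ... | yes missing = inj₁ missing
  ... | no ¬missing = inj₂ (Fin.injective⇒≤ injective)
    where
    open DecMembership (Maybe.≡-dec (Fin._≟_ {k})) using (_∈?_)
    present : ∀ c → just c ∈ cs
    present c = decidable-stable (just c ∈? cs) λ c∉cs → ¬missing (c , c∉cs)
    position : Fin k → Fin (length cs)
    position c = index (present c)
    injective : ∀ {c c′} → position c ≡ position c′ → c ≡ c′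
    injective {c} {c′} eq = Maybe.just-injective (trans (lookup-index (present c))
      (trans (cong (List.lookup cs) eq) (sym (lookup-index (present c′)))))

  -- The greedy colouring works from the end of the list, so the tail after x consists of the
  -- vertices treated before x.
  data AllSuffixes (P : A → List A → Set) : List A → Set where
    []  : AllSuffixes P []
    _∷_ : ∀ {x xs} → P x xs → AllSuffixes P xs → AllSuffixes P (x ∷ xs)

  -- The value `nothing` marks a vertex left uncoloured, which certifies k conflicts. The conflict
  -- list N is a parameter because it will be neighbours in one application and successors on short
  -- cycles in the other.
  GreedyAt : ∀ {k} → (A → List A → List A) → (A → Maybe (Fin k)) → A → List A → Set
  GreedyAt {k = k} N f x xs =
    (f x ≡ nothing → k ≤ length (N x xs)) ×
    (∀ y → y ∈ N x xs → ∀ c → f x ≡ just c → f y ≢ just c)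

  module _ (_≟_ : DecidableEquality A) where

    private
      update : A → B → (A → B) → A → B
      update x b f y with y ≟ x
      ... | yes _ = b
      ... | no  _ = f y

      update-at : ∀ x (b : B) f → update x b f x ≡ b
      update-at x b f with x ≟ x
      ... | yes _   = refl
      ... | no  x≢x = ⊥-elim (x≢x refl)

      update-off : ∀ {x y} (b : B) f → y ≢ x → update x b f y ≡ f y
      update-off {x = x} {y} b f y≢x with y ≟ x
      ... | yes y≡x = ⊥-elim (y≢x y≡x)
      ... | no  _   = refl

      update-greedy : ∀ {k N} → (∀ x xs y → y ∈ N x xs → y ∈ xs) → ∀ {x b f xs} → All (x ≢_) xs →
                      AllSuffixes (GreedyAt {k = k} N f) xs → AllSuffixes (GreedyAt N (update x b f)) xs
      update-greedy N⊆ [] [] = []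
      update-greedy N⊆ {x} {b} {f} {y ∷ ys} (x≢y ∷ x∉ys) ((full , proper) ∷ rest) =
        ( (λ f′y≡ → full (trans (sym unchanged-y) f′y≡))
        , λ z z∈ c f′y≡ f′z≡ → proper z z∈ c
            (trans (sym unchanged-y) f′y≡)
            (trans (sym (update-off b f (All.lookup x∉ys (N⊆ y ys z z∈) ∘ sym))) f′z≡) )
        ∷ update-greedy N⊆ x∉ys rest
        where
        unchanged-y : update x b f y ≡ f y
        unchanged-y = update-off b f (x≢y ∘ sym)

    greedy-colouring : ∀ k (N : A → List A → List A) → (∀ x xs y → y ∈ N x xs → y ∈ xs) →
                       ∀ {xs} → Unique xs → ∃[ f ] AllSuffixes (GreedyAt {k = k} N f) xs
    greedy-colouring k N N⊆ [] = (λ _ → nothing) , []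
    greedy-colouring k N N⊆ {x ∷ xs} (x∉xs ∷ !xs) with greedy-colouring k N N⊆ !xs
    ... | f , good with missing-colour (map f (N x xs))
    ...   | inj₁ (c , c-missing) = update x (just c) f , (at-x ∷ update-greedy N⊆ x∉xs good)
      where
      at-x : GreedyAt N (update x (just c) f) x xs
      at-x = (λ f′x≡nothing → ⊥-elim (just≢nothing (trans (sym (update-at x (just c) f)) f′x≡nothing)))
           , λ y y∈ c′ f′x≡ f′y≡ → c-missing (subst (_∈ map f (N x xs))
               (trans (trans (sym (update-off (just c) f (All.lookup x∉xs (N⊆ x xs y y∈) ∘ sym))) f′y≡)
                      (trans (sym f′x≡) (update-at x (just c) f)))
               (∈-map⁺ f y∈))
        where
        just≢nothing : just c ≢ nothing
        just≢nothing ()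
    ...   | inj₂ k≤ = update x nothing f , (at-x ∷ update-greedy N⊆ x∉xs good)
      where
      at-x : GreedyAt N (update x nothing f) x xs
      at-x = (λ _ → subst (k ≤_) (List.length-map f (N x xs)) k≤)
           , λ y y∈ c f′x≡just → ⊥-elim (nothing≢just (trans (sym (update-at x nothing f)) f′x≡just))
        where
        nothing≢just : ∀ {c : Fin k} → nothing ≢ just c
        nothing≢just ()

  -- Sums over unordered pairs

  sumℕ : List A → (A → ℕ) → ℕ
  sumℕ []       f = 0
  sumℕ (x ∷ xs) f = f x + sumℕ xs f

  pairSum : (A → A → ℕ) → List A → ℕ
  pairSum e []       = 0
  pairSum e (x ∷ xs) = sumℕ xs (e x) + pairSum e xs

  count : ∀ {P : Set} → Dec P → ℕ
  count (yes _) = 1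
  count (no  _) = 0

  count-mono : ∀ {P Q : Set} (P? : Dec P) (Q? : Dec Q) → (P → Q) → count P? ≤ count Q?
  count-mono (yes p) (yes q) _ = ℕ.≤-refl
  count-mono (yes p) (no ¬q) f = ⊥-elim (¬q (f p))
  count-mono (no _)  Q?      _ = z≤n

  count-cong : ∀ {P Q : Set} (P? : Dec P) (Q? : Dec Q) → (P → Q) → (Q → P) → count P? ≡ count Q?
  count-cong P? Q? f g = ℕ.≤-antisym (count-mono P? Q? f) (count-mono Q? P? g)

  count-× : ∀ {P Q : Set} (P? : Dec P) (Q? : Dec Q) → count (P? ×-dec Q?) ≡ count P? * count Q?
  count-× (yes _) (yes _) = refl
  count-× (yes _) (no  _) = refl
  count-× (no  _) Q?      = refl

  sumℕ-mono : ∀ (xs : List A) {f g : A → ℕ} → (∀ x → x ∈ xs → f x ≤ g x) → sumℕ xs f ≤ sumℕ xs g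
  sumℕ-mono []       f≤g = z≤n
  sumℕ-mono (x ∷ xs) f≤g = ℕ.+-mono-≤ (f≤g x (here refl)) (sumℕ-mono xs λ y y∈ → f≤g y (there y∈))

  sumℕ-cong : ∀ (xs : List A) {f g : A → ℕ} → (∀ x → x ∈ xs → f x ≡ g x) → sumℕ xs f ≡ sumℕ xs g
  sumℕ-cong xs f≡g = ℕ.≤-antisym (sumℕ-mono xs λ x x∈ → ℕ.≤-reflexive (f≡g x x∈))
                                 (sumℕ-mono xs λ x x∈ → ℕ.≤-reflexive (sym (f≡g x x∈)))

  sumℕ-++ : ∀ (xs ys : List A) f → sumℕ (xs ++ ys) f ≡ sumℕ xs f + sumℕ ys f
  sumℕ-++ []       ys f = refl
  sumℕ-++ (x ∷ xs) ys f = trans (cong (f x ℕ.+_) (sumℕ-++ xs ys f)) (sym (ℕ.+-assoc (f x) _ _))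

  sumℕ-map : ∀ (g : A → B) xs f → sumℕ (map g xs) f ≡ sumℕ xs (f ∘ g)
  sumℕ-map g []       f = refl
  sumℕ-map g (x ∷ xs) f = cong (f (g x) ℕ.+_) (sumℕ-map g xs f)

  sumℕ-+ : ∀ (xs : List A) (f g : A → ℕ) → sumℕ xs (λ x → f x + g x) ≡ sumℕ xs f + sumℕ xs g
  sumℕ-+ []       f g = refl
  sumℕ-+ (x ∷ xs) f g rewrite sumℕ-+ xs f g = lemma (f x) (g x) (sumℕ xs f) (sumℕ xs g)
    where
    lemma : ∀ a b c d → a + b + (c + d) ≡ a + c + (b + d)
    lemma = solve-∀

  sumℕ-filter : ∀ {P : Pred A 0ℓ} (P? : Decidable P) xs → length (filter P? xs) ≡ sumℕ xs (count ∘ P?)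
  sumℕ-filter P? []       = refl
  sumℕ-filter P? (x ∷ xs) with P? x
  ... | yes _ = cong suc (sumℕ-filter P? xs)
  ... | no  _ = sumℕ-filter P? xs

  sumℕ-over-filter : ∀ {P : Pred A 0ℓ} (P? : Decidable P) xs f →
                     sumℕ (filter P? xs) f ≡ sumℕ xs (λ x → count (P? x) * f x)
  sumℕ-over-filter P? []       f = refl
  sumℕ-over-filter P? (x ∷ xs) f with P? x
  ... | yes _ = ≡.cong₂ _+_ (sym (ℕ.*-identityˡ (f x))) (sumℕ-over-filter P? xs f)
  ... | no  _ = sumℕ-over-filter P? xs f

  sumℕ-↭ : ∀ {xs ys : List A} f → xs ↭ ys → sumℕ xs f ≡ sumℕ ys f
  sumℕ-↭ f ↭-refl        = refl
  sumℕ-↭ f (prep x p)    = cong (f x ℕ.+_) (sumℕ-↭ f p)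
  sumℕ-↭ {xs = _ ∷ _ ∷ xs} f (swap x y p) rewrite sumℕ-↭ f p = lemma (f x) (f y) _
    where
    lemma : ∀ a b c → a + (b + c) ≡ b + (a + c)
    lemma = solve-∀
  sumℕ-↭ f (↭-trans p q) = trans (sumℕ-↭ f p) (sumℕ-↭ f q)

  -- Reconciles two orders of the vertices: the greedy argument counts edges along the order by
  -- weight, while `edges` lists them by the order of `Fin n`.
  pairSum-↭ : ∀ {e : A → A → ℕ} → (∀ x y → e x y ≡ e y x) →
              ∀ {xs ys} → xs ↭ ys → pairSum e xs ≡ pairSum e ys
  pairSum-↭ e-sym ↭-refl = refl
  pairSum-↭ {e = e} e-sym (prep x p) = ≡.cong₂ _+_ (sumℕ-↭ (e x) p) (pairSum-↭ e-sym p)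
  pairSum-↭ {e = e} e-sym (swap {xs} {ys} x y p)
    rewrite sumℕ-↭ (e x) p | sumℕ-↭ (e y) p | pairSum-↭ {e = e} e-sym p | e-sym x y =
    lemma (e y x) (sumℕ ys (e x)) (sumℕ ys (e y)) (pairSum e ys)
    where
    lemma : ∀ a b c d → a + b + (c + d) ≡ a + c + (b + d)
    lemma = solve-∀
  pairSum-↭ e-sym (↭-trans p q) = trans (pairSum-↭ e-sym p) (pairSum-↭ e-sym q)

  pairSum-mono : ∀ {e e′ : A → A → ℕ} xs → (∀ x y → x ∈ xs → y ∈ xs → e x y ≤ e′ x y) →
                 pairSum e xs ≤ pairSum e′ xs
  pairSum-mono []       e≤e′ = z≤n
  pairSum-mono (x ∷ xs) e≤e′ = ℕ.+-mono-≤
    (sumℕ-mono xs λ y y∈ → e≤e′ x y (here refl) (there y∈))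
    (pairSum-mono xs λ y z y∈ z∈ → e≤e′ y z (there y∈) (there z∈))

  pairSum-suffix : ∀ (e : A → A → ℕ) xs {ys} → pairSum e ys ≤ pairSum e (xs ++ ys)
  pairSum-suffix e []       = ℕ.≤-refl
  pairSum-suffix e (x ∷ xs) = ℕ.≤-trans (pairSum-suffix e xs) (ℕ.m≤n+m _ _)

  -- For the head x of an increasing list, the row of pairs (x , y) survives the test x < y
  -- entirely, while the diagonal and the column of pairs (y , x) vanish.
  increasingPairs-pairSum : ∀ {n} (e : Fin n → Fin n → ℕ) {xs} → AllPairs Fin._<_ xs →
    sumℕ xs (λ x → sumℕ xs λ y → count (x Fin.<? y) * e x y) ≡ pairSum e xs
  increasingPairs-pairSum e [] = refl
  increasingPairs-pairSum {n} e {x ∷ xs} (x<xs ∷ xs↗)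
    rewrite sumℕ-+ xs (λ y → count (y Fin.<? x) * e y x) (λ y → sumℕ xs λ z → count (y Fin.<? z) * e y z) =
    ≡.cong₂ _+_ (≡.cong₂ _+_ diagonal row) (≡.cong₂ _+_ column (increasingPairs-pairSum e xs↗))
    where
    diagonal : count (x Fin.<? x) * e x x ≡ 0
    diagonal with x Fin.<? x
    ... | yes x<x = ⊥-elim (ℕ.<-irrefl refl x<x)
    ... | no  _   = refl
    row : sumℕ xs (λ y → count (x Fin.<? y) * e x y) ≡ sumℕ xs (e x)
    row = sumℕ-cong xs λ y y∈ → one y (All.lookup x<xs y∈)
      where
      one : ∀ y → x Fin.< y → count (x Fin.<? y) * e x y ≡ e x y
      one y x<y with x Fin.<? y
      ... | yes _   = ℕ.*-identityˡ _
      ... | no  x≮y = ⊥-elim (x≮y x<y)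
    column : sumℕ xs (λ y → count (y Fin.<? x) * e y x) ≡ 0
    column = trans (sumℕ-cong xs λ y y∈ → nil y (All.lookup x<xs y∈)) (zeros xs)
      where
      nil : ∀ y → x Fin.< y → count (y Fin.<? x) * e y x ≡ 0
      nil y x<y with y Fin.<? x
      ... | yes y<x = ⊥-elim (ℕ.<-asym x<y y<x)
      ... | no  _   = refl
      zeros : ∀ (ys : List (Fin n)) → sumℕ ys (λ _ → 0) ≡ 0
      zeros []       = refl
      zeros (y ∷ ys) = zeros ys

  sumℕ-cartesianProduct : ∀ (xs : List A) (ys : List B) f →
    sumℕ (cartesianProduct xs ys) f ≡ sumℕ xs (λ x → sumℕ ys λ y → f (x , y))
  sumℕ-cartesianProduct []       ys f = refl
  sumℕ-cartesianProduct (x ∷ xs) ys f = trans (sumℕ-++ (map (x ,_) ys) _ f)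
    (≡.cong₂ _+_ (sumℕ-map (x ,_) ys f) (sumℕ-cartesianProduct xs ys f))

  -- Sublists of a given length

  combinations : ℕ → List A → List (List A)
  combinations zero    xs       = [] ∷ []
  combinations (suc m) []       = []
  combinations (suc m) (x ∷ xs) = map (x ∷_) (combinations m xs) ++ combinations (suc m) xs

  combinations-complete : ∀ {xs ys : List A} → xs ⊆ ys → xs ∈ combinations (length xs) ys
  combinations-complete {xs = []}     xs⊆ys        = here refl
  combinations-complete {xs = x ∷ xs} (y ∷ʳ xs⊆ys) = ∈-++⁺ʳ (map (y ∷_) _) (combinations-complete xs⊆ys)
  combinations-complete {xs = x ∷ xs} (refl ∷ xs⊆ys) = ∈-++⁺ˡ (∈-map⁺ (x ∷_) (combinations-complete xs⊆ys))

  combinations-length : ∀ m {xs ys : List A} → ys ∈ combinations m xs → length ys ≡ m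
  combinations-length zero    (here refl) = refl
  combinations-length (suc m) {x ∷ xs} ys∈ with ∈-++⁻ (map (x ∷_) (combinations m xs)) ys∈
  ... | inj₂ ys∈ʳ = combinations-length (suc m) {xs} ys∈ʳ
  ... | inj₁ ys∈ˡ with ∈-map⁻ (x ∷_) ys∈ˡ
  ...   | zs , zs∈ , refl = cong suc (combinations-length m {xs} zs∈)

  drop-suffix-⊆ : ∀ k (xs ys : List A) → k ≤ length xs → ys ⊆ drop k (xs ++ ys)
  drop-suffix-⊆ zero    []       ys _         = ⊆-refl
  drop-suffix-⊆ zero    (x ∷ xs) ys _         = x ∷ʳ drop-suffix-⊆ zero xs ys z≤n
  drop-suffix-⊆ (suc k) (x ∷ xs) ys (s≤s k≤)  = drop-suffix-⊆ k xs ys k≤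

  -- C(N, m) T⁻ᵐ is at most the full binomial sum (1 + 1/T)ᴺ.
  combinations-count : ∀ T m (xs : List A) →
    length (combinations m xs) * T ^ length xs ≤ T ^ m * suc T ^ length xs
  combinations-count T zero    xs = begin
    1 * T ^ length xs          ≡⟨⟩
    1 * T ^ length xs          ≤⟨ ℕ.*-monoʳ-≤ 1 (ℕ.^-monoˡ-≤ (length xs) (ℕ.n≤1+n T)) ⟩
    1 * suc T ^ length xs      ∎
    where open ℕ.≤-Reasoning
  combinations-count T (suc m) []       = z≤n
  combinations-count T (suc m) (x ∷ xs) = begin
    length (map (x ∷_) (combinations m xs) ++ combinations (suc m) xs) * (T * u)
      ≡⟨ cong (_* (T * u)) (trans (List.length-++ (map (x ∷_) (combinations m xs)))
                                  (cong (_+ b) (List.length-map (x ∷_) (combinations m xs)))) ⟩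
    (a + b) * (T * u)                  ≡⟨ lemma₁ a b T u ⟩
    T * (a * u) + T * (b * u)          ≤⟨ ℕ.+-mono-≤ (ℕ.*-monoʳ-≤ T (combinations-count T m xs)) (ℕ.*-monoʳ-≤ T (combinations-count T (suc m) xs)) ⟩
    T * (w * v) + T * (T * w * v)      ≡⟨ lemma₂ T w v ⟩
    T * w * (suc T * v)                ∎
    where
    open ℕ.≤-Reasoning
    a = length (combinations m xs)
    b = length (combinations (suc m) xs)
    u = T ^ length xs
    v = suc T ^ length xs
    w = T ^ m
    lemma₁ : ∀ a b T u → (a + b) * (T * u) ≡ T * (a * u) + T * (b * u)
    lemma₁ = solve-∀
    lemma₂ : ∀ T w v → T * (w * v) + T * (T * w * v) ≡ T * w * (suc T * v)
    lemma₂ = solve-∀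

  -- In fractions, (1 + 1/T)^k ≤ (T + 1)/a with a = T + 1 - k. The right side is the telescoping
  -- product of (j + 1)/j for a ≤ j ≤ T, and each of its k factors is at least (T + 1)/T.
  [1+T]^k*a≤T^k*[1+T] : ∀ T a k → a + k ≡ suc T → suc T ^ k * a ≤ T ^ k * suc T
  [1+T]^k*a≤T^k*[1+T] T a zero    eq = ℕ.*-monoʳ-≤ 1 (ℕ.≤-reflexive (trans (sym (ℕ.+-identityʳ a)) eq))
  [1+T]^k*a≤T^k*[1+T] T a (suc k) eq = begin
    suc T * suc T ^ k * a        ≡⟨ lemma₁ (suc T ^ k) T a ⟩
    suc T ^ k * (T * a + a)      ≤⟨ ℕ.*-monoʳ-≤ (suc T ^ k) (ℕ.+-monoʳ-≤ (T * a) a≤T) ⟩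
    suc T ^ k * (T * a + T)      ≡⟨ lemma₂ (suc T ^ k) T a ⟩
    T * (suc T ^ k * suc a)      ≤⟨ ℕ.*-monoʳ-≤ T ([1+T]^k*a≤T^k*[1+T] T (suc a) k (trans (sym (ℕ.+-suc a k)) eq)) ⟩
    T * (T ^ k * suc T)          ≡⟨ ℕ.*-assoc T (T ^ k) (suc T) ⟨
    T * T ^ k * suc T            ∎
    where
    open ℕ.≤-Reasoning
    a≤T : a ≤ T
    a≤T = subst (a ≤_) (ℕ.suc-injective (trans (sym (ℕ.+-suc a k)) eq)) (ℕ.m≤m+n a k)
    lemma₁ : ∀ s T a → suc T * s * a ≡ s * (T * a + a)
    lemma₁ = solve-∀
    lemma₂ : ∀ s T a → s * (T * a + T) ≡ T * (s * suc a)
    lemma₂ = solve-∀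

  [1+T]^k≤2T^k : ∀ T k → k + k ≤ suc T → suc T ^ k ≤ 2 * T ^ k
  [1+T]^k≤2T^k T k 2k≤1+T = ℕ.*-cancelʳ-≤ (suc T ^ k) (2 * T ^ k) (suc T) (begin
    suc T ^ k * suc T        ≤⟨ ℕ.*-monoʳ-≤ (suc T ^ k) 1+T≤2a ⟩
    suc T ^ k * (2 * a)      ≡⟨ lemma (suc T ^ k) a ⟩
    2 * (suc T ^ k * a)      ≤⟨ ℕ.*-monoʳ-≤ 2 ([1+T]^k*a≤T^k*[1+T] T a k a+k≡1+T) ⟩
    2 * (T ^ k * suc T)      ≡⟨ ℕ.*-assoc 2 (T ^ k) (suc T) ⟨
    2 * T ^ k * suc T        ∎)
    where
    open ℕ.≤-Reasoning
    a = suc T ∸ k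
    a+k≡1+T : a + k ≡ suc T
    a+k≡1+T = ℕ.m∸n+n≡m (ℕ.≤-trans (ℕ.m≤m+n k k) 2k≤1+T)
    k≤a : k ≤ a
    k≤a = ℕ.+-cancelʳ-≤ k k a (subst (k + k ≤_) (sym a+k≡1+T) 2k≤1+T)
    1+T≤2a : suc T ≤ 2 * a
    1+T≤2a = subst (_≤ 2 * a) a+k≡1+T (subst (a + k ≤_) (sym (cong (a ℕ.+_) (ℕ.+-identityʳ a))) (ℕ.+-monoʳ-≤ a k≤a))
    lemma : ∀ s a → s * (2 * a) ≡ 2 * (s * a)
    lemma = solve-∀

  -- An integer substitute for (1 + 1/T)^T ≤ e. Each half of the exponent contributes a factor 2;
  -- for odd T the larger half is (T + 1)/2, the extreme case that the preceding lemma admits.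
  [1+T]^T≤4T^T : ∀ T → suc T ^ T ≤ 4 * T ^ T
  [1+T]^T≤4T^T T = begin
    suc T ^ T                              ≡⟨ cong (suc T ^_) (ℕ.⌊n/2⌋+⌈n/2⌉≡n T) ⟨
    suc T ^ (i + j)                        ≡⟨ ℕ.^-distribˡ-+-* (suc T) i j ⟩
    suc T ^ i * suc T ^ j                  ≤⟨ ℕ.*-mono-≤ ([1+T]^k≤2T^k T i (ℕ.≤-trans (half≤ T) (ℕ.n≤1+n T)))
                                                         ([1+T]^k≤2T^k T j (half≤ (suc T))) ⟩
    2 * T ^ i * (2 * T ^ j)                ≡⟨ lemma (T ^ i) (T ^ j) ⟩
    4 * (T ^ i * T ^ j)                    ≡⟨ cong (4 *_) (ℕ.^-distribˡ-+-* T i j) ⟨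
    4 * T ^ (i + j)                        ≡⟨ cong (λ k → 4 * T ^ k) (ℕ.⌊n/2⌋+⌈n/2⌉≡n T) ⟩
    4 * T ^ T                              ∎
    where
    open ℕ.≤-Reasoning
    i = ℕ.⌊ T /2⌋
    j = ℕ.⌈ T /2⌉
    half≤ : ∀ n → ℕ.⌊ n /2⌋ + ℕ.⌊ n /2⌋ ≤ n
    half≤ n = ℕ.≤-trans (ℕ.+-monoʳ-≤ ℕ.⌊ n /2⌋ (ℕ.⌊n/2⌋≤⌈n/2⌉ n)) (ℕ.≤-reflexive (ℕ.⌊n/2⌋+⌈n/2⌉≡n n))
    lemma : ∀ a b → 2 * a * (2 * b) ≡ 4 * (a * b)
    lemma = solve-∀

  ^-distribʳ-* : ∀ a b m → (a * b) ^ m ≡ a ^ m * b ^ m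
  ^-distribʳ-* a b zero    = refl
  ^-distribʳ-* a b (suc m) = trans (cong (a * b *_) (^-distribʳ-* a b m)) (lemma a b (a ^ m) (b ^ m))
    where
    lemma : ∀ a b c d → a * b * (c * d) ≡ a * c * (b * d)
    lemma = solve-∀

  -- With N = `length xs` ≤ Tm, the count is at most T^m (1 + 1/T)^N ≤ T^m ((1 + 1/T)^T)^m ≤ (4T)^m.
  -- Powers of T clear the denominators, and r pads the exponent N to Tm.
  combinations-bound : ∀ T .{{_ : ℕ.NonZero T}} m (xs : List A) → length xs ≤ T * m →
                       length (combinations m xs) ≤ (4 * T) ^ m
  combinations-bound T m xs N≤Tm = ℕ.*-cancelʳ-≤ c ((4 * T) ^ m) (T ^ (T * m)) {{ℕ.m^n≢0 T (T * m)}} (begin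
    c * T ^ (T * m)                          ≡⟨ cong (λ k → c * T ^ k) (ℕ.m+[n∸m]≡n N≤Tm) ⟨
    c * T ^ (N + r)                          ≡⟨ cong (c *_) (ℕ.^-distribˡ-+-* T N r) ⟩
    c * (T ^ N * T ^ r)                      ≡⟨ ℕ.*-assoc c (T ^ N) (T ^ r) ⟨
    c * T ^ N * T ^ r                        ≤⟨ ℕ.*-mono-≤ (combinations-count T m xs) (ℕ.^-monoˡ-≤ r (ℕ.n≤1+n T)) ⟩
    T ^ m * suc T ^ N * suc T ^ r            ≡⟨ ℕ.*-assoc (T ^ m) (suc T ^ N) (suc T ^ r) ⟩
    T ^ m * (suc T ^ N * suc T ^ r)          ≡⟨ cong (T ^ m *_) (ℕ.^-distribˡ-+-* (suc T) N r) ⟨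
    T ^ m * suc T ^ (N + r)                  ≡⟨ cong (λ k → T ^ m * suc T ^ k) (ℕ.m+[n∸m]≡n N≤Tm) ⟩
    T ^ m * suc T ^ (T * m)                  ≡⟨ cong (T ^ m *_) (ℕ.^-*-assoc (suc T) T m) ⟨
    T ^ m * (suc T ^ T) ^ m                  ≤⟨ ℕ.*-monoʳ-≤ (T ^ m) (ℕ.^-monoˡ-≤ m ([1+T]^T≤4T^T T)) ⟩
    T ^ m * (4 * T ^ T) ^ m                  ≡⟨ cong (T ^ m *_) (^-distribʳ-* 4 (T ^ T) m) ⟩
    T ^ m * (4 ^ m * (T ^ T) ^ m)            ≡⟨ lemma (T ^ m) (4 ^ m) _ ⟩
    4 ^ m * T ^ m * (T ^ T) ^ m              ≡⟨ ≡.cong₂ _*_ (sym (^-distribʳ-* 4 T m)) (ℕ.^-*-assoc T T m) ⟩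
    (4 * T) ^ m * T ^ (T * m)                ∎)
    where
    open ℕ.≤-Reasoning
    c = length (combinations m xs)
    N = length xs
    r = T * m ∸ N
    lemma : ∀ a b c → a * (b * c) ≡ b * a * c
    lemma = solve-∀

  module _ {P : A → List A → Set} where

    suffix-at : ∀ {xs x} → AllSuffixes P xs → x ∈ xs → ∃[ ys ] P x ys
    suffix-at (Pxs ∷ _)   (here refl) = _ , Pxs
    suffix-at (_ ∷ rest)  (there x∈)  = suffix-at rest x∈

    suffix-between : ∀ {xs x y} → AllSuffixes P xs → x ∈ xs → y ∈ xs → x ≢ y →
                     (∃[ ys ] P x ys × y ∈ ys) ⊎ (∃[ ys ] P y ys × x ∈ ys)
    suffix-between (_   ∷ _)    (here refl) (here refl) x≢y = ⊥-elim (x≢y refl)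
    suffix-between (Pxs ∷ _)    (here refl) (there y∈)  _   = inj₁ (_ , Pxs , y∈)
    suffix-between (Pxs ∷ _)    (there x∈)  (here refl) _   = inj₂ (_ , Pxs , x∈)
    suffix-between (_   ∷ rest) (there x∈)  (there y∈)  x≢y = suffix-between rest x∈ y∈ x≢y

    suffixes-zip : ∀ {R : Rel A 0ℓ} {xs} → AllSuffixes P xs → AllPairs R xs →
                   AllSuffixes (λ x ys → P x ys × All (R x) ys) xs
    suffixes-zip []           []          = []
    suffixes-zip (Pxs ∷ rest) (Rxs ∷ Rs)  = (Pxs , Rxs) ∷ suffixes-zip rest Rs

open Combinatorics

-- Induced subgraphs, short cycles and girth.

module ShortCycles where
  open import Data.Nat.Base using (_≤_; _<_; z≤n; s≤s)
  open import Relation.Binary.PropositionalEquality using (refl; cong; sym; trans; subst)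
  open import Relation.Binary.Construct.Add.Supremum.NonStrict ℕ._≤_ using ([_]; _≤⊤⁺)

  private variable
    n : ℕ

  module _ {P : Pred (Fin n) 0ℓ} (P? : Decidable P) where

    comprehension : Subset n
    comprehension = Vec.tabulate (⌊_⌋ ∘ P?)

    ∈-comprehension⁺ : ∀ {v} → P v → v ∈ₛ comprehension
    ∈-comprehension⁺ {v} Pv = Vec.lookup⇒[]= v comprehension
      (trans (Vec.lookup∘tabulate (⌊_⌋ ∘ P?) v) (Equivalence.to T-≡ (fromWitness {a? = P? v} Pv)))

    ∈-comprehension⁻ : ∀ {v} → v ∈ₛ comprehension → P v
    ∈-comprehension⁻ {v} v∈ = toWitness {a? = P? v} (Equivalence.from T-≡
      (trans (sym (Vec.lookup∘tabulate (⌊_⌋ ∘ P?) v)) (Vec.[]=⇒lookup v∈)))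

  module _ (X : Graph n) (W : Subset n) where

    induced : Graph n
    induced = record
      { vertices     = vertices X ∩ W
      ; adj          = λ u v → adj X u v ∧ (⌊ u ∈ₛ? W ⌋ ∧ ⌊ v ∈ₛ? W ⌋)
      ; Adj-sym      = λ u v uv → let (uv′ , uW∧vW) = to T-∧ uv; (uW , vW) = to (T-∧ {⌊ u ∈ₛ? W ⌋}) uW∧vW in
                         from T-∧ (Adj-sym X u v uv′ , from (T-∧ {⌊ v ∈ₛ? W ⌋}) (vW , uW))
      ; Adj-irrefl   = λ u uu → Adj-irrefl X u (proj₁ (to T-∧ uu))
      ; Adj-vertices = λ u v uv → let (uv′ , uW∧vW) = to T-∧ uv in
                         x∈p∩q⁺ (Adj-vertices X u v uv′ , toWitness {a? = u ∈ₛ? W} (proj₁ (to (T-∧ {⌊ u ∈ₛ? W ⌋}) uW∧vW)))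
      }
      where open Equivalence using (to; from)

    induced-Adj⁻ : ∀ {u v} → Adj induced u v → Adj X u v × u ∈ₛ W × v ∈ₛ W
    induced-Adj⁻ {u} {v} uv = let (uv′ , uW∧vW) = to T-∧ uv; (uW , vW) = to (T-∧ {⌊ u ∈ₛ? W ⌋}) uW∧vW in
      uv′ , toWitness {a? = u ∈ₛ? W} uW , toWitness {a? = v ∈ₛ? W} vW
      where open Equivalence using (to)

    induced-Adj⁺ : ∀ {u v} → Adj X u v → u ∈ₛ W → v ∈ₛ W → Adj induced u v
    induced-Adj⁺ {u} {v} uv uW vW =
      from T-∧ (uv , from (T-∧ {⌊ u ∈ₛ? W ⌋}) (fromWitness {a? = u ∈ₛ? W} uW , fromWitness {a? = v ∈ₛ? W} vW))
      where open Equivalence using (from)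

    induced-⊑ : induced ⊑ X
    induced-⊑ = proj₁ ∘ x∈p∩q⁻ (vertices X) W , λ u v → proj₁ ∘ induced-Adj⁻

    induced-independent : ∀ {S} → Independent induced S → Independent X S
    induced-independent (S⊆ , S-indep) = proj₁ induced-⊑ ∘ S⊆ ,
      λ u u∈S v v∈S uv → S-indep u u∈S v v∈S (induced-Adj⁺ uv (inW u∈S) (inW v∈S))
      where
      inW : ∀ {v} → v ∈ₛ _ → v ∈ₛ W
      inW = proj₂ ∘ x∈p∩q⁻ (vertices X) W ∘ S⊆

  module _ {k : ℕ} (f : Fin n → Maybe (Fin k)) where

    colourClass : Fin k → Subset n
    colourClass c = comprehension λ v → Maybe.≡-dec Fin._≟_ (f v) (just c)

    ∈-colourClass⁺ : ∀ {c v} → f v ≡ just c → v ∈ₛ colourClass c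
    ∈-colourClass⁺ {c} = ∈-comprehension⁺ λ v → Maybe.≡-dec Fin._≟_ (f v) (just c)

    ∈-colourClass⁻ : ∀ {c v} → v ∈ₛ colourClass c → f v ≡ just c
    ∈-colourClass⁻ {c} = ∈-comprehension⁻ λ v → Maybe.≡-dec Fin._≟_ (f v) (just c)

  ⊑-trans : {G H K : Graph n} → G ⊑ H → H ⊑ K → G ⊑ K
  ⊑-trans (V⊆ , E⊆) (V⊆′ , E⊆′) = V⊆′ ∘ V⊆ , λ u v → E⊆′ u v ∘ E⊆ u v

  IsCycle-⊑ : ∀ {H X : Graph n} → H ⊑ X → ∀ c → IsCycle H c → IsCycle X c
  IsCycle-⊑ (_ , E⊆) (u ∷ vs) (len , uniq , linked , least , oriented) =
    len , uniq , Linked.map (E⊆ _ _) linked , least , oriented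

  cycles-⊑ : ∀ {H X : Graph n} → H ⊑ X → ∀ {c} → c ∈ cycles H → c ∈ cycles X
  cycles-⊑ {n} {H} {X} H⊑X {c} c∈ with ∈-filter⁻ (isCycle? H) {xs = candidates} c∈
    where candidates = concatMap (λ k → map Vec.toList (vectors (allFin n) k)) (upTo (suc n))
  ... | c∈candidates , cycle = ∈-filter⁺ (isCycle? X) c∈candidates (IsCycle-⊑ {H = H} {X} H⊑X c cycle)

  cycles-IsCycle : ∀ (X : Graph n) {c} → c ∈ cycles X → IsCycle X c
  cycles-IsCycle {n} X c∈ = proj₂ (∈-filter⁻ (isCycle? X) {xs = candidates} c∈)
    where candidates = concatMap (λ k → map Vec.toList (vectors (allFin n) k)) (upTo (suc n))

  ≤-girth : ∀ r (H : Graph n) → (∀ {c} → c ∈ cycles H → r ≤ length c) → Sup.[ r ] ≤⁺ girth H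
  ≤-girth r H r≤ = Extrema.v≤min⁺ ℕ∞-totalOrder (Sup.[ r ] ≤⊤⁺) (All.map⁺ (All.tabulate λ c∈ → [ r≤ c∈ ]))

  module _ (r : ℕ) (X : Graph n) where
    open DecMembership (Fin._≟_ {n}) using (_∈?_)

    private
      through : Fin n → List (List (Fin n))
      through v = filter (v ∈?_) (shortCycles r X)

    through≤maxShortCycles : ∀ {v} → v ∈ₛ vertices X → length (through v) ≤ maxShortCycles r X
    through≤maxShortCycles {v} v∈X = All.lookup
      (ℕExtrema.xs≤max 0 (map (length ∘ through) (filter (_∈ₛ? vertices X) (allFin n))))
      (∈-map⁺ (length ∘ through) (∈-filter⁺ (_∈ₛ? vertices X) (∈-allFin v) v∈X))

    -- Two listed cycles through v would share v. The second claim of the theorem thereby becomes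
    -- the case D = 1 of the first.
    disjoint⇒maxShortCycles≤1 : DisjointShortCycles r X → maxShortCycles r X ≤ 1
    disjoint⇒maxShortCycles≤1 disjoint = ℕExtrema.max≤v⁺ z≤n
      (All.map⁺ (All.tabulate {xs = filter (_∈ₛ? vertices X) (allFin n)} λ {v} _ →
        at-most-one v (AllPairs.filter⁺ (v ∈?_) disjoint) (All.all-filter (v ∈?_) (shortCycles r X))))
      where
      at-most-one : ∀ v {cs} → AllPairs Disjoint cs → All (v ∈_) cs → length cs ≤ 1
      at-most-one v []                    []              = z≤n
      at-most-one v (_ ∷ [])              (_ ∷ [])        = ℕ.≤-refl
      at-most-one v ((c#c′ ∷ _) ∷ _ ∷ _)  (v∈c ∷ v∈c′ ∷ _) = ⊥-elim (c#c′ (v∈c , v∈c′))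

    private
      -- Takes the second entry without testing that u is the first. A cycle that starts elsewhere
      -- then forbids an extra colour, but each short cycle through u still forbids at most one, so
      -- d + 1 colours suffice.
      successor : Fin n → List (Fin n) → Fin n
      successor u (_ ∷ v ∷ _) = v
      successor u _           = u

      forbidden : Fin n → List (Fin n) → List (Fin n)
      forbidden u vs = filter (_∈? vs) (map (successor u) (through u))

      forbidden⊆ : ∀ u vs v → v ∈ forbidden u vs → v ∈ vs
      forbidden⊆ u vs v v∈ = proj₂ (∈-filter⁻ (_∈? vs) {xs = map (successor u) (through u)} v∈)

    -- A short cycle lists its least vertex first, so that it is not
    -- monochromatic if each vertex avoids the colour of its successor on
    -- the cycles in which it is the least vertex.
    short-cycle-colouring : ∀ d → maxShortCycles r X ≤ d →
      Σ[ f ∈ (Fin n → Maybe (Fin (suc d))) ]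
        (∀ v → v ∈ₛ vertices X → ∃[ c ] f v ≡ just c) ×
        (∀ c → Sup.[ r ] ≤⁺ girth (induced X (colourClass f c)))
    short-cycle-colouring d λ≤d with greedy-colouring Fin._≟_ (suc d) forbidden forbidden⊆ (Unique.allFin⁺ n)
    ... | f , greedy = f , coloured , λ c → ≤-girth r _ (long c)
      where
      coloured : ∀ v → v ∈ₛ vertices X → ∃[ c ] f v ≡ just c
      coloured v v∈X with f v | suffix-at greedy (∈-allFin v)
      ... | just c  | _ = c , refl
      ... | nothing | vs , full , _ = ⊥-elim (ℕ.<⇒≱ (full refl) (begin
          length (forbidden v vs)                   ≤⟨ List.length-filter (_∈? vs) (map (successor v) (through v)) ⟩
          length (map (successor v) (through v))    ≡⟨ List.length-map (successor v) (through v) ⟩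
          length (through v)                        ≤⟨ through≤maxShortCycles v∈X ⟩
          maxShortCycles r X                        ≤⟨ λ≤d ⟩
          d                                         ∎))
        where open ℕ.≤-Reasoning

      increasing : AllPairs Fin._<_ (allFin n)
      increasing = AllPairs.tabulate⁺-< id

      -- Colouring runs from the largest vertex down, so v > u lies in the suffix at u and its
      -- colour is already fixed when u is coloured.
      proper : ∀ {u v} → u Fin.< v → v ∈ map (successor u) (through u) → ∀ c → f u ≡ just c → f v ≢ just c
      proper {u} {v} u<v v∈ c fu with suffix-between (suffixes-zip greedy increasing) (∈-allFin u) (∈-allFin v) (Fin.<⇒≢ u<v)
      ... | inj₁ (vs , ((_ , avoid) , _) , v∈vs) = avoid v (∈-filter⁺ (_∈? vs) v∈ v∈vs) c fu
      ... | inj₂ (us , (_ , v<us) , u∈us)        = ⊥-elim (ℕ.<-asym u<v (All.lookup v<us u∈us))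

      long : ∀ c {vs} → vs ∈ cycles (induced X (colourClass f c)) → r ≤ length vs
      long c {vs} vs∈ with r ℕ.≤? length vs | cycles-IsCycle (induced X (colourClass f c)) vs∈
      ... | yes r≤ | _ = r≤
      long c {u ∷ []}     vs∈ | no _ | (s≤s () , _)
      long c {u ∷ v ∷ vs} vs∈ | no r≰ | (_ , _ , (uv ∷ _) , (u<v ∷ _) , _)
        with induced-Adj⁻ X (colourClass f c) uv
      ... | _ , u∈c , v∈c = ⊥-elim (proper u<v
          (∈-map⁺ (successor u) (∈-filter⁺ (u ∈?_)
            (∈-filter⁺ (λ c → length c ℕ.<? r) (cycles-⊑ {H = induced X (colourClass f c)} {X} (induced-⊑ X (colourClass f c)) vs∈) (ℕ.≰⇒> r≰))
            (here refl)))
          c (∈-colourClass⁻ f u∈c) (∈-colourClass⁻ f v∈c))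

open ShortCycles

-- Edges inside a vertex set and retained edges.

module _ {n} (G : Graph n) where
  open DecMembership (Fin._≟_ {n}) using (_∈?_)

  Within : List (Fin n) → Fin n × Fin n → Set
  Within P (u , v) = u ∈ P × v ∈ P

  within? : ∀ P → Decidable (Within P)
  within? P (u , v) = u ∈? P ×-dec v ∈? P

  ∈-select⁻ : ∀ {A : Set} (xs : List A) ω {x} → x ∈ select xs ω → x ∈ xs
  ∈-select⁻ []       []            ()
  ∈-select⁻ (x ∷ xs) (inside  ∷ ω) (here x≡)  = here x≡
  ∈-select⁻ (x ∷ xs) (inside  ∷ ω) (there x∈) = there (∈-select⁻ xs ω x∈)
  ∈-select⁻ (x ∷ xs) (outside ∷ ω) x∈         = there (∈-select⁻ xs ω x∈)

  retained-Adj : ∀ ω {u v} → (u , v) ∈ select (edges G) ω → Adj (spanning G ω) u v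
  retained-Adj ω {u} {v} uv∈ = Equivalence.from T-∧
    ( proj₂ (proj₂ (∈-filter⁻ (λ (u , v) → u Fin.<? v ×-dec adj? G u v) {xs = cartesianProduct (allFin n) (allFin n)}
        (∈-select⁻ (edges G) ω uv∈)))
    , fromWitness {a? = (u , v) ∈ₑ? select (edges G) ω ⊎-dec (v , u) ∈ₑ? select (edges G) ω} (inj₁ uv∈) )
    where open DecMembership (≡-dec (Fin._≟_ {n}) (Fin._≟_ {n})) using () renaming (_∈?_ to _∈ₑ?_)

  -- Turns independence in the random graph into a statement about the list of retained edges, the
  -- form whose probability can be computed by recursion.
  independent-avoids : ∀ ω {I} → Independent (spanning G ω) I → ∀ P → (∀ v → v ∈ P → v ∈ₛ I) →
                       All (¬_ ∘ Within P) (select (edges G) ω)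
  independent-avoids ω (_ , I-indep) P P⊆I = All.tabulate λ {(u , v)} uv∈ (u∈P , v∈P) →
    I-indep u (P⊆I u u∈P) v (P⊆I v v∈P) (retained-Adj ω uv∈)

  edgesWithin : List (Fin n) → ℕ
  edgesWithin P = length (filter (within? P) (edges G))

  edgesWithin-pairSum : ∀ P → edgesWithin P ≡
                        pairSum (λ u v → count (adj? G u v) ℕ.* count (within? P (u , v))) (allFin n)
  edgesWithin-pairSum P = begin
    length (filter (within? P) (edges G))
      ≡⟨ sumℕ-filter (within? P) (edges G) ⟩
    sumℕ (edges G) (count ∘ within? P)
      ≡⟨ sumℕ-over-filter (λ (u , v) → u Fin.<? v ×-dec adj? G u v) (cartesianProduct (allFin n) (allFin n)) (count ∘ within? P) ⟩
    sumℕ (cartesianProduct (allFin n) (allFin n)) (λ (u , v) → count (u Fin.<? v ×-dec adj? G u v) ℕ.* count (within? P (u , v)))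
      ≡⟨ sumℕ-cartesianProduct (allFin n) (allFin n) (λ (u , v) → count (u Fin.<? v ×-dec adj? G u v) ℕ.* count (within? P (u , v))) ⟩
    sumℕ (allFin n) (λ u → sumℕ (allFin n) λ v → count (u Fin.<? v ×-dec adj? G u v) ℕ.* count (within? P (u , v)))
      ≡⟨ sumℕ-cong (allFin n) (λ u _ → sumℕ-cong (allFin n) λ v _ → ≡.trans
           (≡.cong (ℕ._* count (within? P (u , v))) (count-× (u Fin.<? v) (adj? G u v)))
           (ℕ.*-assoc (count (u Fin.<? v)) (count (adj? G u v)) (count (within? P (u , v))))) ⟩
    sumℕ (allFin n) (λ u → sumℕ (allFin n) λ v → count (u Fin.<? v) ℕ.* (count (adj? G u v) ℕ.* count (within? P (u , v))))
      ≡⟨ increasingPairs-pairSum (λ u v → count (adj? G u v) ℕ.* count (within? P (u , v))) (AllPairs.tabulate⁺-< id) ⟩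
    pairSum (λ u v → count (adj? G u v) ℕ.* count (within? P (u , v))) (allFin n) ∎
    where open ≡.≡-Reasoning

-- Probabilities in the random subgraph.

module RandomSubgraphs (ℝ : CompleteOrderedField) where
  open OrderedField ℝ
  open FiniteSums ℝ
  open GraphParameters ℝ

  module _ {p : Carrier} (0<p : 0# < p) (p<1 : p < 1#) where

    private
      q = 1# - p

      0≤q : 0# ≤ q
      0≤q = ≤⇒diff≥0 (proj₁ p<1)

      mass : ∀ {k} → Subset k → Carrier
      mass ω = p ^ ∣ ω ∣ * q ^ ∣ ∁ ω ∣

      mass-nonneg : ∀ {k} (ω : Subset k) → 0# ≤ mass ω
      mass-nonneg ω = *-nonneg (^-nonneg (proj₁ 0<p) ∣ ω ∣) (^-nonneg 0≤q ∣ ∁ ω ∣)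

    module _ {A : Set} {Q : Pred A 0ℓ} (Q? : Decidable Q) where

      avoids? : Decidable (All (¬_ ∘ Q))
      avoids? = All.all? (¬? ∘ Q?)

      -- Independence of the edges, by induction on their list: an edge in Q must be dropped and
      -- contributes q, while any other edge contributes p + q = 1.
      ℙ-avoids : ∀ xs → sumOver (subsets (length xs)) (λ ω → ind (avoids? (select xs ω)) * mass ω)
                        ≈ q ^ length (filter Q? xs)
      ℙ-avoids []       = solve 0 (con (+ 1) :* (con (+ 1) :* con (+ 1)) :+ con (+ 0) := con (+ 1)) refl
      ℙ-avoids (x ∷ xs) = begin-equality
        sumOver (subsets (suc (length xs))) F
          ≈⟨ sumOver-++ (map (inside ∷_) Ω) (map (outside ∷_) Ω ++ []) F ⟩
        sumOver (map (inside ∷_) Ω) F + sumOver (map (outside ∷_) Ω ++ []) F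
          ≈⟨ +-congˡ (trans (sumOver-++ (map (outside ∷_) Ω) [] F) (+-identityʳ _)) ⟩
        sumOver (map (inside ∷_) Ω) F + sumOver (map (outside ∷_) Ω) F
          ≈⟨ +-cong (sumOver-map (inside ∷_) Ω F) (sumOver-map (outside ∷_) Ω F) ⟩
        sumOver Ω (F ∘ (inside ∷_)) + sumOver Ω (F ∘ (outside ∷_))
          ≈⟨ +-congˡ (trans (sumOver-cong Ω λ ω → solve 4 (λ i a q b → i :* (a :* (q :* b)) := q :* (i :* (a :* b))) refl _ _ q _)
                            (trans (sumOver-*ˡ Ω q F′) (*-congˡ (ℙ-avoids xs)))) ⟩
        sumOver Ω (F ∘ (inside ∷_)) + q * q ^ length (filter Q? xs)
          ≈⟨ step (Q? x) ⟩
        q ^ length (filter Q? (x ∷ xs)) ∎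
        where
        open ≤-Reasoning
        Ω = subsets (length xs)
        F : Subset (suc (length xs)) → Carrier
        F ω = ind (avoids? (select (x ∷ xs) ω)) * mass ω
        F′ : Subset (length xs) → Carrier
        F′ ω = ind (avoids? (select xs ω)) * mass ω
        step : Dec (Q x) → sumOver Ω (F ∘ (inside ∷_)) + q * q ^ length (filter Q? xs) ≈ q ^ length (filter Q? (x ∷ xs))
        step (yes Qx) = begin-equality
          sumOver Ω (F ∘ (inside ∷_)) + q * q ^ length (filter Q? xs)
            ≈⟨ +-congʳ (trans (sumOver-cong Ω λ ω → trans
                 (*-congʳ (ind-no (avoids? (x ∷ select xs ω)) λ { (¬Qx ∷ _) → ¬Qx Qx })) (zeroˡ _)) (sumOver-0 Ω)) ⟩
          0# + q * q ^ length (filter Q? xs)    ≈⟨ +-identityˡ _ ⟩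
          q ^ suc (length (filter Q? xs))       ≡⟨ ≡.cong (λ ys → q ^ length ys) (List.filter-accept Q? Qx) ⟨
          q ^ length (filter Q? (x ∷ xs))       ∎
        step (no ¬Qx) = begin-equality
          sumOver Ω (F ∘ (inside ∷_)) + q * q ^ length (filter Q? xs)
            ≈⟨ +-congʳ (trans (sumOver-cong Ω λ ω → trans
                 (*-congʳ (antisym (ind-mono (avoids? (x ∷ select xs ω)) (avoids? (select xs ω)) λ { (_ ∷ rest) → rest })
                                   (ind-mono (avoids? (select xs ω)) (avoids? (x ∷ select xs ω)) (¬Qx ∷_))))
                 (solve 4 (λ i p a b → i :* (p :* a :* b) := p :* (i :* (a :* b))) refl _ p _ _))
                 (trans (sumOver-*ˡ Ω p F′) (*-congˡ (ℙ-avoids xs)))) ⟩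
          p * q ^ length (filter Q? xs) + q * q ^ length (filter Q? xs)
            ≈⟨ solve 2 (λ p x → p :* x :+ (con (+ 1) :- p) :* x := x) refl p _ ⟩
          q ^ length (filter Q? xs)             ≡⟨ ≡.cong (λ ys → q ^ length ys) (List.filter-reject Q? ¬Qx) ⟨
          q ^ length (filter Q? (x ∷ xs))       ∎

    -- The indicator of B is at most the sum of the indicators of the avoidance events; exchanging
    -- the two finite sums leaves one avoidance probability for each P.
    union-bound : ∀ {n} (G : Graph n) {B : Pred (Graph n) 0ℓ} (B? : Decidable B) (Ps : List (List (Fin n))) →
      (∀ ω → B (spanning G ω) → ∃[ P ] P ∈ Ps × All (¬_ ∘ Within G P) (select (edges G) ω)) →
      ℙ G p B? ≤ sumOver Ps (λ P → q ^ edgesWithin G P)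
    union-bound {n} G {B} B? Ps witness = begin
      sumOver (filter (B? ∘ spanning G) Ω) mass
        ≈⟨ sumOver-filter (B? ∘ spanning G) Ω mass ⟩
      sumOver Ω (λ ω → ind (B? (spanning G ω)) * mass ω)
        ≤⟨ sumOver-mono Ω (λ ω _ → *-monoˡ-≤ (mass-nonneg ω) (covered ω (B? (spanning G ω)))) ⟩
      sumOver Ω (λ ω → sumOver Ps (λ P → avoid P ω) * mass ω)
        ≈⟨ sumOver-cong Ω (λ ω → trans (*-comm _ (mass ω)) (trans (sym (sumOver-*ˡ Ps (mass ω) λ P → avoid P ω))
             (sumOver-cong Ps λ P → *-comm (mass ω) (avoid P ω)))) ⟩
      sumOver Ω (λ ω → sumOver Ps (λ P → avoid P ω * mass ω))
        ≈⟨ sumOver-swap Ω Ps (λ ω P → avoid P ω * mass ω) ⟩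
      sumOver Ps (λ P → sumOver Ω (λ ω → avoid P ω * mass ω))
        ≈⟨ sumOver-cong Ps (λ P → ℙ-avoids (within? G P) (edges G)) ⟩
      sumOver Ps (λ P → q ^ edgesWithin G P) ∎
      where
      open ≤-Reasoning
      Ω = subsets (length (edges G))
      avoid : List (Fin n) → Subset (length (edges G)) → Carrier
      avoid P ω = ind (avoids? (within? G P) (select (edges G) ω))
      covered : ∀ ω (B?ω : Dec (B (spanning G ω))) → ind B?ω ≤ sumOver Ps (λ P → avoid P ω)
      covered ω (no _)  = sumOver-nonneg Ps λ P _ → ind-nonneg (avoids? (within? G P) (select (edges G) ω))
      covered ω (yes b) with witness ω b
      ... | P , P∈ , avoided = begin
        1#                             ≈⟨ ind-yes (avoids? (within? G P) (select (edges G) ω)) avoided ⟨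
        avoid P ω                      ≤⟨ ∈⇒≤-sumOver {f = λ P → avoid P ω}
                                            (λ P → ind-nonneg (avoids? (within? G P) (select (edges G) ω))) P∈ ⟩
        sumOver Ps (λ P → avoid P ω)   ∎

    ℙ-mono : ∀ {n} (G : Graph n) {B C : Pred (Graph n) 0ℓ} (B? : Decidable B) (C? : Decidable C) →
             (∀ ω → B (spanning G ω) → C (spanning G ω)) → ℙ G p B? ≤ ℙ G p C?
    ℙ-mono G B? C? B⇒C = begin
      sumOver (filter (B? ∘ spanning G) Ω) mass
        ≈⟨ sumOver-filter (B? ∘ spanning G) Ω mass ⟩
      sumOver Ω (λ ω → ind (B? (spanning G ω)) * mass ω)
        ≤⟨ sumOver-mono Ω (λ ω _ → *-monoˡ-≤ (mass-nonneg ω) (ind-mono (B? (spanning G ω)) (C? (spanning G ω)) (B⇒C ω))) ⟩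
      sumOver Ω (λ ω → ind (C? (spanning G ω)) * mass ω)
        ≈⟨ sumOver-filter (C? ∘ spanning G) Ω mass ⟨
      sumOver (filter (C? ∘ spanning G) Ω) mass ∎
      where
      open ≤-Reasoning
      Ω = subsets (length (edges G))

-- Adjacency is taken in G, although I will be independent in G_p: colour classes must be
-- independent in G for packing to apply, and the edges found inside I are the ones that G_p has
-- lost.
earlierNeighbours : ∀ {n} → Graph n → Subset n → Fin n → List (Fin n) → List (Fin n)
earlierNeighbours G I u = filter λ v → v ∈ₛ? I ×-dec adj? G u v

-- Dense segments inside heavy sets.

module HeavySets (ℝ : CompleteOrderedField) where
  open OrderedField ℝ
  open FiniteSums ℝ
  open GraphParameters ℝ
  open FractionalColourings ℝ

  -- Summation by parts: for μ ascending, Σ μ h is a nonnegative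
  -- combination of the sums of h over suffixes.
  positive-suffix : ∀ {A : Set} (μ h : A → Carrier) {xs} → (∀ x → 0# ≤ μ x) →
    AllPairs (λ x y → μ x ≤ μ y) xs → 0# < sumOver xs (λ x → μ x * h x) →
    ∃[ ys ] ∃[ zs ] xs ≡ ys ++ zs × 0# < sumOver zs h
  positive-suffix {A} μ h {xs} 0≤μ xs↗ 0<Σμh with search xs xs↗
    where
    -- The second alternative is strengthened for the induction: it bounds the weighted sum by b
    -- times the plain sum for every lower bound b of the weights. At the head the bound is used
    -- with b = μ x; at the end b = 0 contradicts positivity.
    search : ∀ xs → AllPairs (λ x y → μ x ≤ μ y) xs →
      (∃[ ys ] ∃[ zs ] xs ≡ ys ++ zs × 0# < sumOver zs h) ⊎
      (sumOver xs h ≤ 0# × ∀ b → All (λ x → b ≤ μ x) xs → sumOver xs (λ x → μ x * h x) ≤ b * sumOver xs h)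
    search []       []           = inj₂ (≤-refl , λ b _ → ≤-reflexive (sym (zeroʳ b)))
    search (x ∷ xs) (x≤xs ∷ xs↗) with search xs xs↗
    ... | inj₁ (ys , zs , eq , 0<Σ) = inj₁ (x ∷ ys , zs , ≡.cong (x ∷_) eq , 0<Σ)
    ... | inj₂ (_ , bound) with sumOver (x ∷ xs) h ≤? 0#
    ...   | no Σ≰0  = inj₁ ([] , x ∷ xs , ≡.refl , ≰⇒> Σ≰0)
    ...   | yes Σ≤0 = inj₂ (Σ≤0 , λ { b (b≤μx ∷ _) → begin
        μ x * h x + sumOver xs (λ x → μ x * h x)   ≤⟨ +-monoʳ-≤ _ (bound (μ x) x≤xs) ⟩
        μ x * h x + μ x * sumOver xs h             ≈⟨ distribˡ (μ x) (h x) _ ⟨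
        μ x * (h x + sumOver xs h)                 ≤⟨ diff≥0⇒≤
          (solve 3 (λ m b s → b :* s :- m :* s := (m :- b) :* (con (+ 0) :- s)) refl (μ x) b _)
          (*-nonneg (≤⇒diff≥0 b≤μx) (≤⇒diff≥0 Σ≤0)) ⟩
        b * (h x + sumOver xs h)                   ∎ })
        where open ≤-Reasoning
  ... | inj₁ found       = found
  ... | inj₂ (_ , bound) = ⊥-elim (<⇒≱ 0<Σμh (≤-trans (bound 0# (All.tabulate λ {x} _ → 0≤μ x)) (≤-reflexive (zeroˡ _))))

  private
    -- Here i, u and c are the weights of I, of its uncoloured part and of its coloured part: u - c
    -- ≥ i - 2c ≥ i - 2δ > 2.
    surplus : ∀ {u c δ i} → i ≤ u + c → c ≤ δ → δ + δ + 1+1 < i → 0# < u - c - 1+1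
    surplus {u} {c} {δ} {i} i≤u+c c≤δ heavy = <-≤-trans (<⇒diff>0 heavy) (diff≥0⇒≤
      (solve 5 (λ u c d w i → u :- c :- w :- (i :- (d :+ d :+ w)) := (u :+ c :- i) :+ ((d :- c) :+ (d :- c))) refl u c δ 1+1 i)
      (+-nonneg (≤⇒diff≥0 i≤u+c) (+-nonneg (≤⇒diff≥0 c≤δ) (≤⇒diff≥0 c≤δ))))

    reversed : ∀ {t a b k} → 0# ≤ t → 0# ≤ k → b ≤ a → t * (b - a) - k ≤ 0#
    reversed {t} {a} {b} {k} 0≤t 0≤k b≤a = diff≥0⇒≤
      (solve 4 (λ t b a k → con (+ 0) :- (t :* (b :- a) :- k) := t :* (a :- b) :+ k) refl t b a k)
      (+-nonneg (*-nonneg 0≤t (≤⇒diff≥0 b≤a)) 0≤k)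

    forget : ∀ {t a b k} → 0# ≤ t → 0# ≤ a → 0# ≤ t * (b - a) - k → k ≤ t * b
    forget {t} {a} {b} {k} 0≤t 0≤a 0≤H = diff≥0⇒≤
      (solve 4 (λ t b a k → t :* b :- k := t :* (b :- a) :- k :+ t :* a) refl t b a k)
      (+-nonneg 0≤H (*-nonneg 0≤t 0≤a))

  module _ {n} (G : Graph n) {μ} (dual : IsDualWeighting G μ) (0<t : 0# < χf G)
           {xs} (xs↭ : xs ↭ allFin n) (xs↗ : AllPairs (λ u v → μ u ≤ μ v) xs)
           {I} (I⊆G : I ⊆ₛ vertices G) (d : ℕ) {f : Fin n → Maybe (Fin d)}
           (greedy : AllSuffixes (GreedyAt (earlierNeighbours G I) f) xs) where
    open IsDualWeighting dual renaming (total to Σμ≈t)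

    private
      t = χf G

      _≟c_ : (c c′ : Maybe (Fin d)) → Dec (c ≡ c′)
      _≟c_ = Maybe.≡-dec Fin._≟_

      Coloured Uncoloured : Fin n → Set
      Coloured   v = v ∈ₛ I × f v ≢ nothing
      Uncoloured v = v ∈ₛ I × f v ≡ nothing

      coloured? : Decidable Coloured
      coloured? v = v ∈ₛ? I ×-dec ¬? (f v ≟c nothing)

      uncoloured? : Decidable Uncoloured
      uncoloured? v = v ∈ₛ? I ×-dec f v ≟c nothing

      inClass? : ∀ c → Decidable (λ v → v ∈ₛ I × f v ≡ just c)
      inClass? c v = v ∈ₛ? I ×-dec f v ≟c just c

      class-independent : ∀ c → Independent G (comprehension (inClass? c))
      class-independent c = I⊆G ∘ proj₁ ∘ ∈-comprehension⁻ (inClass? c) , λ u u∈ v v∈ uv →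
        nonadjacent (∈-comprehension⁻ (inClass? c) u∈) (∈-comprehension⁻ (inClass? c) v∈) uv
        where
        nonadjacent : ∀ {u v} → u ∈ₛ I × f u ≡ just c → v ∈ₛ I × f v ≡ just c → ¬ Adj G u v
        nonadjacent {u} {v} (u∈I , fu) (v∈I , fv) uv
          with suffix-between greedy (∈-resp-↭ (↭-sym xs↭) (∈-allFin u)) (∈-resp-↭ (↭-sym xs↭) (∈-allFin v))
                 (λ u≡v → Adj-irrefl G u (≡.subst (Adj G u) (≡.sym u≡v) uv))
        ... | inj₁ (vs , (_ , proper) , v∈) =
          proper v (∈-filter⁺ (λ v → v ∈ₛ? I ×-dec adj? G u v) v∈ (v∈I , uv)) c fu fv
        ... | inj₂ (us , (_ , proper) , u∈) =
          proper u (∈-filter⁺ (λ u → u ∈ₛ? I ×-dec adj? G v u) u∈ (u∈I , Adj-sym G u v uv)) c fv fu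

      -- There are d colour classes, each independent in G and so of weight at most 1.
      coloured-weight : sumOver (allFin n) (λ v → ind (coloured? v) * μ v) ≤ fromℕ d
      coloured-weight = begin
        sumOver (allFin n) (λ v → ind (coloured? v) * μ v)
          ≤⟨ sumOver-mono (allFin n) (λ v _ → ≤-trans (*-monoˡ-≤ (nonneg v) (some-class v (coloured? v)))
               (≤-reflexive (trans (*-comm _ (μ v)) (trans (sym (sumOver-*ˡ (allFin d) (μ v) λ c → ind (v ∈ₛ? class c)))
                 (sumOver-cong (allFin d) λ c → *-comm (μ v) _))))) ⟩
        sumOver (allFin n) (λ v → sumOver (allFin d) λ c → ind (v ∈ₛ? class c) * μ v)
          ≈⟨ sumOver-swap (allFin n) (allFin d) (λ v c → ind (v ∈ₛ? class c) * μ v) ⟩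
        sumOver (allFin d) (λ c → weight μ (class c))
          ≤⟨ sumOver-mono (allFin d) (λ c _ → packing (class c) (class-independent c)) ⟩
        sumOver (allFin d) (λ _ → 1#)
          ≈⟨ sumOver-const (allFin d) 1# ⟩
        fromℕ (length (allFin d)) * 1#
          ≈⟨ *-identityʳ _ ⟩
        fromℕ (length (allFin d))
          ≡⟨ ≡.cong fromℕ (List.length-tabulate {n = d} id) ⟩
        fromℕ d ∎
        where
        open ≤-Reasoning
        class : Fin d → Subset n
        class c = comprehension (inClass? c)
        some-class : ∀ v (c? : Dec (Coloured v)) → ind c? ≤ sumOver (allFin d) (λ c → ind (v ∈ₛ? class c))
        some-class v (no _) = sumOver-nonneg (allFin d) λ c _ → ind-nonneg (v ∈ₛ? class c)
        some-class v (yes (v∈I , fv≢)) with f v in fv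
        ... | nothing = ⊥-elim (fv≢ ≡.refl)
        ... | just c  = ≤-trans (≤-reflexive (sym (ind-yes (v ∈ₛ? class c) (∈-comprehension⁺ (inClass? c) (v∈I , fv)))))
          (∈⇒≤-sumOver {f = λ c → ind (v ∈ₛ? class c)} (λ c → ind-nonneg (v ∈ₛ? class c)) (∈-allFin c))

      backEdge : Fin n → Fin n → ℕ
      backEdge u v = count (adj? G u v) ℕ.* count (u ∈ₛ? I ×-dec v ∈ₛ? I)

      -- Each edge is charged to the endpoint that comes first in the list, so the d edges charged
      -- to different uncoloured vertices are distinct.
      uncoloured-edges : ∀ {vs} → AllSuffixes (GreedyAt (earlierNeighbours G I) f) vs →
                         d ℕ.* length (filter uncoloured? vs) ℕ.≤ pairSum backEdge vs
      uncoloured-edges []                           = ℕ.≤-reflexive (ℕ.*-zeroʳ d)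
      uncoloured-edges {u ∷ vs} ((full , _) ∷ rest) = step (uncoloured? u)
        where
        open ℕ.≤-Reasoning
        step : Dec (Uncoloured u) → d ℕ.* length (filter uncoloured? (u ∷ vs)) ℕ.≤ pairSum backEdge (u ∷ vs)
        step (no ¬unc)         = ℕ.≤-trans
          (ℕ.≤-reflexive (≡.cong (λ ws → d ℕ.* length ws) (List.filter-reject uncoloured? ¬unc)))
          (ℕ.≤-trans (uncoloured-edges rest) (ℕ.m≤n+m _ _))
        step (yes (u∈I , fu≡)) = begin
          d ℕ.* length (filter uncoloured? (u ∷ vs))          ≡⟨ ≡.cong (λ ws → d ℕ.* length ws) (List.filter-accept uncoloured? (u∈I , fu≡)) ⟩
          d ℕ.* suc (length (filter uncoloured? vs))          ≡⟨ ℕ.*-suc d _ ⟩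
          d ℕ.+ d ℕ.* length (filter uncoloured? vs)          ≤⟨ ℕ.+-mono-≤ (full fu≡) (uncoloured-edges rest) ⟩
          length (earlierNeighbours G I u vs) ℕ.+ pairSum backEdge vs
            ≡⟨ ≡.cong (ℕ._+ pairSum backEdge vs) (sumℕ-filter (λ v → v ∈ₛ? I ×-dec adj? G u v) vs) ⟩
          sumℕ vs (λ v → count (v ∈ₛ? I ×-dec adj? G u v)) ℕ.+ pairSum backEdge vs
            ≤⟨ ℕ.+-monoˡ-≤ _ (sumℕ-mono vs λ v _ → ℕ.≤-trans
                 (count-mono (v ∈ₛ? I ×-dec adj? G u v) (adj? G u v ×-dec (u ∈ₛ? I ×-dec v ∈ₛ? I)) λ (v∈I , uv) → uv , u∈I , v∈I)
                 (ℕ.≤-reflexive (count-× (adj? G u v) (u ∈ₛ? I ×-dec v ∈ₛ? I)))) ⟩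
          sumℕ vs (backEdge u) ℕ.+ pairSum backEdge vs        ∎

      suffix-greedy : ∀ ys {zs} → AllSuffixes (GreedyAt (earlierNeighbours G I) f) (ys ++ zs) →
                      AllSuffixes (GreedyAt (earlierNeighbours G I) f) zs
      suffix-greedy []       good       = good
      suffix-greedy (y ∷ ys) (_ ∷ good) = suffix-greedy ys good

      edges-bound : ∀ {ys zs} → xs ≡ ys ++ zs →
        d ℕ.* length (filter uncoloured? zs) ℕ.≤ edgesWithin G (filter (_∈ₛ? I) zs)
      edges-bound {ys} {zs} eq = begin
        d ℕ.* length (filter uncoloured? zs)    ≤⟨ uncoloured-edges (suffix-greedy ys (≡.subst (AllSuffixes _) eq greedy)) ⟩
        pairSum backEdge zs                     ≤⟨ pairSum-mono zs (λ u v u∈ v∈ → ℕ.*-monoʳ-≤ (count (adj? G u v))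
                                                     (count-mono (u ∈ₛ? I ×-dec v ∈ₛ? I) (within? G P (u , v)) λ (u∈I , v∈I) →
                                                       ∈-filter⁺ (_∈ₛ? I) u∈ u∈I , ∈-filter⁺ (_∈ₛ? I) v∈ v∈I)) ⟩
        pairSum withinEdge zs                   ≤⟨ pairSum-suffix withinEdge ys ⟩
        pairSum withinEdge (ys ++ zs)           ≡⟨ ≡.cong (pairSum withinEdge) eq ⟨
        pairSum withinEdge xs                   ≡⟨ pairSum-↭ withinEdge-sym xs↭ ⟩
        pairSum withinEdge (allFin n)           ≡⟨ edgesWithin-pairSum G P ⟨
        edgesWithin G P                         ∎
        where
        open ℕ.≤-Reasoning
        P = filter (_∈ₛ? I) zs
        withinEdge : Fin n → Fin n → ℕ
        withinEdge u v = count (adj? G u v) ℕ.* count (within? G P (u , v))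
        withinEdge-sym : ∀ u v → withinEdge u v ≡ withinEdge v u
        withinEdge-sym u v = ≡.cong₂ ℕ._*_
          (count-cong (adj? G u v) (adj? G v u) (Adj-sym G u v) (Adj-sym G v u))
          (count-cong (within? G P (u , v)) (within? G P (v , u)) (λ (u∈ , v∈) → v∈ , u∈) (λ (v∈ , u∈) → u∈ , v∈))

      -- The test function for `positive-suffix`. As μ has total t, its μ-weighted sum is t(U - C -
      -- 2), with U and C the weights of the uncoloured and coloured vertices. Positivity on a
      -- segment with b uncoloured and a coloured vertices says that t(b - a) exceeds twice its
      -- length, which yields both a < b and the bound on the length.
      h : Fin n → Carrier
      h v = t * (ind (uncoloured? v) - ind (coloured? v)) - 1+1

      ΣhK : ∀ zs → sumOver zs h ≈
        t * (fromℕ (length (filter uncoloured? zs)) - fromℕ (length (filter coloured? zs))) - fromℕ (length zs) * 1+1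
      ΣhK zs = trans (sumOver-- zs _ _) (+-cong
        (trans (sumOver-*ˡ zs t _) (*-congˡ (trans (sumOver-- zs _ _)
          (+-cong (sumOver-ind uncoloured? zs) (-‿cong (sumOver-ind coloured? zs))))))
        (-‿cong (sumOver-const zs 1+1)))

      weight≤ : weight μ I ≤ sumOver (allFin n) (λ v → ind (uncoloured? v) * μ v)
                             + sumOver (allFin n) (λ v → ind (coloured? v) * μ v)
      weight≤ = ≤-trans (sumOver-mono (allFin n) λ v _ → split v (v ∈ₛ? I)) (≤-reflexive (sumOver-+ (allFin n) _ _))
        where
        split : ∀ v (v∈? : Dec (v ∈ₛ I)) → ind v∈? * μ v ≤ ind (uncoloured? v) * μ v + ind (coloured? v) * μ v
        split v (no _)    = ≤-trans (≤-reflexive (zeroˡ (μ v)))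
          (+-nonneg (*-nonneg (ind-nonneg (uncoloured? v)) (nonneg v)) (*-nonneg (ind-nonneg (coloured? v)) (nonneg v)))
        split v (yes v∈I) = case f v ≟c nothing of λ where
          (yes fv≡) → ≤-trans (≤-reflexive (trans (*-congʳ (sym (ind-yes (uncoloured? v) (v∈I , fv≡)))) (sym (+-identityʳ _))))
                          (+-monoʳ-≤ _ (*-nonneg (ind-nonneg (coloured? v)) (nonneg v)))
          (no fv≢)  → ≤-trans (≤-reflexive (trans (*-congʳ (sym (ind-yes (coloured? v) (v∈I , fv≢)))) (sym (+-identityˡ _))))
                          (+-monoˡ-≤ _ (*-nonneg (ind-nonneg (uncoloured? v)) (nonneg v)))

      Σμh : sumOver xs (λ v → μ v * h v) ≈
        t * (sumOver (allFin n) (λ v → ind (uncoloured? v) * μ v)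
             - sumOver (allFin n) (λ v → ind (coloured? v) * μ v) - 1+1)
      Σμh = begin-equality
        sumOver xs (λ v → μ v * h v)
          ≈⟨ sumOver-↭ (λ v → μ v * h v) xs↭ ⟩
        sumOver (allFin n) (λ v → μ v * h v)
          ≈⟨ sumOver-cong (allFin n) (λ v → solve 5 (λ m t u c w → m :* (t :* (u :- c) :- w) := t :* (u :* m :- c :* m) :- w :* m)
               refl (μ v) t (ind (uncoloured? v)) (ind (coloured? v)) 1+1) ⟩
        sumOver (allFin n) (λ v → t * (ind (uncoloured? v) * μ v - ind (coloured? v) * μ v) - 1+1 * μ v)
          ≈⟨ trans (sumOver-- (allFin n) _ _) (+-cong
               (trans (sumOver-*ˡ (allFin n) t _) (*-congˡ (sumOver-- (allFin n) _ _)))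
               (-‿cong (trans (sumOver-*ˡ (allFin n) 1+1 μ) (*-congˡ Σμ≈t)))) ⟩
        t * (U - C) - 1+1 * t
          ≈⟨ solve 4 (λ t u c w → t :* (u :- c) :- w :* t := t :* (u :- c :- w)) refl t U C 1+1 ⟩
        t * (U - C - 1+1) ∎
        where
        open ≤-Reasoning
        U = sumOver (allFin n) (λ v → ind (uncoloured? v) * μ v)
        C = sumOver (allFin n) (λ v → ind (coloured? v) * μ v)

    -- The number b counts uncoloured vertices of the segment. Both b ≥ m/2 and length at most tm/2
    -- are stated without division.
    DenseSuffix : Set
    DenseSuffix = ∃[ ys ] ∃[ zs ] ∃[ b ]
      let P = filter (_∈ₛ? I) zs in
      xs ≡ ys ++ zs × 1 ℕ.≤ length P × length P ℕ.≤ b ℕ.+ b × d ℕ.* b ℕ.≤ edgesWithin G P ×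
      fromℕ (length zs) * 1+1 ≤ χf G * fromℕ (length P)

    private
      positive⇒dense : ∀ ys zs → xs ≡ ys ++ zs → 0# < sumOver zs h → DenseSuffix
      positive⇒dense ys zs eq 0<Σh = ys , zs , b , eq , 1≤m , m≤b+b , edges-bound {ys} eq , short
        where
        a = length (filter coloured? zs)
        b = length (filter uncoloured? zs)
        m = length (filter (_∈ₛ? I) zs)
        k = fromℕ (length zs) * 1+1

        0<H : 0# < t * (fromℕ b - fromℕ a) - k
        0<H = <-≤-trans 0<Σh (≤-reflexive (ΣhK zs))

        0≤k : 0# ≤ k
        0≤k = *-nonneg (fromℕ-nonneg (length zs)) (fromℕ-nonneg 2)

        a<b : a ℕ.< b
        a<b = ℕ.≰⇒> λ b≤a → <⇒≱ 0<H (reversed (proj₁ 0<t) 0≤k (fromℕ-mono-≤ b≤a))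

        b≤m : b ℕ.≤ m
        b≤m = ≡.subst₂ ℕ._≤_ (≡.sym (sumℕ-filter uncoloured? zs)) (≡.sym (sumℕ-filter (_∈ₛ? I) zs))
          (sumℕ-mono zs λ v _ → count-mono (uncoloured? v) (v ∈ₛ? I) proj₁)

        m≤b+b : m ℕ.≤ b ℕ.+ b
        m≤b+b = begin
          m                                                              ≡⟨ sumℕ-filter (_∈ₛ? I) zs ⟩
          sumℕ zs (λ v → count (v ∈ₛ? I))                                ≤⟨ sumℕ-mono zs (λ v _ → split v) ⟩
          sumℕ zs (λ v → count (uncoloured? v) ℕ.+ count (coloured? v))  ≡⟨ sumℕ-+ zs _ _ ⟩
          sumℕ zs (count ∘ uncoloured?) ℕ.+ sumℕ zs (count ∘ coloured?)  ≡⟨ ≡.cong₂ ℕ._+_ (sumℕ-filter uncoloured? zs) (sumℕ-filter coloured? zs) ⟨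
          b ℕ.+ a                                                        ≤⟨ ℕ.+-monoʳ-≤ b (ℕ.<⇒≤ a<b) ⟩
          b ℕ.+ b                                                        ∎
          where
          open ℕ.≤-Reasoning
          split : ∀ v → count (v ∈ₛ? I) ℕ.≤ count (uncoloured? v) ℕ.+ count (coloured? v)
          split v with v ∈ₛ? I | f v ≟c nothing
          ... | yes _ | yes _ = ℕ.s≤s ℕ.z≤n
          ... | yes _ | no _  = ℕ.s≤s ℕ.z≤n
          ... | no _  | _     = ℕ.z≤n

        1≤m : 1 ℕ.≤ m
        1≤m = ℕ.≤-trans (ℕ.≤-trans (ℕ.s≤s ℕ.z≤n) a<b) b≤m

        short : k ≤ t * fromℕ m
        short = ≤-trans (forget (proj₁ 0<t) (fromℕ-nonneg a) (proj₁ 0<H))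
          (*-monoʳ-≤ (proj₁ 0<t) (fromℕ-mono-≤ b≤m))

    dense-suffix : fromℕ d + fromℕ d + 1+1 < weight μ I → DenseSuffix
    dense-suffix heavy = extract (positive-suffix μ h nonneg xs↗ 0<Σμh)
      where
      0<Σμh : 0# < sumOver xs (λ v → μ v * h v)
      0<Σμh = <-≤-trans (*-pos 0<t (surplus weight≤ coloured-weight heavy)) (≤-reflexive (sym Σμh))

      extract : (∃[ ys ] ∃[ zs ] xs ≡ ys ++ zs × 0# < sumOver zs h) → DenseSuffix
      extract (ys , zs , eq , 0<Σh) = positive⇒dense ys zs eq 0<Σh

-- The search descends from n and stops at the first failure, so minimality means failure at the
-- predecessor; the applications use exactly this.
least : ∀ {P : Pred ℕ 0ℓ} → Decidable P → ∀ n → P n → ∃[ m ] P m × (m ≡ 0 ⊎ ∃[ k ] m ≡ suc k × ¬ P k)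
least P? zero    Pn = 0 , Pn , inj₁ ≡.refl
least P? (suc n) Pn with P? n
... | yes Pn′ = least P? n Pn′
... | no  ¬Pn = suc n , Pn , inj₂ (n , ≡.refl , ¬Pn)

-- Euler's number and the logarithm.

module Logarithm (ℝ : CompleteOrderedField) where
  open OrderedField ℝ
  open FiniteSums ℝ

  0<1+1 : 0# < 1+1
  0<1+1 = fromℕ-pos 1

  private
    ½ = 1+1 ⁻¹

    2^k≤[1+k]! : ∀ k → 1# ≤ factorial (suc k) * ½ ^ k
    2^k≤[1+k]! zero    = ≤-reflexive (solve 0 (con (+ 1) := (con (+ 1) :+ con (+ 0)) :* con (+ 1) :* con (+ 1)) refl)
    2^k≤[1+k]! (suc k) = begin
      1#                                                       ≤⟨ 2^k≤[1+k]! k ⟩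
      factorial (suc k) * ½ ^ k                                ≈⟨ *-identityˡ _ ⟨
      1# * (factorial (suc k) * ½ ^ k)                         ≈⟨ *-congʳ (inverseʳ 0<1+1) ⟨
      1+1 * ½ * (factorial (suc k) * ½ ^ k)                    ≤⟨ *-monoˡ-≤ (≤-trans 0≤1 (2^k≤[1+k]! k))
                                                                    (*-monoˡ-≤ (⁻¹-nonneg 0<1+1) (fromℕ-mono-≤ {2} {suc (suc k)} (ℕ.s≤s (ℕ.s≤s ℕ.z≤n)))) ⟩
      fromℕ (suc (suc k)) * ½ * (factorial (suc k) * ½ ^ k)    ≈⟨ solve 4 (λ n h f p → n :* h :* (f :* p) := n :* f :* (h :* p)) refl _ ½ _ _ ⟩
      factorial (suc (suc k)) * ½ ^ suc k                      ∎
      where open ≤-Reasoning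

  factorial-pos : ∀ n → 0# < factorial n
  factorial-pos zero    = 0<1
  factorial-pos (suc n) = *-pos (fromℕ-pos n) (factorial-pos n)

  -- The partial sum 1/0! + 1/1! is 2, but it lies below the supremum only once the partial sums are
  -- known to be bounded. Comparing 1/(k + 1)! with 2^(-k) bounds them by 3.
  2≤e : 1+1 ≤ e
  2≤e = ≤-trans (≤-reflexive (sym S₂≈2)) (sup-upper PartialSum (_ , 0 , refl) (1# + 1+1 , bounded) _ (2 , refl))
    where
    term : ℕ → Carrier
    term k = factorial k ⁻¹

    PartialSum : Carrier → Set
    PartialSum x = ∃[ n ] x ≈ sumOver (upTo n) term

    term₀ : term 0 ≈ 1#
    term₀ = sym (⁻¹-unique 0<1 (*-identityʳ 1#))

    term₁ : term 1 ≈ 1#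
    term₁ = sym (⁻¹-unique (factorial-pos 1) (solve 0 ((con (+ 1) :+ con (+ 0)) :* con (+ 1) :* con (+ 1) := con (+ 1)) refl))

    S₂≈2 : sumOver (upTo 2) term ≈ 1+1
    S₂≈2 = +-cong term₀ (+-congʳ term₁)

    bounded : UpperBound PartialSum (1# + 1+1)
    bounded x (zero , x≈) = ≤-trans (≤-reflexive x≈) (fromℕ-nonneg 3)
    bounded x (suc n , x≈) = begin
      x                                       ≈⟨ x≈ ⟩
      sumOver (upTo (suc n)) term             ≈⟨ sumOver-upTo-suc n term ⟩
      term 0 + sumOver (upTo n) (term ∘ suc)  ≤⟨ +-mono-≤ (≤-reflexive term₀) (sumOver-mono (upTo n) λ k _ →
                                                   *-cancelˡ-≤ (factorial-pos (suc k))
                                                     (≤-trans (≤-reflexive (inverseʳ (factorial-pos (suc k)))) (2^k≤[1+k]! k))) ⟩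
      1# + sumOver (upTo n) (½ ^_)            ≤⟨ +-monoʳ-≤ 1# (geometric-sum-≤ (⁻¹-nonneg 0<1+1) (≤-reflexive (inverseʳ 0<1+1)) n) ⟩
      1# + 1+1                                ∎
      where open ≤-Reasoning

  module _ {b : Carrier} (1<b : 1# < b) where

    private
      0≤b : 0# ≤ b
      0≤b = ≤-trans 0≤1 (proj₁ 1<b)

      0<b : 0# < b
      0<b = <-≤-trans 0<1 (proj₁ 1<b)

      1≤b^ : ∀ n → 1# ≤ b ^ n
      1≤b^ zero    = ≤-refl
      1≤b^ (suc n) = ≤-trans (≤-reflexive (sym (*-identityʳ 1#))) (*-mono-≤ 0≤1 0≤b (proj₁ 1<b) (1≤b^ n))

    ^-cancel-≤ : ∀ m n → b ^ m ≤ b ^ n → m ℕ.≤ n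
    ^-cancel-≤ zero    n       _   = ℕ.z≤n
    ^-cancel-≤ (suc m) zero    b^≤ = ⊥-elim (<⇒≱ 1<b (≤-trans
      (≤-trans (≤-reflexive (sym (*-identityʳ b))) (*-monoʳ-≤ 0≤b (1≤b^ m))) b^≤))
    ^-cancel-≤ (suc m) (suc n) b^≤ = ℕ.s≤s (^-cancel-≤ m n (*-cancelˡ-≤ 0<b b^≤))

    -- Bernoulli's inequality with h = b - 1 reduces this to `archimedean`, whose double negation it
    -- inherits.
    powers-unbounded : ∀ x → ¬ ¬ (∃[ n ] x ≤ b ^ n)
    powers-unbounded x ¬∃ = archimedean (x / h) λ { (n , x/h≤n) → ¬∃ (n , (begin
      x                    ≈⟨ /-*-cancel 0<h ⟨
      h * (x / h)          ≤⟨ *-monoʳ-≤ (proj₁ 0<h) x/h≤n ⟩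
      h * fromℕ n          ≤⟨ diff≥0⇒≤ (solve 2 (λ h n → con (+ 1) :+ n :* h :- h :* n := con (+ 1)) refl h (fromℕ n)) 0≤1 ⟩
      1# + fromℕ n * h     ≤⟨ bernoulli (proj₁ 0<h) n ⟩
      (1# + h) ^ n         ≈⟨ ^-congˡ n (solve 1 (λ b → con (+ 1) :+ (b :- con (+ 1)) := b) refl b) ⟩
      b ^ n                ∎)) }
      where
      open ≤-Reasoning
      h = b - 1#
      0<h = <⇒diff>0 1<b

    module _ {x : Carrier} (1≤x : 1# ≤ x) where

      private
        0≤x : 0# ≤ x
        0≤x = ≤-trans 0≤1 1≤x

        Below : Carrier → Set
        Below y = ∃[ i ] ∃[ j ] ∃[ n ]
          (y ≈ (fromℕ i - fromℕ j) / fromℕ (suc n)) × (b ^ i ≤ b ^ j * x ^ suc n)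

        module _ (k : ℕ) (x≤b^k : x ≤ b ^ k) where

          -- From x ≤ b^k, membership of (i - j)/(n + 1) gives b^i ≤ b^(j + k(n + 1)), and exponents
          -- can be compared as b > 1. Without such a bound nothing is known about the supremum
          -- `log b x`.
          bounded : UpperBound Below (fromℕ k)
          bounded y (i , j , n , y≈ , b^i≤) = ≤-trans (≤-reflexive y≈) (≤*⇒/≤ (fromℕ-pos n) (begin
            fromℕ i - fromℕ j                            ≤⟨ +-monoˡ-≤ (- fromℕ j) (fromℕ-mono-≤ i≤) ⟩
            fromℕ (j ℕ.+ k ℕ.* suc n) - fromℕ j          ≈⟨ +-congʳ (trans (×-homo-+ 1# j (k ℕ.* suc n)) (+-congˡ (×1-homo-* k (suc n)))) ⟩
            fromℕ j + fromℕ k * fromℕ (suc n) - fromℕ j  ≈⟨ solve 3 (λ j k n → j :+ k :* n :- j := n :* k) refl (fromℕ j) (fromℕ k) (fromℕ (suc n)) ⟩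
            fromℕ (suc n) * fromℕ k                      ∎))
            where
            open ≤-Reasoning
            i≤ : i ℕ.≤ j ℕ.+ k ℕ.* suc n
            i≤ = ^-cancel-≤ i (j ℕ.+ k ℕ.* suc n) (begin
              b ^ i                         ≤⟨ b^i≤ ⟩
              b ^ j * x ^ suc n             ≤⟨ *-monoʳ-≤ (^-nonneg 0≤b j) (^-monoˡ-≤ 0≤x x≤b^k (suc n)) ⟩
              b ^ j * (b ^ k) ^ suc n       ≈⟨ *-congˡ (^-assocʳ b k (suc n)) ⟩
              b ^ j * b ^ (k ℕ.* suc n)     ≈⟨ ^-homo-* b j (k ℕ.* suc n) ⟨
              b ^ (j ℕ.+ k ℕ.* suc n)       ∎)

          ≤-log : ∀ {y} → Below y → y ≤ log b x
          ≤-log {y} below = sup-upper Below (y , below) (fromℕ k , bounded) y below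

      -- If d - 1 is a failing exponent, b^(d - 1) ≤ x^4 puts the rational (d - 1)/4 into the set
      -- that defines the logarithm; the witness 3 encodes the denominator 4. If d = 0, the rational
      -- 0 gives `log b x` ≥ 0.
      log-nearest : ¬ ¬ (∃[ d ] x ^ 4 ≤ b ^ d × fromℕ d ≤ fromℕ 4 * log b x + 1#)
      log-nearest ¬∃ = powers-unbounded x λ { (k , x≤b^k) →
        let (d , x⁴≤b^d , minimal) = least (λ d → x ^ 4 ≤? b ^ d) (k ℕ.* 4)
              (≤-trans (^-monoˡ-≤ 0≤x x≤b^k 4) (≤-reflexive (^-assocʳ b k 4)))
        in ¬∃ (d , x⁴≤b^d , near k x≤b^k minimal) }
        where
        open ≤-Reasoning
        near : ∀ k {d} → x ≤ b ^ k → d ≡ 0 ⊎ (∃[ d′ ] d ≡ suc d′ × ¬ x ^ 4 ≤ b ^ d′) →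
               fromℕ d ≤ fromℕ 4 * log b x + 1#
        near k x≤b^k (inj₁ ≡.refl) = +-nonneg (*-nonneg (fromℕ-nonneg 4) (begin
          0#                           ≈⟨ solve 1 (λ i → con (+ 0) := (con (+ 0) :- con (+ 0)) :* i) refl _ ⟩
          (0# - 0#) / fromℕ 1          ≤⟨ ≤-log k x≤b^k (0 , 0 , 0 , refl ,
                                            (≤-trans 1≤x (≤-reflexive (solve 1 (λ x → x := con (+ 1) :* (x :* con (+ 1))) refl x)))) ⟩
          log b x                      ∎)) 0≤1
        near k x≤b^k (inj₂ (d′ , ≡.refl , x⁴≰)) = begin
          1# + fromℕ d′                ≈⟨ +-comm 1# (fromℕ d′) ⟩
          fromℕ d′ + 1#                ≈⟨ +-congʳ (/-*-cancel (fromℕ-pos 3)) ⟨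
          fromℕ 4 * (fromℕ d′ / fromℕ 4) + 1#
            ≤⟨ +-monoˡ-≤ 1# (*-monoʳ-≤ (fromℕ-nonneg 4) (≤-log k x≤b^k (d′ , 0 , 3 ,
                 *-congʳ (solve 1 (λ d → d := d :- con (+ 0)) refl (fromℕ d′)) ,
                 ≤-trans (≰⇒≥ x⁴≰) (≤-reflexive (sym (*-identityˡ (x ^ 4))))))) ⟩
          fromℕ 4 * log b x + 1#       ∎

-- The probability of a heavy independent set.

module HeavyIndependentSets (ℝ : CompleteOrderedField) where
  open OrderedField ℝ
  open FiniteSums ℝ
  open GraphParameters ℝ
  open FractionalColourings ℝ
  open RandomSubgraphs ℝ
  open HeavySets ℝ
  open Logarithm ℝ

  -- In ascending order the segments of heaviest vertices are suffixes, which list recursion and the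
  -- greedy colouring reach first.
  ascending : ∀ {n} (μ : Fin n → Carrier) →
              ∃[ xs ] xs ↭ allFin n × Unique xs × AllPairs (λ u v → μ u ≤ μ v) xs
  ascending {n} μ = sort (allFin n) , sort-↭ (allFin n)
    , PermutationSetoid.Unique-resp-↭ (≡.setoid (Fin n)) (↭⇒↭ₛ (↭-sym (sort-↭ (allFin n)))) (Unique.allFin⁺ n)
    , Linked⇒AllPairs ≤-trans (sort-↗ (allFin n))
    where open Sort (On.decTotalOrder ≤-decTotalOrder μ)

  -- The integer `suc T` is the ceiling of t/2, and segment lengths tm/2 are rounded up to its
  -- multiples. It stays below t because 2(S + 1) = 2 + 2S ≤ t + t.
  half-ceiling : ∀ {t} N → 1+1 ≤ t → t ≤ fromℕ N → ∃[ T ] t ≤ fromℕ (suc T) * 1+1 × fromℕ (suc T) ≤ t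
  half-ceiling {t} N 2≤t t≤N = from-least (least (λ T → t ≤? fromℕ T * 1+1) N (begin
      t                       ≤⟨ t≤N ⟩
      fromℕ N                 ≈⟨ *-identityʳ _ ⟨
      fromℕ N * 1#            ≤⟨ *-monoʳ-≤ (fromℕ-nonneg N) (1≤fromℕ-suc 1) ⟩
      fromℕ N * 1+1           ∎))
    where
    open ≤-Reasoning
    from-least : (∃[ T ] t ≤ fromℕ T * 1+1 × (T ≡ 0 ⊎ ∃[ S ] T ≡ suc S × ¬ t ≤ fromℕ S * 1+1)) →
                 ∃[ T ] t ≤ fromℕ (suc T) * 1+1 × fromℕ (suc T) ≤ t
    from-least (_ , t≤0 , inj₁ ≡.refl) = ⊥-elim (<⇒≱ 0<1+1 (≤-trans 2≤t (≤-trans t≤0 (≤-reflexive (zeroˡ 1+1)))))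
    from-least (_ , t≤2T , inj₂ (S , ≡.refl , t≰2S)) = S , t≤2T , *-cancelˡ-≤ 0<1+1 (begin
      1+1 * (1# + fromℕ S)    ≈⟨ solve 2 (λ w s → w :* (con (+ 1) :+ s) := w :+ s :* w) refl 1+1 (fromℕ S) ⟩
      1+1 + fromℕ S * 1+1     ≤⟨ +-mono-≤ 2≤t (≰⇒≥ t≰2S) ⟩
      t + t                   ≈⟨ solve 1 (λ t → t :+ t := (con (+ 1) :+ (con (+ 1) :+ con (+ 0))) :* t) refl t ⟩
      1+1 * t                 ∎)

  module _ {n} (G : Graph n) {μ} (dual : IsDualWeighting G μ) (2≤t : 1+1 ≤ χf G)
           {p} (0<p : 0# < p) (p<1 : p < 1#)
           {x} (4t≤x : fromℕ 4 * χf G ≤ x) (d : ℕ) (q^d*x⁴≤1 : (1# - p) ^ d * x ^ 4 ≤ 1#) where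

    private
      t = χf G
      q = 1# - p
      y = x ⁻¹
      z = y * y

      0<t : 0# < t
      0<t = <-≤-trans 0<1+1 2≤t

      0<x : 0# < x
      0<x = <-≤-trans (*-pos (fromℕ-pos 3) 0<t) 4t≤x

      0≤y : 0# ≤ y
      0≤y = ⁻¹-nonneg 0<x

      0≤z : 0# ≤ z
      0≤z = *-nonneg 0≤y 0≤y

      0≤q : 0# ≤ q
      0≤q = ≤⇒diff≥0 (proj₁ p<1)

      q≤1 : q ≤ 1#
      q≤1 = diff≥0⇒≤ (solve 1 (λ p → con (+ 1) :- (con (+ 1) :- p) := p) refl p) (proj₁ 0<p)

      4ty≤1 : fromℕ 4 * t * y ≤ 1#
      4ty≤1 = ≤-trans (*-monoˡ-≤ 0≤y 4t≤x) (≤-reflexive (inverseʳ 0<x))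

      y≤1 : y ≤ 1#
      y≤1 = ≤-trans (≤-trans (≤-reflexive (sym (*-identityˡ y))) (*-monoˡ-≤ 0≤y 1≤4t)) 4ty≤1
        where
        1≤4t : 1# ≤ fromℕ 4 * t
        1≤4t = ≤-trans (≤-reflexive (sym (*-identityʳ 1#)))
          (*-mono-≤ 0≤1 (fromℕ-nonneg 4) (1≤fromℕ-suc 3) (≤-trans (1≤fromℕ-suc 1) 2≤t))

      z≤1 : z ≤ 1#
      z≤1 = ≤-trans (*-mono-≤ 0≤y 0≤1 y≤1 y≤1) (≤-reflexive (*-identityʳ 1#))

      q^d≤z² : q ^ d ≤ z * z
      q^d≤z² = begin
        q ^ d                                  ≈⟨ *-identityʳ _ ⟨
        q ^ d * 1#                             ≈⟨ *-congˡ (trans (*-cong xxyy≈1 xxyy≈1) (*-identityʳ 1#)) ⟨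
        q ^ d * ((x * y) * (x * y) * ((x * y) * (x * y)))
          ≈⟨ solve 3 (λ q x y → q :* ((x :* y) :* (x :* y) :* ((x :* y) :* (x :* y)))
                                := q :* (x :* (x :* (x :* (x :* con (+ 1))))) :* (y :* y :* (y :* y))) refl (q ^ d) x y ⟩
        q ^ d * x ^ 4 * (z * z)                ≤⟨ *-monoˡ-≤ (*-nonneg 0≤z 0≤z) q^d*x⁴≤1 ⟩
        1# * (z * z)                           ≈⟨ *-identityˡ _ ⟩
        z * z                                  ∎
        where
        open ≤-Reasoning
        xxyy≈1 : x * y * (x * y) ≈ 1#
        xxyy≈1 = trans (*-cong (inverseʳ 0<x) (inverseʳ 0<x)) (*-identityʳ 1#)

      -- Each uncoloured vertex accounts for d missing edges, hence for q^d ≤ x⁻⁴ = z². As at least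
      -- half of the m vertices are uncoloured and z ≤ 1, this averages to z per vertex.
      sparse-mass : ∀ {b m k} → m ℕ.≤ b ℕ.+ b → d ℕ.* b ℕ.≤ k → q ^ k ≤ z ^ m
      sparse-mass {b} {m} {k} m≤b+b db≤k = begin
        q ^ k              ≤⟨ ^-antitone-≤ 0≤q q≤1 db≤k ⟩
        q ^ (d ℕ.* b)      ≈⟨ ^-assocʳ q d b ⟨
        (q ^ d) ^ b        ≤⟨ ^-monoˡ-≤ (^-nonneg 0≤q d) q^d≤z² b ⟩
        (z * z) ^ b        ≈⟨ ^-distrib-* z z b ⟩
        z ^ b * z ^ b      ≈⟨ ^-homo-* z b b ⟨
        z ^ (b ℕ.+ b)      ≤⟨ ^-antitone-≤ 0≤z z≤1 m≤b+b ⟩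
        z ^ m              ∎
        where open ≤-Reasoning

    heavy? : Decidable (λ X → Any (λ S → fromℕ d + fromℕ d + 1+1 < weight μ S) (independentSets X))
    heavy? X = Any.any? (λ S → (fromℕ d + fromℕ d + 1+1) <? weight μ S) (independentSets X)

    module _ {xs} (xs↭ : xs ↭ allFin n) (!xs : Unique xs) (xs↗ : AllPairs (λ u v → μ u ≤ μ v) xs)
             (T′ : ℕ) (t≤2T : t ≤ fromℕ (suc T′) * 1+1) (T≤t : fromℕ (suc T′) ≤ t) where

      private
        T = suc T′

        -- The ratio of the geometric series: at most (4T)^m sets of size m, each of probability at
        -- most z^m. From T ≤ t and 4t ≤ x follows 4tρ ≤ (4t/x)² ≤ 1, while the series sums to at
        -- most 2ρ.
        ρ : Carrier
        ρ = fromℕ (4 ℕ.* T) * z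

        0≤ρ : 0# ≤ ρ
        0≤ρ = *-nonneg (fromℕ-nonneg (4 ℕ.* T)) 0≤z

        4tρ≤1 : fromℕ 4 * t * ρ ≤ 1#
        4tρ≤1 = begin
          fromℕ 4 * t * ρ                                ≈⟨ *-congˡ (*-congʳ (×1-homo-* 4 T)) ⟩
          fromℕ 4 * t * (fromℕ 4 * fromℕ T * z)          ≤⟨ *-monoʳ-≤ 0≤4t (*-monoˡ-≤ 0≤z (*-monoʳ-≤ (fromℕ-nonneg 4) T≤t)) ⟩
          fromℕ 4 * t * (fromℕ 4 * t * (y * y))          ≈⟨ solve 2 (λ s y → s :* (s :* (y :* y)) := (s :* y) :* (s :* y)) refl (fromℕ 4 * t) y ⟩
          (fromℕ 4 * t * y) * (fromℕ 4 * t * y)          ≤⟨ *-mono-≤ (*-nonneg 0≤4t 0≤y) 0≤1 4ty≤1 4ty≤1 ⟩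
          1# * 1#                                        ≈⟨ *-identityʳ 1# ⟩
          1#                                             ∎
          where
          open ≤-Reasoning
          0≤4t : 0# ≤ fromℕ 4 * t
          0≤4t = *-nonneg (fromℕ-nonneg 4) (proj₁ 0<t)

        2ρ≤1 : 1+1 * ρ ≤ 1#
        2ρ≤1 = ≤-trans (*-monoˡ-≤ 0≤ρ (≤-trans 2≤t t≤4t)) 4tρ≤1
          where
          t≤4t : t ≤ fromℕ 4 * t
          t≤4t = diff≥0⇒≤ (solve 2 (λ t k → (con (+ 1) :+ k) :* t :- t := k :* t) refl t (fromℕ 3))
            (*-nonneg (fromℕ-nonneg 3) (proj₁ 0<t))

        -- Truncated subtraction keeps the whole list once T * m reaches n.
        heaviest : ℕ → List (Fin n)
        heaviest m = drop (n ℕ.∸ T ℕ.* m) xs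

        length-xs : length xs ≡ n
        length-xs = ≡.trans (↭-length xs↭) (List.length-tabulate {n = n} id)

        length-heaviest : ∀ m → length (heaviest m) ℕ.≤ T ℕ.* m
        length-heaviest m = begin
          length (heaviest m)              ≡⟨ List.length-drop (n ℕ.∸ T ℕ.* m) xs ⟩
          length xs ℕ.∸ (n ℕ.∸ T ℕ.* m)    ≡⟨ ≡.cong (ℕ._∸ (n ℕ.∸ T ℕ.* m)) length-xs ⟩
          n ℕ.∸ (n ℕ.∸ T ℕ.* m)            ≤⟨ ℕ.m≤n+o⇒m∸n≤o n (n ℕ.∸ T ℕ.* m) (ℕ.≤-trans (ℕ.m≤n+m∸n n (T ℕ.* m)) (ℕ.≤-reflexive (ℕ.+-comm (T ℕ.* m) _))) ⟩
          T ℕ.* m                          ∎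
          where open ℕ.≤-Reasoning

        -- An arbitrary m-subset of the segment may span few edges. Filtering by the wanted
        -- inequality itself keeps the sets that can occur as witnesses and gives each survivor its
        -- bound for free.
        Sparse : Pred (List (Fin n)) 0ℓ
        Sparse P = q ^ edgesWithin G P ≤ z ^ length P

        sparse? : Decidable Sparse
        sparse? P = q ^ edgesWithin G P ≤? z ^ length P

        -- The index k stands for m = k + 1: the empty set would contribute 1 to the sum.
        ofLength : ℕ → List (List (Fin n))
        ofLength k = combinations (suc k) (heaviest (suc k))

        candidates : List (List (Fin n))
        candidates = filter sparse? (concatMap ofLength (upTo n))

        candidates-mass : sumOver candidates (λ P → q ^ edgesWithin G P) ≤ 1# / (1+1 * t)
        candidates-mass = *≤⇒≤/ (*-pos 0<1+1 0<t) (begin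
          1+1 * t * sumOver candidates (λ P → q ^ edgesWithin G P)
            ≤⟨ *-monoʳ-≤ 0≤2t (sumOver-mono candidates λ P P∈ → proj₂ (∈-filter⁻ sparse? {xs = concatMap ofLength (upTo n)} P∈)) ⟩
          1+1 * t * sumOver candidates (λ P → z ^ length P)
            ≤⟨ *-monoʳ-≤ 0≤2t (sumOver-filter-≤ sparse? (concatMap ofLength (upTo n)) λ P _ → ^-nonneg 0≤z (length P)) ⟩
          1+1 * t * sumOver (concatMap ofLength (upTo n)) (λ P → z ^ length P)
            ≈⟨ *-congˡ (sumOver-concatMap ofLength (upTo n) λ P → z ^ length P) ⟩
          1+1 * t * sumOver (upTo n) (λ k → sumOver (ofLength k) λ P → z ^ length P)
            ≤⟨ *-monoʳ-≤ 0≤2t (sumOver-mono (upTo n) λ k _ → ofLength-mass k) ⟩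
          1+1 * t * sumOver (upTo n) (λ k → ρ * ρ ^ k)
            ≈⟨ *-congˡ (sumOver-*ˡ (upTo n) ρ (ρ ^_)) ⟩
          1+1 * t * (ρ * sumOver (upTo n) (ρ ^_))
            ≤⟨ *-monoʳ-≤ 0≤2t (*-monoʳ-≤ 0≤ρ (geometric-sum-≤ 0≤ρ 2ρ≤1 n)) ⟩
          1+1 * t * (ρ * 1+1)
            ≈⟨ solve 2 (λ t r → numeral 2 :* t :* (r :* numeral 2) := numeral 4 :* t :* r) refl t ρ ⟩
          fromℕ 4 * t * ρ
            ≤⟨ 4tρ≤1 ⟩
          1# ∎)
          where
          open ≤-Reasoning
          0≤2t : 0# ≤ 1+1 * t
          0≤2t = *-nonneg (proj₁ 0<1+1) (proj₁ 0<t)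
          ofLength-mass : ∀ k → sumOver (ofLength k) (λ P → z ^ length P) ≤ ρ * ρ ^ k
          ofLength-mass k = begin
            sumOver (ofLength k) (λ P → z ^ length P)
              ≤⟨ sumOver-mono (ofLength k) (λ P P∈ → ≤-reflexive (reflexive
                   (≡.cong (z ^_) (combinations-length (suc k) {heaviest (suc k)} P∈)))) ⟩
            sumOver (ofLength k) (λ _ → z ^ suc k)
              ≈⟨ sumOver-const (ofLength k) (z ^ suc k) ⟩
            fromℕ (length (ofLength k)) * z ^ suc k
              ≤⟨ *-monoˡ-≤ (^-nonneg 0≤z (suc k)) (fromℕ-mono-≤
                   (combinations-bound T (suc k) (heaviest (suc k)) (length-heaviest (suc k)))) ⟩
            fromℕ ((4 ℕ.* T) ℕ.^ suc k) * z ^ suc k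
              ≈⟨ *-congʳ (fromℕ-^ (4 ℕ.* T) (suc k)) ⟩
            fromℕ (4 ℕ.* T) ^ suc k * z ^ suc k
              ≈⟨ ^-distrib-* (fromℕ (4 ℕ.* T)) z (suc k) ⟨
            ρ * ρ ^ k ∎

        found : ∀ ω {I} → Independent (spanning G ω) I →
                ∀ {f} (greedy : AllSuffixes (GreedyAt (earlierNeighbours G I) f) xs) (I⊆G : I ⊆ₛ vertices G) →
                DenseSuffix G dual 0<t xs↭ xs↗ I⊆G d greedy →
                ∃[ P ] P ∈ candidates × All (¬_ ∘ Within G P) (select (edges G) ω)
        found ω {I} indep greedy I⊆G (ys , zs , b , eq , 1≤m , m≤b+b , db≤e , short) =
            P
          , ∈-filter⁺ sparse? (∈-concatMap⁺ ofLength (Any.map (λ { ≡.refl → P∈combinations }) (∈-upTo⁺ k<n)))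
              (sparse-mass m≤b+b db≤e)
          , independent-avoids G ω indep P (λ v v∈P → proj₂ (∈-filter⁻ (_∈ₛ? I) {xs = zs} v∈P))
          where
          P = filter (_∈ₛ? I) zs
          m = length P
          k = ℕ.pred m

          1+k≡m : suc k ≡ m
          1+k≡m = ℕ.suc-pred m {{ℕ.>-nonZero 1≤m}}

          lengths : length ys ℕ.+ length zs ≡ n
          lengths = ≡.trans (≡.sym (List.length-++ ys)) (≡.trans (≡.cong length (≡.sym eq)) length-xs)

          k<n : k ℕ.< n
          k<n = begin
            suc k                        ≡⟨ 1+k≡m ⟩
            m                            ≤⟨ List.length-filter (_∈ₛ? I) zs ⟩
            length zs                    ≤⟨ ℕ.m≤n+m (length zs) (length ys) ⟩
            length ys ℕ.+ length zs      ≡⟨ lengths ⟩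
            n                            ∎
            where open ℕ.≤-Reasoning

          zs≤Tm : length zs ℕ.≤ T ℕ.* m
          zs≤Tm = fromℕ-cancel-≤ (*-cancelˡ-≤ 0<1+1 (begin
            1+1 * fromℕ (length zs)      ≈⟨ *-comm 1+1 _ ⟩
            fromℕ (length zs) * 1+1      ≤⟨ short ⟩
            t * fromℕ m                  ≤⟨ *-monoˡ-≤ (fromℕ-nonneg m) t≤2T ⟩
            fromℕ T * 1+1 * fromℕ m      ≈⟨ solve 3 (λ a w m → a :* w :* m := w :* (a :* m)) refl (fromℕ T) 1+1 (fromℕ m) ⟩
            1+1 * (fromℕ T * fromℕ m)    ≈⟨ *-congˡ (×1-homo-* T m) ⟨
            1+1 * fromℕ (T ℕ.* m)        ∎))
            where open ≤-Reasoning

          dropped : n ℕ.∸ T ℕ.* m ℕ.≤ length ys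
          dropped = ℕ.m≤n+o⇒m∸n≤o n (T ℕ.* m) (begin
            n                            ≡⟨ lengths ⟨
            length ys ℕ.+ length zs      ≤⟨ ℕ.+-monoʳ-≤ (length ys) zs≤Tm ⟩
            length ys ℕ.+ T ℕ.* m        ≡⟨ ℕ.+-comm (length ys) (T ℕ.* m) ⟩
            T ℕ.* m ℕ.+ length ys        ∎)
            where open ℕ.≤-Reasoning

          P∈combinations : P ∈ ofLength k
          P∈combinations = ≡.subst (λ j → P ∈ combinations j (heaviest j)) (≡.sym 1+k≡m)
            (combinations-complete (⊆-trans (filter-⊆ (_∈ₛ? I) zs)
              (≡.subst (λ vs → zs ⊆ drop (n ℕ.∸ T ℕ.* m) vs) (≡.sym eq) (drop-suffix-⊆ (n ℕ.∸ T ℕ.* m) ys zs dropped))))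

        witness : ∀ ω → Any (λ S → fromℕ d + fromℕ d + 1+1 < weight μ S) (independentSets (spanning G ω)) →
                  ∃[ P ] P ∈ candidates × All (¬_ ∘ Within G P) (select (edges G) ω)
        witness ω heavy = from-heavy (Membership.find heavy)
          where
          from-heavy : (∃[ I ] I ∈ independentSets (spanning G ω) × fromℕ d + fromℕ d + 1+1 < weight μ I) →
                       ∃[ P ] P ∈ candidates × All (¬_ ∘ Within G P) (select (edges G) ω)
          from-heavy (I , I∈ , I-heavy) = from-greedy (greedy-colouring Fin._≟_ d (earlierNeighbours G I)
              (λ u vs v v∈ → proj₁ (∈-filter⁻ (λ v → v ∈ₛ? I ×-dec adj? G u v) v∈)) !xs)
            where
            I-indep = ∈-independentSets⁻ (spanning G ω) I∈
            I⊆G = proj₁ I-indep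
            from-greedy : (∃[ f ] AllSuffixes (GreedyAt {k = d} (earlierNeighbours G I) f) xs) →
                          ∃[ P ] P ∈ candidates × All (¬_ ∘ Within G P) (select (edges G) ω)
            from-greedy (f , greedy) = found ω I-indep greedy I⊆G
              (dense-suffix G dual 0<t xs↭ xs↗ I⊆G d greedy I-heavy)

      ℙ-heavy-sorted : ℙ G p heavy? ≤ 1# / (1+1 * t)
      ℙ-heavy-sorted = ≤-trans (union-bound 0<p p<1 G heavy? candidates witness) candidates-mass

    ℙ-heavy : ℙ G p heavy? ≤ 1# / (1+1 * χf G)
    ℙ-heavy = from-sorted (ascending μ) (half-ceiling (length (subsets n)) 2≤t (χf-bounded G))
      where
      from-sorted : (∃[ xs ] xs ↭ allFin n × Unique xs × AllPairs (λ u v → μ u ≤ μ v) xs) →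
                    (∃[ T ] χf G ≤ fromℕ (suc T) * 1+1 × fromℕ (suc T) ≤ χf G) →
                    ℙ G p heavy? ≤ 1# / (1+1 * χf G)
      from-sorted (xs , xs↭ , !xs , xs↗) (T , t≤2T , T≤t) = ℙ-heavy-sorted xs↭ !xs xs↗ T t≤2T T≤t

-- Subgraphs of high girth and the final bounds.

spanning-⊑ : ∀ {n} (G : Graph n) ω → spanning G ω ⊑ G
spanning-⊑ G ω = id , λ u v → proj₁ ∘ Equivalence.to T-∧

module HighGirthSubgraphs (ℝ : CompleteOrderedField) where
  open OrderedField ℝ
  open FiniteSums ℝ
  open GraphParameters ℝ
  open FractionalColourings ℝ
  open RandomSubgraphs ℝ
  open Logarithm ℝ
  open HeavyIndependentSets ℝ

  χf≤hf : ∀ r {n} (G H : Graph n) → H ⊑ G → Sup.[ r ] ≤⁺ girth H → χf H ≤ hf r G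
  χf≤hf r {n} G H H⊑G r≤girth = sup-upper _ (χf H , H , H⊑G , r≤girth , refl)
    (fromℕ (length (subsets n)) , λ { x (K , _ , _ , x≈) → ≤-trans (≤-reflexive x≈) (χf-bounded K) })
    (χf H) (H , H⊑G , r≤girth , refl)

  module _ {n} (G : Graph n) {μ} (dual : IsDualWeighting G μ) (r : ℕ)
           (X : Graph n) (X⊑G : X ⊑ G) (G⊆X : vertices G ⊆ₛ vertices X)
           {m : Carrier} (0<m : 0# < m) (light : ∀ S → Independent X S → weight μ S ≤ m)
           (d : ℕ) (λ≤d : maxShortCycles r X ℕ.≤ d) where
    open IsDualWeighting dual renaming (total to Σμ≈t)

    -- Colour classes induce subgraphs of X, so their independent sets are independent in X and
    -- inherit the bound m that weak duality needs. The sign of `hf r G` is returned because d and m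
    -- are later replaced by larger numbers.
    few-short-cycles⇒χf≤ : 0# ≤ hf r G × χf G ≤ fromℕ (suc d) * (m * hf r G)
    few-short-cycles⇒χf≤ = from-colouring (short-cycle-colouring r X d λ≤d)
      where
      from-colouring : (Σ[ f ∈ (Fin n → Maybe (Fin (suc d))) ]
          (∀ v → v ∈ₛ vertices X → ∃[ c ] f v ≡ just c) ×
          (∀ c → Sup.[ r ] ≤⁺ girth (induced X (colourClass f c)))) →
        0# ≤ hf r G × χf G ≤ fromℕ (suc d) * (m * hf r G)
      from-colouring (f , coloured , long) =
          ≤-trans (χf-nonneg (part Fin.zero)) (part-χf Fin.zero)
        , from-average (exists-above-average Fin.zero (List.tabulate Fin.suc) λ c → weight μ (vertices (part c)))
        where
        open ≤-Reasoning

        part : Fin (suc d) → Graph n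
        part c = induced X (colourClass f c)

        part-χf : ∀ c → χf (part c) ≤ hf r G
        part-χf c = χf≤hf r G (part c) (⊑-trans {G = part c} {X} {G} (induced-⊑ X (colourClass f c)) X⊑G) (long c)

        part-weight : ∀ c → weight μ (vertices (part c)) ≤ m * hf r G
        part-weight c = ≤-trans
          (weak-duality (part c) nonneg 0<m λ S → light S ∘ induced-independent X (colourClass f c))
          (*-monoʳ-≤ (proj₁ 0<m) (part-χf c))

        some-part : ∀ v (v∈? : Dec (v ∈ₛ vertices G)) →
                    μ v ≤ sumOver (allFin (suc d)) (λ c → ind (v ∈ₛ? vertices (part c)) * μ v)
        some-part v (no v∉G)  = ≤-trans (≤-reflexive (support v v∉G))
          (sumOver-nonneg (allFin (suc d)) λ c _ → *-nonneg (ind-nonneg (v ∈ₛ? vertices (part c))) (nonneg v))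
        some-part v (yes v∈G) = from-colour (coloured v (G⊆X v∈G))
          where
          from-colour : (∃[ c ] f v ≡ just c) → μ v ≤ sumOver (allFin (suc d)) (λ c → ind (v ∈ₛ? vertices (part c)) * μ v)
          from-colour (c , fv≡c) = begin
            μ v                                       ≈⟨ *-identityˡ (μ v) ⟨
            1# * μ v                                  ≈⟨ *-congʳ (ind-yes (v ∈ₛ? vertices (part c)) (x∈p∩q⁺ (G⊆X v∈G , ∈-colourClass⁺ f fv≡c))) ⟨
            ind (v ∈ₛ? vertices (part c)) * μ v       ≤⟨ ∈⇒≤-sumOver {f = λ c → ind (v ∈ₛ? vertices (part c)) * μ v}
                                                           (λ c → *-nonneg (ind-nonneg (v ∈ₛ? vertices (part c))) (nonneg v)) (∈-allFin c) ⟩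
            sumOver (allFin (suc d)) (λ c → ind (v ∈ₛ? vertices (part c)) * μ v) ∎

        t≤Σ : χf G ≤ sumOver (allFin (suc d)) (λ c → weight μ (vertices (part c)))
        t≤Σ = begin
          χf G
            ≈⟨ Σμ≈t ⟨
          sumOver (allFin n) μ
            ≤⟨ sumOver-mono (allFin n) (λ v _ → some-part v (v ∈ₛ? vertices G)) ⟩
          sumOver (allFin n) (λ v → sumOver (allFin (suc d)) λ c → ind (v ∈ₛ? vertices (part c)) * μ v)
            ≈⟨ sumOver-swap (allFin n) (allFin (suc d)) (λ v c → ind (v ∈ₛ? vertices (part c)) * μ v) ⟩
          sumOver (allFin (suc d)) (λ c → weight μ (vertices (part c))) ∎

        from-average : (∃[ c ] sumOver (allFin (suc d)) (λ c → weight μ (vertices (part c)))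
                               ≤ fromℕ (length (allFin (suc d))) * weight μ (vertices (part c))) →
                       χf G ≤ fromℕ (suc d) * (m * hf r G)
        from-average (c , Σ≤) = begin
          χf G                                                               ≤⟨ t≤Σ ⟩
          sumOver (allFin (suc d)) (λ c → weight μ (vertices (part c)))      ≤⟨ Σ≤ ⟩
          fromℕ (length (allFin (suc d))) * weight μ (vertices (part c))     ≤⟨ *-monoʳ-≤ (fromℕ-nonneg (length (allFin (suc d)))) (part-weight c) ⟩
          fromℕ (length (allFin (suc d))) * (m * hf r G)                     ≡⟨ ≡.cong (λ k → fromℕ k * (m * hf r G)) (List.length-tabulate {n = suc d} id) ⟩
          fromℕ (suc d) * (m * hf r G)                                       ∎

  module _ (r : ℕ) {n} (G : Graph n) (2≤t : 1+1 ≤ χf G) {p} (0<p : 0# < p) (p<1 : p < 1#) where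

    private
      t = χf G
      q = 1# - p
      b = 1# / q
      x = 1+1 * e * t
      M = fromℕ 8 * log b x + fromℕ 4

      0<t : 0# < t
      0<t = <-≤-trans 0<1+1 2≤t

      0<q : 0# < q
      0<q = <⇒diff>0 p<1

      qb≈1 : q * b ≈ 1#
      qb≈1 = /-*-cancel 0<q

      1<b : 1# < b
      1<b = ≰⇒> λ b≤1 → <⇒≱ 0<p (diff≥0⇒≤ (solve 1 (λ p → con (+ 0) :- p := con (+ 1) :- p :- con (+ 1)) refl p)
        (≤⇒diff≥0 (begin
          1#         ≈⟨ qb≈1 ⟨
          q * b      ≤⟨ *-monoʳ-≤ (proj₁ 0<q) b≤1 ⟩
          q * 1#     ≈⟨ *-identityʳ q ⟩
          q          ∎)))
        where open ≤-Reasoning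

      4t≤x : fromℕ 4 * t ≤ x
      4t≤x = begin
        fromℕ 4 * t        ≈⟨ *-congʳ (×1-homo-* 2 2) ⟩
        1+1 * 1+1 * t      ≤⟨ *-monoˡ-≤ (proj₁ 0<t) (*-monoʳ-≤ (proj₁ 0<1+1) 2≤e) ⟩
        1+1 * e * t        ∎
        where open ≤-Reasoning

      1≤x : 1# ≤ x
      1≤x = begin
        1#                 ≈⟨ *-identityʳ 1# ⟨
        1# * 1#            ≤⟨ *-mono-≤ 0≤1 (fromℕ-nonneg 4) (1≤fromℕ-suc 3) (≤-trans (1≤fromℕ-suc 1) 2≤t) ⟩
        fromℕ 4 * t        ≤⟨ 4t≤x ⟩
        x                  ∎
        where open ≤-Reasoning

      module _ (d : ℕ) (x⁴≤b^d : x ^ 4 ≤ b ^ d) (d≤ : fromℕ d ≤ fromℕ 4 * log b x + 1#) where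

        q^d*x⁴≤1 : q ^ d * x ^ 4 ≤ 1#
        q^d*x⁴≤1 = begin
          q ^ d * x ^ 4      ≤⟨ *-monoʳ-≤ (^-nonneg (proj₁ 0<q) d) x⁴≤b^d ⟩
          q ^ d * b ^ d      ≈⟨ ^-distrib-* q b d ⟨
          (q * b) ^ d        ≤⟨ ^-≤-1 (≤-trans 0≤1 (≤-reflexive (sym qb≈1))) (≤-reflexive qb≈1) d ⟩
          1#                 ∎
          where open ≤-Reasoning

        m = fromℕ d + fromℕ d + 1+1

        0<m : 0# < m
        0<m = <-≤-trans 0<1+1 (≤-trans (≤-reflexive (sym (+-identityˡ 1+1)))
          (+-monoˡ-≤ 1+1 (+-nonneg (fromℕ-nonneg d) (fromℕ-nonneg d))))

        -- The origin of the constants 8 and 4: d ≤ 4L + 1 turns 2d + 2 into 8L + 4.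
        m≤M : m ≤ M
        m≤M = begin
          fromℕ d + fromℕ d + 1+1      ≤⟨ +-monoˡ-≤ 1+1 (+-mono-≤ d≤ d≤) ⟩
          (fromℕ 4 * L + 1#) + (fromℕ 4 * L + 1#) + 1+1
            ≈⟨ solve 2 (λ k l → (k :* l :+ con (+ 1)) :+ (k :* l :+ con (+ 1)) :+ numeral 2
                             := (k :+ k) :* l :+ numeral 4) refl (fromℕ 4) L ⟩
          (fromℕ 4 + fromℕ 4) * L + fromℕ 4      ≈⟨ +-congʳ (*-congʳ (×-homo-+ 1# 4 4)) ⟨
          M                            ∎
          where
          open ≤-Reasoning
          L = log b x

        heavy?′ : Decidable (λ X → Any (λ S → m < weight (proj₁ (strong-duality G)) S) (independentSets X))
        heavy?′ = heavy? G (proj₂ (strong-duality G)) 2≤t 0<p p<1 4t≤x d q^d*x⁴≤1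

        module _ {D} (0≤D : 0# ≤ D)
                 (likely : 1# / (1+1 * t) < ℙ G p (λ X → fromℕ (maxShortCycles r X) ≤? D)) where

          -- Otherwise every outcome with few short cycles would have a heavy independent set, and
          -- the likely event would have probability at most 1/(2t).
          typical : ¬ ¬ (∃[ ω ] fromℕ (maxShortCycles r (spanning G ω)) ≤ D ×
                     ¬ Any (λ S → m < weight (proj₁ (strong-duality G)) S) (independentSets (spanning G ω)))
          typical none = <⇒≱ likely (≤-trans
            (ℙ-mono 0<p p<1 G (λ X → fromℕ (maxShortCycles r X) ≤? D) heavy?′ λ ω λ≤D →
              decidable-stable (heavy?′ (spanning G ω)) λ ¬heavy → none (ω , λ≤D , ¬heavy))
            (ℙ-heavy G (proj₂ (strong-duality G)) 2≤t 0<p p<1 4t≤x d q^d*x⁴≤1))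

          bound : (∃[ ω ] fromℕ (maxShortCycles r (spanning G ω)) ≤ D ×
                     ¬ Any (λ S → m < weight (proj₁ (strong-duality G)) S) (independentSets (spanning G ω))) →
                  t ≤ (D + 1#) * M * hf r G
          bound (ω , λ≤D , ¬heavy) = conclude (few-short-cycles⇒χf≤ G (proj₂ (strong-duality G)) r X (spanning-⊑ G ω) id 0<m
              (λ S S-indep → ≤-stable λ S≰m → ¬heavy (Membership.lose (∈-independentSets⁺ X S-indep) (≰⇒> S≰m)))
              -- D is a real number, so colours are counted with the actual maximum k, and 1 + k ≤ D
              -- + 1 is applied afterwards.
              (maxShortCycles r X) ℕ.≤-refl)
            where
            open ≤-Reasoning
            X = spanning G ω
            k = maxShortCycles r X
            conclude : 0# ≤ hf r G × t ≤ fromℕ (suc k) * (m * hf r G) → t ≤ (D + 1#) * M * hf r G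
            conclude (0≤hf , t≤) = begin
              t                                  ≤⟨ t≤ ⟩
              (1# + fromℕ k) * (m * hf r G)      ≤⟨ *-mono-≤ (*-nonneg (proj₁ 0<m) 0≤hf) (+-nonneg 0≤D 0≤1)
                                                      (≤-trans (+-monoʳ-≤ 1# λ≤D) (≤-reflexive (+-comm 1# D)))
                                                      (*-monoˡ-≤ 0≤hf m≤M) ⟩
              (D + 1#) * (M * hf r G)            ≈⟨ *-assoc (D + 1#) M (hf r G) ⟨
              (D + 1#) * M * hf r G              ∎

    -- Dividing by M requires M > 0, which follows from M ≥ 2d + 2 as soon as d is available; hence
    -- it shares the double negation with the bound.
    0<M×χf≤ : ∀ {D} → 0# ≤ D → 1# / (1+1 * t) < ℙ G p (λ X → fromℕ (maxShortCycles r X) ≤? D) →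
              ¬ ¬ (0# < M × t ≤ (D + 1#) * M * hf r G)
    0<M×χf≤ 0≤D likely ¬bound = log-nearest 1<b 1≤x λ { (d , x⁴≤b^d , d≤) →
      typical d x⁴≤b^d d≤ 0≤D likely λ ω → ¬bound
        (<-≤-trans (0<m d x⁴≤b^d d≤) (m≤M d x⁴≤b^d d≤) , bound d x⁴≤b^d d≤ 0≤D likely ω) }

    few-short-cycles : ∀ D → 0# ≤ D → 1# / (1+1 * t) < ℙ G p (λ X → fromℕ (maxShortCycles r X) ≤? D) →
                       t / ((D + 1#) * M) ≤ hf r G
    few-short-cycles D 0≤D likely = ≤-stable λ ≰hf → 0<M×χf≤ 0≤D likely λ (0<M , t≤) →
      ≰hf (≤*⇒/≤ (*-pos (<-≤-trans 0<1 (≤-trans (≤-reflexive (sym (+-identityˡ 1#))) (+-monoˡ-≤ 1# 0≤D))) 0<M) t≤)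

    disjoint-short-cycles : 1# / (1+1 * t) < ℙ G p (disjointShortCycles? r) → t / (1+1 * M) ≤ hf r G
    disjoint-short-cycles likely = ≤-stable λ ≰hf → 0<M×χf≤ 0≤1 (<-≤-trans likely
        (ℙ-mono 0<p p<1 G (disjointShortCycles? r) (λ X → fromℕ (maxShortCycles r X) ≤? 1#) λ ω disjoint →
          ≤-trans (fromℕ-mono-≤ (disjoint⇒maxShortCycles≤1 r (spanning G ω) disjoint)) (≤-reflexive (+-identityʳ 1#))))
      λ (0<M , t≤) → ≰hf (≤*⇒/≤ (*-pos 0<1+1 0<M)
        (≤-trans t≤ (≤-reflexive (*-congʳ (*-congʳ (+-congˡ (sym (+-identityʳ 1#))))))))

proposition9p13 : (ℝ : CompleteOrderedField) →
    let open CompleteOrderedField ℝ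
        open GraphParameters ℝ in
    (r : ℕ) → 4 ℕ.≤ r →
    (n : ℕ) (G : Graph n) →
    let t = χf G in
    fromℕ 2 ≤ t →
    (p : Carrier) → 0# < p → p < 1# →
    let M = fromℕ 8 * log (1# / (1# - p)) (fromℕ 2 * e * t) + fromℕ 4 in
    ((D : Carrier) → 0# ≤ D →
      1# / (fromℕ 2 * t) < ℙ G p (λ X → fromℕ (maxShortCycles r X) ≤? D) →
      t / ((D + 1#) * M) ≤ hf r G)
    ×
    (1# / (fromℕ 2 * t) < ℙ G p (disjointShortCycles? r) →
      t / (fromℕ 2 * M) ≤ hf r G)
proposition9p13 ℝ r _ n G 2≤t p 0<p p<1 =
  few-short-cycles r G 2≤t 0<p p<1 , disjoint-short-cycles r G 2≤t 0<p p<1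
  where open HighGirthSubgraphs ℝ
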